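{- For all $L\in\mathbf N$, all integers $\nu\ge 1$, and all $s\in\{0,1,\ldots,\nu-1\}$, $$G\left(L,\;L+1+2s,\;(\nu+1)\left(1+\frac{1+2s}{2\nu+1}\right),\;(\nu+1)\left(1-\frac{1+2s}{2\nu+1}\right),\;2\nu+1,\;q\right)\geq 0.$$
   Context: $\mathbf N$ denotes the set of nonnegative integers. For $m\in\mathbf N$, $(q)_m=\prod_{j=1}^m(1-q^j)$, with $(q)_0=1$. The $q$-binomial coefficient is $\begin{bmatrix} m+n\\ m\end{bmatrix}_q=\frac{(q)_{m+n}}{(q)_m(q)_n}$ if $m,n\in\mathbf N$, and it is $0$ otherwise (so $\begin{bmatrix} A\\ B\end{bmatrix}_q=0$ unless $0\le B\le A$). Define $$G(N,M,\alpha,\beta,K,q)=\sum_{j=-\infty}^\infty(-1)^j q^{Kj\frac{(\alpha+\beta)j+(\alpha-\beta)}{2}}\begin{bmatrix} N+M\\ N-Kj\end{bmatrix}_q .$$ The notation $P(q)\ge 0$ means that $P(q)$ is a polynomial in $q$ with nonnegative coefficients. -}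

module Defs where

open import Data.Integer.Base as ℤ using (ℤ; +_; +[1+_]; -[1+_]; 0ℤ; 1ℤ; -1ℤ; ∣_∣)
import Data.Integer.Properties as ℤₚ
open import Data.List.Base using (List; []; _∷_)
open import Data.List.Relation.Unary.All using (All)
open import Data.Nat.Base as ℕ using (ℕ; zero; suc; NonZero)
import Data.Nat.Properties as ℕₚ
open import Data.Bool.Base using (if_then_else_)
open import Data.Product.Base using (_×_; ∃-syntax)
open import Data.Rational.Base as ℚ using (ℚ; mkℚ; ½)
open import Relation.Binary.PropositionalEquality

-- Formal power series in q over ℤ: f n is the coefficient of qⁿ.
Series : Set
Series = ℕ → ℤ

tail : Series → Series
tail f n = f (suc n)

0# : Series
0# _ = 0ℤ

q^_ : ℕ → Series
(q^ k) n = if n ℕ.≡ᵇ k then 1ℤ else 0ℤ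

infixl 6 _⊝_
infixl 7 _⊛_ _÷_

_⊝_ : Series → Series → Series
(f ⊝ g) n = f n ℤ.- g n

-- Cauchy product.
_⊛_ : Series → Series → Series
(f ⊛ g) zero    = f 0 ℤ.* g 0
(f ⊛ g) (suc n) = f 0 ℤ.* g (suc n) ℤ.+ (tail f ⊛ g) n

-- Long division of power series, meaningful when g 0 ≡ 1; see ÷-⊛.
_÷_ : Series → Series → Series
(f ÷ g) zero    = f 0
(f ÷ g) (suc n) = ((λ k → f (suc k) ℤ.- f 0 ℤ.* g (suc k)) ÷ g) n

÷-⊛ : ∀ f g → g 0 ≡ 1ℤ → ∀ n → ((f ÷ g) ⊛ g) n ≡ f n
÷-⊛ f g g₀ zero    = trans (cong (f 0 ℤ.*_) g₀) (ℤₚ.*-identityʳ (f 0))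
÷-⊛ f g g₀ (suc n) = begin
  a ℤ.+ ((f′ ÷ g) ⊛ g) n     ≡⟨ cong (λ x → a ℤ.+ x) (÷-⊛ f′ g g₀ n) ⟩
  a ℤ.+ (f (suc n) ℤ.- a)    ≡⟨ ℤₚ.+-comm a _ ⟩
  f (suc n) ℤ.- a ℤ.+ a      ≡⟨ ℤₚ.+-assoc (f (suc n)) (ℤ.- a) a ⟩
  f (suc n) ℤ.+ (ℤ.- a ℤ.+ a) ≡⟨ cong (λ x → f (suc n) ℤ.+ x) (ℤₚ.+-inverseˡ a) ⟩
  f (suc n) ℤ.+ 0ℤ           ≡⟨ ℤₚ.+-identityʳ _ ⟩
  f (suc n)                  ∎
  where
  open ≡-Reasoning
  a  = f 0 ℤ.* g (suc n)
  f′ : Series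
  f′ k = f (suc k) ℤ.- f 0 ℤ.* g (suc k)

-- (q)ₘ = (1 - q)(1 - q²)⋯(1 - qᵐ)
⟨q⟩ : ℕ → Series
⟨q⟩ zero    = q^ 0
⟨q⟩ (suc m) = ⟨q⟩ m ⊛ (q^ 0 ⊝ q^ suc m)

⟨q⟩₀≡1 : ∀ m → ⟨q⟩ m 0 ≡ 1ℤ
⟨q⟩₀≡1 zero    = refl
⟨q⟩₀≡1 (suc m) = cong (ℤ._* 1ℤ) (⟨q⟩₀≡1 m)

-- qBinomial m n is the q-binomial coefficient with top entry m + n and
-- bottom entry m.
qBinomial : ℤ → ℤ → Series
qBinomial (+ m) (+ n) = ⟨q⟩ (m ℕ.+ n) ÷ (⟨q⟩ m ⊛ ⟨q⟩ n)
qBinomial _     _     = 0#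

qBinomial-quotient : ∀ m n k →
  (qBinomial (+ m) (+ n) ⊛ (⟨q⟩ m ⊛ ⟨q⟩ n)) k ≡ ⟨q⟩ (m ℕ.+ n) k
qBinomial-quotient m n =
  ÷-⊛ (⟨q⟩ (m ℕ.+ n)) (⟨q⟩ m ⊛ ⟨q⟩ n) (cong₂ ℤ._*_ (⟨q⟩₀≡1 m) (⟨q⟩₀≡1 n))

[_choose_] : ℤ → ℤ → Series
[ A choose B ] = qBinomial B (A ℤ.- B)

-- For general α and β the exponents of q in G are rational and may be
-- negative, so G is a formal sum of rational powers of q: F e is the
-- coefficient of qᵉ.
FormalSum : Set
FormalSum = ℚ → ℤ

⌈_⌉ : Series → FormalSum
⌈ f ⌉ (mkℚ (+ n) 0 _) = f n
⌈ f ⌉ _               = 0ℤ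

q^_·_ : ℚ → Series → FormalSum
(q^ r · f) e = ⌈ f ⌉ (e ℚ.- r)

-- The sum of f j over all integers j with ∣ j ∣ ≤ J.
Σ∣j∣≤ : ℕ → (ℤ → ℤ) → ℤ
Σ∣j∣≤ zero    f = f 0ℤ
Σ∣j∣≤ (suc J) f = Σ∣j∣≤ J f ℤ.+ (f (+[1+ J ]) ℤ.+ f (-[1+ J ]))

exponent : ℚ → ℚ → ℕ → ℤ → ℚ
exponent α β K j =
  fromℤ (+ K) ℚ.* fromℤ j ℚ.* (((α ℚ.+ β) ℚ.* fromℤ j ℚ.+ (α ℚ.- β)) ℚ.* ½)
  where
  fromℤ : ℤ → ℚ
  fromℤ i = i ℚ./ 1

summand : (N M : ℕ) (α β : ℚ) (K : ℕ) → ℤ → FormalSum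
summand N M α β K j e =
  -1ℤ ℤ.^ ∣ j ∣ ℤ.*
  (q^ exponent α β K j · [ + (N ℕ.+ M) choose + N ℤ.- + K ℤ.* j ]) e

-- The sum over all integers j.  As K ≥ 1, the q-binomial coefficient vanishes
-- when ∣ j ∣ > N + M, so the sum is cut off there; G-complete shows that
-- nothing is lost.
G : (N M : ℕ) (α β : ℚ) (K : ℕ) .{{_ : NonZero K}} → FormalSum
G N M α β K e = Σ∣j∣≤ (N ℕ.+ M) (λ j → summand N M α β K j e)

-- P ≥0: P is a polynomial in q with nonnegative coefficients.
coefficient : List ℤ → Series
coefficient []      _       = 0ℤ
coefficient (c ∷ p) zero    = c
coefficient (c ∷ p) (suc n) = coefficient p n

infix 4 _≥0

_≥0 : FormalSum → Set
P ≥0 = ∃[ p ] (∀ e → P e ≡ ⌈ coefficient p ⌉ e) × All (0ℤ ℤ.≤_) p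

private
  ⊖-neg : ∀ {m n} → m ℕ.< n → m ℤ.⊖ n ℤ.< 0ℤ
  ⊖-neg {m} {n} m<n =
    subst (m ℤ.⊖ n ℤ.<_) (ℤₚ.n⊖n≡0 n) (ℤₚ.⊖-monoˡ-< n m<n)

  negˡ : ∀ {i} j n → i ℤ.< 0ℤ → qBinomial i j n ≡ 0ℤ
  negˡ j n ℤ.-<+ = refl
  negˡ j n (ℤ.+<+ ())

  negʳ : ∀ i {j} n → j ℤ.< 0ℤ → qBinomial i j n ≡ 0ℤ
  negʳ (+ _)    n ℤ.-<+ = refl
  negʳ -[1+ _ ] n ℤ.-<+ = refl
  negʳ i n (ℤ.+<+ ())

  bound : ∀ {a J} k → a ℕ.≤ J → a ℕ.< suc k ℕ.* suc J
  bound {a} {J} k a≤J = ℕₚ.≤-trans (ℕ.s≤s a≤J) (ℕₚ.m≤m+n (suc J) (k ℕ.* suc J))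

  vanish⁺ : ∀ N M K .{{_ : NonZero K}} J → N ℕ.+ M ℕ.≤ J → ∀ n →
    [ + (N ℕ.+ M) choose + N ℤ.- + K ℤ.* +[1+ J ] ] n ≡ 0ℤ
  vanish⁺ N M (suc k) J le n =
    negˡ _ n (⊖-neg (bound k (ℕₚ.≤-trans (ℕₚ.m≤m+n N M) le)))

  vanish⁻ : ∀ N M K .{{_ : NonZero K}} J → N ℕ.+ M ℕ.≤ J → ∀ n →
    [ + (N ℕ.+ M) choose + N ℤ.- + K ℤ.* -[1+ J ] ] n ≡ 0ℤ
  vanish⁻ N M (suc k) J le n = negʳ (+ (N ℕ.+ suc k ℕ.* suc J)) n
    (subst (ℤ._< 0ℤ) (sym (ℤₚ.m-n≡m⊖n (N ℕ.+ M) (N ℕ.+ suc k ℕ.* suc J)))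
      (⊖-neg (ℕₚ.+-monoʳ-< N
        (bound k (ℕₚ.≤-trans (ℕₚ.m≤n+m M N) le)))))

  ⌈0⌉ : ∀ f → (∀ n → f n ≡ 0ℤ) → ∀ e → ⌈ f ⌉ e ≡ 0ℤ
  ⌈0⌉ f z (mkℚ (+ n)    0       _) = z n
  ⌈0⌉ f z (mkℚ (+ n)    (suc _) _) = refl
  ⌈0⌉ f z (mkℚ -[1+ _ ] _       _) = refl

  summand-vanish : ∀ N M α β K j →
    (∀ n → [ + (N ℕ.+ M) choose + N ℤ.- + K ℤ.* j ] n ≡ 0ℤ) →
    ∀ e → summand N M α β K j e ≡ 0ℤ
  summand-vanish N M α β K j z e =
    trans (cong (-1ℤ ℤ.^ ∣ j ∣ ℤ.*_) (⌈0⌉ _ z (e ℚ.- exponent α β K j)))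
          (ℤₚ.*-zeroʳ (-1ℤ ℤ.^ ∣ j ∣))

  stable : ∀ (f : ℤ → ℤ) a →
    (∀ J → a ℕ.≤ J → f (+[1+ J ]) ≡ 0ℤ) → (∀ J → a ℕ.≤ J → f (-[1+ J ]) ≡ 0ℤ) →
    ∀ d → Σ∣j∣≤ (d ℕ.+ a) f ≡ Σ∣j∣≤ a f
  stable f a p m zero    = refl
  stable f a p m (suc d) = trans
    (cong₂ ℤ._+_ (stable f a p m d)
      (cong₂ ℤ._+_ (p (d ℕ.+ a) (ℕₚ.m≤n+m a d)) (m (d ℕ.+ a) (ℕₚ.m≤n+m a d))))
    (ℤₚ.+-identityʳ _)

G-complete : ∀ N M α β K .{{_ : NonZero K}} J → N ℕ.+ M ℕ.≤ J → ∀ e →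
  Σ∣j∣≤ J (λ j → summand N M α β K j e) ≡ G N M α β K e
G-complete N M α β K J le e =
  subst (λ x → Σ∣j∣≤ x f ≡ Σ∣j∣≤ (N ℕ.+ M) f) (ℕₚ.m∸n+n≡m le)
    (stable f (N ℕ.+ M)
      (λ i h → summand-vanish N M α β K (+[1+ i ]) (vanish⁺ N M K i h) e)
      (λ i h → summand-vanish N M α β K (-[1+ i ]) (vanish⁻ N M K i h) e)
      (J ℕ.∸ (N ℕ.+ M)))
  where
  f : ℤ → ℤ
  f j = summand N M α β K j e

{-# OPTIONS --safe #-}

-- Write [m,n] for the q-binomial coefficient with top entry m + n and bottom
-- entry m.  By the q-Saalschütz sum, the Burge transform
--   Σᵢ q^(i² - b²) [2L, M - i] [L - i + a, i - b] [L - i - a, i + b]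
--     = [L + a + b, M - b] [L - a - b, M + b]
-- turns a nonnegative alternating sum over j of such doubly bounded products,
-- with a and b linear in j, into another one.  Starting from
--   Σⱼ (-1)ʲ q^(j²) [L + j, M - j] [L - j, M + j],
-- which satisfies the Pascal recurrence of the q²-binomial coefficients, and
-- from an antisymmetric sum that vanishes, Burge transforms and one use of
-- Pascal's rule give the case a = ν j + s/2, b = j + 1/2.  A further Burge
-- transform with the roles of a and b exchanged gives b = (ν + 1) j + (s + 1)/2,
-- and the q-Vandermonde sum then merges each product into a single q-binomial
-- coefficient [L - K j, L + 1 + 2s + K j] with K = 2ν + 1.
module Submission where

open import Algebra.Bundles using (CommutativeRing)
import Algebra.Construct.Pointwise as Pointwise
import Algebra.Properties.Semiring.Exp as Exp
import Algebra.Solver.Ring.NaturalCoefficients.Default as RingSolver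
open import Data.Integer.Base as ℤ using (ℤ; +_; -[1+_]; 0ℤ; 1ℤ; -1ℤ)
import Data.Integer.Properties as ℤ
import Data.Integer.Tactic.RingSolver as ℤSolver
open import Data.List.Base using (List; []; _∷_; map)
open import Data.List.Relation.Unary.All as All using (All; []; _∷_)
import Data.List.Relation.Unary.All.Properties as All
import Data.Nat.Coprimality as Coprimality
open import Data.Nat.Base as ℕ using (ℕ; zero; suc; _∸_; s≤s; z≤n)
import Data.Nat.Properties as ℕ
import Data.Nat.Tactic.RingSolver as ℕSolver
open import Data.Product.Base using (_×_; _,_; ∃-syntax)
open import Data.Rational.Base as ℚ using (ℚ; mkℚ; ½)
import Data.Rational.Properties as ℚ
import Data.Rational.Solver as ℚSolver
import Data.Rational.Unnormalised.Base as ℚᵘ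
import Data.Rational.Unnormalised.Properties as ℚᵘ
open import Data.Sum.Base using (_⊎_; inj₁; inj₂)
open import Level using (0ℓ)
import Relation.Binary.Reasoning.Setoid as SetoidReasoning
open import Relation.Binary.PropositionalEquality as ≡ using (_≡_; _≢_; _≗_)
open import Relation.Nullary.Decidable using (yes; no)
open import Relation.Nullary.Negation using (contradiction)

-- A Burge transform replaces a by a + b. With b = j + 1/2 it raises ν and s together and fixes ν -
-- s, so each value of ν - s needs its own start, with s = 0. Pascal's rule splits such a start into
-- a sum with b = j, for which transforms keep s = 0 and lead back to the q²-binomial case, and a
-- sum with s = 1 and the same ν, which is a transform of the start for ν - 1. The vanishing
-- antisymmetric sum ends this descent at ν = 0. In the last product the multipliers of j are ν and
-- ν + 1 and the constants are s/2 and (s + 1)/2. The q-Vandermonde sum adds them, which is the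
-- origin of K = 2ν + 1 and of the offset 1 + 2s. The obstacle is that q-Saalschütz needs 2a and 2b
-- to be natural numbers, whereas a and b change sign with j and, like L and M, may be
-- half-integers. Hence the integer parameters of `F`, and the separate treatment of j = n and j =
-- -1 - n in the termwise identities.

module QBinomials {c ℓ} (R : CommutativeRing c ℓ) (q : CommutativeRing.Carrier R) where

  open CommutativeRing R
  open Exp semiring using (_^_; ^-homo-*; ^-congʳ)
  open RingSolver commutativeSemiring using (solve; _:=_; _:+_; _:*_; con)
  open SetoidReasoning setoid
  import Algebra.Properties.Ring ring as RingProperties

  -- Pascal's rules and trinomial revision for q-binomial coefficients.

  q^+ : ∀ m n → q ^ (m ℕ.+ n) ≈ q ^ m * q ^ n
  q^+ = ^-homo-* q

  q^≡ : ∀ {m n} → m ≡ n → q ^ m ≈ q ^ n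
  q^≡ = ^-congʳ q

  ≈0ʳ : ∀ x {y} → y ≈ 0# → x * y ≈ 0#
  ≈0ʳ x y≈0 = trans (*-congˡ y≈0) (zeroʳ x)

  ≈0ˡ : ∀ {x} y → x ≈ 0# → x * y ≈ 0#
  ≈0ˡ y x≈0 = trans (*-congʳ x≈0) (zeroˡ y)

  -- bin n k has top entry n and bottom entry k, whereas h and gauss below take
  -- two numbers that add up to the top entry.
  bin : ℕ → ℕ → Carrier
  bin n       zero    = 1#
  bin zero    (suc k) = 0#
  bin (suc n) (suc k) = bin n k + q ^ suc k * bin n (suc k)

  bin-> : ∀ {n k} → n ℕ.< k → bin n k ≈ 0#
  bin-> {zero}  {suc k} _         = refl
  bin-> {suc n} {suc k} (s≤s n<k) = begin
    bin n k + q ^ suc k * bin n (suc k)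
      ≈⟨ +-cong (bin-> n<k) (≈0ʳ _ (bin-> (ℕ.m≤n⇒m≤1+n n<k))) ⟩
    0# + 0# ≈⟨ +-identityˡ 0# ⟩
    0#      ∎

  bin-diag : ∀ n → bin n n ≈ 1#
  bin-diag zero    = refl
  bin-diag (suc n) = begin
    bin n n + q ^ suc n * bin n (suc n)
      ≈⟨ +-cong (bin-diag n) (≈0ʳ _ (bin-> {n} ℕ.≤-refl)) ⟩
    1# + 0# ≈⟨ +-identityʳ 1# ⟩
    1#      ∎

  -- When n < k the truncated exponent multiplies bin n k ≈ 0.
  bin-pascal : ∀ n k → bin (suc n) (suc k) ≈ bin n (suc k) + q ^ (n ∸ k) * bin n k
  bin-pascal zero zero = solve 1 (λ x → con 1 :+ x :* con 0 := con 0 :+ con 1 :* con 1) refl (q ^ 1)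
  bin-pascal zero (suc k) =
    solve 1 (λ x → con 0 :+ x :* con 0 := con 0 :+ con 1 :* con 0) refl (q ^ suc (suc k))
  bin-pascal (suc n) zero = begin
    1# + q * 1# * bin (suc n) 1                ≈⟨ +-congˡ (*-congˡ (bin-pascal n 0)) ⟩
    1# + q * 1# * (bin n 1 + q ^ n * 1#)
      ≈⟨ solve 3 (λ x b y → con 1 :+ x :* con 1 :* (b :+ y :* con 1)
                          := (con 1 :+ x :* con 1 :* b) :+ x :* y :* con 1) refl q (bin n 1) (q ^ n) ⟩
    (1# + q * 1# * bin n 1) + q * q ^ n * 1#   ∎
  bin-pascal (suc n) (suc k) = begin
    bin (suc n) (suc k) + q ^ suc (suc k) * bin (suc n) (suc (suc k))
      ≈⟨ +-cong (bin-pascal n k) (*-congˡ (bin-pascal n (suc k))) ⟩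
    (b + q ^ (n ∸ k) * a) + q ^ suc (suc k) * (d + q ^ (n ∸ suc k) * b)
      ≈⟨ solve 6 (λ a b d x y z → (b :+ x :* a) :+ y :* (d :+ z :* b)
                               := (b :+ y :* d) :+ (x :* a :+ y :* z :* b)) refl
           a b d (q ^ (n ∸ k)) (q ^ suc (suc k)) (q ^ (n ∸ suc k)) ⟩
    (b + q ^ suc (suc k) * d) + (q ^ (n ∸ k) * a + q ^ suc (suc k) * q ^ (n ∸ suc k) * b)
      ≈⟨ +-congˡ (+-congˡ exchange) ⟩
    (b + q ^ suc (suc k) * d) + (q ^ (n ∸ k) * a + q ^ (n ∸ k) * q ^ suc k * b)
      ≈⟨ +-congˡ (solve 4 (λ a b x y → x :* a :+ x :* y :* b := x :* (a :+ y :* b)) refl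
           a b (q ^ (n ∸ k)) (q ^ suc k)) ⟩
    (b + q ^ suc (suc k) * d) + q ^ (n ∸ k) * (a + q ^ suc k * b) ∎
    where
    a = bin n k
    b = bin n (suc k)
    d = bin n (suc (suc k))
    -- Both exponents equal n + 1 when k < n. Otherwise `b` vanishes, which makes the truncated
    -- subtractions harmless.
    exchange : q ^ suc (suc k) * q ^ (n ∸ suc k) * b ≈ q ^ (n ∸ k) * q ^ suc k * b
    exchange with suc k ℕ.≤? n
    ... | no k≮n = trans (≈0ʳ _ b≈0) (sym (≈0ʳ _ b≈0))
      where b≈0 = bin-> (ℕ.≰⇒> k≮n)
    ... | yes k<n = *-congʳ (begin
      q ^ suc (suc k) * q ^ (n ∸ suc k) ≈⟨ q^+ (suc (suc k)) (n ∸ suc k) ⟨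
      q ^ (suc (suc k) ℕ.+ (n ∸ suc k))
        ≈⟨ q^≡ (≡.trans (≡.cong suc (ℕ.m+[n∸m]≡n k<n))
             (≡.trans (≡.cong suc (≡.sym (ℕ.m∸n+n≡m (ℕ.<⇒≤ k<n)))) (≡.sym (ℕ.+-suc (n ∸ k) k)))) ⟩
      q ^ ((n ∸ k) ℕ.+ suc k)           ≈⟨ q^+ (n ∸ k) (suc k) ⟩
      q ^ (n ∸ k) * q ^ suc k           ∎)

  h : ℕ → ℕ → Carrier
  h m n = bin (m ℕ.+ n) n

  h-zeroˡ : ∀ n → h 0 n ≈ 1#
  h-zeroˡ = bin-diag

  h-pascalˡ : ∀ m n → h (suc m) (suc n) ≈ h m (suc n) + q ^ suc m * h (suc m) n
  h-pascalˡ m n = trans (bin-pascal (m ℕ.+ suc n) n) (+-congˡ (*-cong (q^≡ e₁) (reflexive e₂)))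
    where
    e₁ : m ℕ.+ suc n ∸ n ≡ suc m
    e₁ = ≡.trans (≡.cong (_∸ n) (ℕ.+-suc m n)) (ℕ.m+n∸n≡m (suc m) n)
    e₂ : bin (m ℕ.+ suc n) n ≡ h (suc m) n
    e₂ = ≡.cong (λ x → bin x n) (ℕ.+-suc m n)

  h-pascalʳ : ∀ m n → h (suc m) (suc n) ≈ h (suc m) n + q ^ suc n * h m (suc n)
  h-pascalʳ m n = +-congʳ (reflexive (≡.cong (λ x → bin x n) (ℕ.+-suc m n)))

  h-comm : ∀ m n → h m n ≈ h n m
  h-comm zero    n       = trans (h-zeroˡ n) refl
  h-comm (suc m) zero    = sym (h-zeroˡ (suc m))
  h-comm (suc m) (suc n) = begin
    h (suc m) (suc n)                   ≈⟨ h-pascalˡ m n ⟩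
    h m (suc n) + q ^ suc m * h (suc m) n
      ≈⟨ +-cong (h-comm m (suc n)) (*-congˡ (h-comm (suc m) n)) ⟩
    h (suc n) m + q ^ suc m * h n (suc m) ≈⟨ h-pascalʳ n m ⟨
    h (suc n) (suc m)                   ∎

  -- Both sides are the q-multinomial coefficient of `r`, `e`, `d`. In an arbitrary commutative ring
  -- q-factorials cannot be cancelled, so Pascal recurrences of the two sides are compared instead.
  h-trinomial : ∀ r e d → h r e * h (r ℕ.+ e) d ≈ h e d * h r (d ℕ.+ e)
  h-trinomial zero e d = begin
    h 0 e * h e d         ≈⟨ *-comm _ _ ⟩
    h e d * h 0 e         ≈⟨ *-congˡ (trans (h-zeroˡ e) (sym (h-zeroˡ (d ℕ.+ e)))) ⟩
    h e d * h 0 (d ℕ.+ e) ∎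
  h-trinomial (suc r) zero d = begin
    1# * h (suc r ℕ.+ 0) d         ≈⟨ *-cong (sym (h-zeroˡ d))
      (reflexive (≡.cong₂ h (ℕ.+-identityʳ (suc r)) (≡.sym (ℕ.+-identityʳ d)))) ⟩
    h 0 d * h (suc r) (d ℕ.+ 0)    ∎
  h-trinomial (suc r) (suc e) zero = *-comm _ _
  h-trinomial (suc r) (suc e) (suc d) = begin
    h (suc r) (suc e) * h (suc r ℕ.+ suc e) (suc d)
      ≈⟨ *-congˡ (h-pascalˡ (r ℕ.+ suc e) d) ⟩
    h (suc r) (suc e) * (h (r ℕ.+ suc e) (suc d) + q ^ (suc r ℕ.+ suc e) * h (suc r ℕ.+ suc e) d)
      ≈⟨ distribˡ _ _ _ ⟩
    h (suc r) (suc e) * h (r ℕ.+ suc e) (suc d) +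
      h (suc r) (suc e) * (q ^ (suc r ℕ.+ suc e) * h (suc r ℕ.+ suc e) d)
      ≈⟨ +-cong (*-congʳ (h-pascalˡ r e)) (*-congˡ (*-congʳ (q^+ (suc r) (suc e)))) ⟩
    (h r (suc e) + Q * h (suc r) e) * h (r ℕ.+ suc e) (suc d) +
      h (suc r) (suc e) * (Q * Q′ * h (suc r ℕ.+ suc e) d)
      ≈⟨ solve 7 (λ a b x y z w v → (a :+ x :* b) :* w :+ z :* (x :* y :* v)
                               := a :* w :+ x :* (b :* w :+ y :* (z :* v))) refl
           (h r (suc e)) (h (suc r) e) Q Q′ (h (suc r) (suc e)) (h (r ℕ.+ suc e) (suc d)) (h (suc r ℕ.+ suc e) d) ⟩
    h r (suc e) * h (r ℕ.+ suc e) (suc d) +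
      Q * (h (suc r) e * h (r ℕ.+ suc e) (suc d) + Q′ * (h (suc r) (suc e) * h (suc r ℕ.+ suc e) d))
      ≈⟨ +-cong (h-trinomial r (suc e) (suc d)) (*-congˡ (+-cong
           (trans (*-congˡ (reflexive (≡.cong (λ x → h x (suc d)) (ℕ.+-suc r e)))) (h-trinomial (suc r) e (suc d)))
           (*-congˡ (h-trinomial (suc r) (suc e) d)))) ⟩
    H * h r (suc d ℕ.+ suc e) +
      Q * (h e (suc d) * h (suc r) (suc d ℕ.+ e) + Q′ * (h (suc e) d * h (suc r) (d ℕ.+ suc e)))
      ≈⟨ +-congˡ (*-congˡ (+-congʳ (*-congˡ (reflexive (≡.cong (h (suc r)) (≡.sym (ℕ.+-suc d e))))))) ⟩
    H * h r (suc d ℕ.+ suc e) +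
      Q * (h e (suc d) * K + Q′ * (h (suc e) d * K))
      ≈⟨ solve 7 (λ a b x y z w v → z :* w :+ x :* (a :* v :+ y :* (b :* v))
                               := z :* w :+ x :* ((a :+ y :* b) :* v)) refl
           (h e (suc d)) (h (suc e) d) Q Q′ H (h r (suc d ℕ.+ suc e)) K ⟩
    H * h r (suc d ℕ.+ suc e) + Q * ((h e (suc d) + Q′ * h (suc e) d) * K)
      ≈⟨ +-congˡ (*-congˡ (*-congʳ (h-pascalˡ e d))) ⟨
    H * h r (suc d ℕ.+ suc e) + Q * (H * K)
      ≈⟨ solve 4 (λ z w x k → z :* w :+ x :* (z :* k) := z :* (w :+ x :* k)) refl
           H (h r (suc d ℕ.+ suc e)) Q K ⟩
    H * (h r (suc d ℕ.+ suc e) + Q * K)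
      ≈⟨ *-congˡ (h-pascalˡ r (d ℕ.+ suc e)) ⟨
    H * h (suc r) (suc d ℕ.+ suc e) ∎
    where
    Q  = q ^ suc r
    Q′ = q ^ suc e
    H  = h (suc e) (suc d)
    K  = h (suc r) (d ℕ.+ suc e)

  -- Convolutions, the q-Saalschütz sum and the q-Vandermonde sum.

  w : (a c e κ : ℕ) → Carrier
  w a c e κ = q ^ (κ ℕ.* (κ ℕ.+ e)) * (bin a κ * bin c (κ ℕ.+ e))

  w-zero : ∀ a c e → w a c e 0 ≈ bin c e
  w-zero a c e = trans (*-identityˡ _) (*-identityˡ _)

  -- The exponent κ (κ + e) makes Pascal's rule in `a` close up: the new term is again a `w`, with
  -- `e` raised by one and a prefactor free of κ.
  w-suc : ∀ a c e κ →
    w (suc a) c e (suc κ) ≈ w a c e (suc κ) + q ^ (suc a ℕ.+ e) * w a c (suc e) κ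
  w-suc a c e κ = begin
    X * (bin (suc a) (suc κ) * B)                        ≈⟨ *-congˡ (*-congʳ (bin-pascal a κ)) ⟩
    X * ((bin a (suc κ) + q ^ (a ∸ κ) * bin a κ) * B)
      ≈⟨ solve 5 (λ x y a b d → x :* ((a :+ y :* b) :* d) := x :* (a :* d) :+ x :* y :* b :* d) refl
           X (q ^ (a ∸ κ)) (bin a (suc κ)) (bin a κ) B ⟩
    X * (bin a (suc κ) * B) + X * q ^ (a ∸ κ) * bin a κ * B
      ≈⟨ +-congˡ (*-cong exponents (reflexive (≡.cong (bin c) (≡.sym (ℕ.+-suc κ e))))) ⟩
    X * (bin a (suc κ) * B) + q ^ (suc a ℕ.+ e) * Y * bin a κ * bin c (κ ℕ.+ suc e)
      ≈⟨ +-congˡ (trans (*-assoc _ _ _) (*-assoc _ _ _)) ⟩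
    X * (bin a (suc κ) * B) + q ^ (suc a ℕ.+ e) * (Y * (bin a κ * bin c (κ ℕ.+ suc e))) ∎
    where
    X = q ^ (suc κ ℕ.* (suc κ ℕ.+ e))
    Y = q ^ (κ ℕ.* (κ ℕ.+ suc e))
    B = bin c (suc κ ℕ.+ e)
    degree : ∀ x κ e → suc κ ℕ.* (suc κ ℕ.+ e) ℕ.+ x ≡ suc (x ℕ.+ κ) ℕ.+ e ℕ.+ κ ℕ.* (κ ℕ.+ suc e)
    degree = ℕSolver.solve-∀
    exponents : X * q ^ (a ∸ κ) * bin a κ ≈ q ^ (suc a ℕ.+ e) * Y * bin a κ
    exponents with κ ℕ.≤? a
    ... | no κ≰a = trans (≈0ʳ _ b≈0) (sym (≈0ʳ _ b≈0))
      where b≈0 = bin-> (ℕ.≰⇒> κ≰a)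
    ... | yes κ≤a = *-congʳ (begin
      X * q ^ (a ∸ κ)     ≈⟨ q^+ (suc κ ℕ.* (suc κ ℕ.+ e)) (a ∸ κ) ⟨
      q ^ (suc κ ℕ.* (suc κ ℕ.+ e) ℕ.+ (a ∸ κ))
        ≈⟨ q^≡ (≡.trans (degree (a ∸ κ) κ e)
             (≡.cong (λ x → suc x ℕ.+ e ℕ.+ κ ℕ.* (κ ℕ.+ suc e)) (ℕ.m∸n+n≡m κ≤a))) ⟩
      q ^ (suc a ℕ.+ e ℕ.+ κ ℕ.* (κ ℕ.+ suc e)) ≈⟨ q^+ (suc a ℕ.+ e) (κ ℕ.* (κ ℕ.+ suc e)) ⟩
      q ^ (suc a ℕ.+ e) * Y ∎)

  -- Handing both i and n - i to the summand keeps truncated subtraction out of the sums.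
  conv : ℕ → (ℕ → ℕ → Carrier) → Carrier
  conv zero    f = f 0 0
  conv (suc n) f = f 0 (suc n) + conv n (λ i → f (suc i))

  conv-cong : ∀ n {f g} → (∀ i j → f i j ≈ g i j) → conv n f ≈ conv n g
  conv-cong zero    f≈g = f≈g 0 0
  conv-cong (suc n) f≈g = +-cong (f≈g 0 (suc n)) (conv-cong n (λ i → f≈g (suc i)))

  conv-zero : ∀ n {f} → (∀ i j → i ℕ.≤ n → f i j ≈ 0#) → conv n f ≈ 0#
  conv-zero zero    f≈0 = f≈0 0 0 z≤n
  conv-zero (suc n) f≈0 =
    trans (+-cong (f≈0 0 (suc n) z≤n) (conv-zero n (λ i j i≤n → f≈0 (suc i) j (s≤s i≤n)))) (+-identityˡ 0#)

  conv-head : ∀ n {f} → (∀ i j → f (suc i) j ≈ 0#) → conv n f ≈ f 0 n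
  conv-head zero    f≈0 = refl
  conv-head (suc n) f≈0 = trans (+-congˡ (conv-zero n (λ i j _ → f≈0 i j))) (+-identityʳ _)

  conv-shift : ∀ u n {f} → (∀ i j → i ℕ.< u → f i j ≈ 0#) →
    conv (u ℕ.+ n) f ≈ conv n (λ i → f (u ℕ.+ i))
  conv-shift zero    n f≈0 = refl
  conv-shift (suc u) n f≈0 =
    trans (+-cong (f≈0 0 _ (s≤s z≤n)) (conv-shift u n (λ i j i<u → f≈0 (suc i) j (s≤s i<u)))) (+-identityˡ _)

  conv-+ : ∀ n f g → conv n (λ i j → f i j + g i j) ≈ conv n f + conv n g
  conv-+ zero    f g = refl
  conv-+ (suc n) f g = trans (+-congˡ (conv-+ n _ _))
    (solve 4 (λ a b c d → (a :+ b) :+ (c :+ d) := (a :+ c) :+ (b :+ d)) refl _ _ _ _)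

  conv-*ˡ : ∀ n x f → conv n (λ i j → x * f i j) ≈ x * conv n f
  conv-*ˡ zero    x f = refl
  conv-*ˡ (suc n) x f = trans (+-congˡ (conv-*ˡ n x _)) (sym (distribˡ x _ _))

  -- Lifts a Pascal rule in the second index to the whole convolution. At second index 0 the rule
  -- has no lower term, hence the separate hypothesis there.
  conv-recʳ : ∀ n x f g → (∀ i → f i 0 ≈ g i 0) →
    (∀ i j → f i (suc j) ≈ g i (suc j) + x * f i j) →
    conv (suc n) f ≈ conv (suc n) g + x * conv n f
  conv-recʳ zero x f g f₀ f₊ = trans (+-cong (f₊ 0 0) (f₀ 1))
    (solve 3 (λ a b c → (a :+ b) :+ c := (a :+ c) :+ b) refl _ _ _)
  conv-recʳ (suc n) x f g f₀ f₊ = begin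
    f 0 (suc (suc n)) + conv (suc n) (λ i → f (suc i))
      ≈⟨ +-cong (f₊ 0 (suc n)) (conv-recʳ n x _ (λ i → g (suc i)) (λ i → f₀ (suc i)) (λ i → f₊ (suc i))) ⟩
    (g 0 (suc (suc n)) + x * f 0 (suc n)) + (conv (suc n) (λ i → g (suc i)) + x * conv n (λ i → f (suc i)))
      ≈⟨ solve 5 (λ a b c d x → (a :+ x :* b) :+ (c :+ x :* d) := (a :+ c) :+ x :* (b :+ d)) refl
           (g 0 (suc (suc n))) (f 0 (suc n)) (conv (suc n) (λ i → g (suc i))) (conv n (λ i → f (suc i))) x ⟩
    (g 0 (suc (suc n)) + conv (suc n) (λ i → g (suc i))) + x * (f 0 (suc n) + conv n (λ i → f (suc i))) ∎

  w-zero-suc : ∀ c e κ → w 0 c e (suc κ) ≈ 0#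
  w-zero-suc c e κ = ≈0ʳ _ (zeroˡ _)

  conv-w-suc : ∀ a c e n (K : ℕ → Carrier) →
    conv (suc n) (λ κ δ → w (suc a) c e κ * K δ) ≈
    conv (suc n) (λ κ δ → w a c e κ * K δ) +
      q ^ (suc a ℕ.+ e) * conv n (λ κ δ → w a c (suc e) κ * K δ)
  conv-w-suc a c e n K = begin
    X + conv n (λ κ δ → w (suc a) c e (suc κ) * K δ)
      ≈⟨ +-congˡ (conv-cong n (λ κ δ → trans (*-congʳ (w-suc a c e κ))
           (solve 4 (λ a b x k → (a :+ x :* b) :* k := a :* k :+ x :* (b :* k)) refl
              (w a c e (suc κ)) (w a c (suc e) κ) Q (K δ)))) ⟩
    X + conv n (λ κ δ → w a c e (suc κ) * K δ + Q * (w a c (suc e) κ * K δ))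
      ≈⟨ +-congˡ (trans (conv-+ n _ _) (+-congˡ (conv-*ˡ n Q _))) ⟩
    X + (conv n (λ κ δ → w a c e (suc κ) * K δ) + Q * conv n (λ κ δ → w a c (suc e) κ * K δ))
      ≈⟨ +-assoc _ _ _ ⟨
    X + conv n (λ κ δ → w a c e (suc κ) * K δ) + Q * conv n (λ κ δ → w a c (suc e) κ * K δ) ∎
    where
    Q = q ^ (suc a ℕ.+ e)
    X = w a c e 0 * K (suc n)

  -- The q-Saalschütz sum.  Both sides are the coefficient of zᵈ in the
  -- Heine–Euler transformation, and raising a by one is Pascal's rule.
  saalschütz : ∀ a c e d →
    conv d (λ κ δ → w a c e κ * h (a ℕ.+ c) δ) ≈ h (a ℕ.+ e) d * bin (c ℕ.+ d) (d ℕ.+ e)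
  saalschütz zero c e d = trans (conv-head d (λ κ δ → ≈0ˡ _ (w-zero-suc c e κ)))
    (trans (*-congʳ (w-zero 0 c e)) base)
    where
    base : bin c e * h c d ≈ h e d * bin (c ℕ.+ d) (d ℕ.+ e)
    base with e ℕ.≤? c
    ... | no e≰c = trans (≈0ˡ _ (bin-> c<e))
            (sym (≈0ʳ _ (bin-> (≡.subst (ℕ._< d ℕ.+ e) (ℕ.+-comm d c) (ℕ.+-monoʳ-< d c<e)))))
      where c<e = ℕ.≰⇒> e≰c
    -- For a = 0 only κ = 0 contributes, and with c = r + e what remains is trinomial revision.
    ... | yes e≤c = ≡.subst (λ c → bin c e * h c d ≈ h e d * bin (c ℕ.+ d) (d ℕ.+ e)) (ℕ.m∸n+n≡m e≤c)
            (trans (h-trinomial (c ∸ e) e d) (*-congˡ (reflexive (≡.cong (λ x → bin x (d ℕ.+ e)) (assoc (c ∸ e) e d)))))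
      where
      assoc : ∀ r e d → r ℕ.+ (d ℕ.+ e) ≡ r ℕ.+ e ℕ.+ d
      assoc = ℕSolver.solve-∀
  saalschütz (suc a) c e zero = begin
    w (suc a) c e 0 * 1#     ≈⟨ trans (*-identityʳ _) (w-zero (suc a) c e) ⟩
    bin c e                  ≈⟨ trans (*-identityˡ _) (reflexive (≡.cong (λ x → bin x e) (ℕ.+-identityʳ c))) ⟨
    1# * bin (c ℕ.+ 0) e     ∎
  saalschütz (suc a) c e (suc d) = begin
    conv (suc d) (λ κ δ → w (suc a) c e κ * h (suc a ℕ.+ c) δ)
      -- Pascal's rule in δ first lowers the kernel to `h (a ℕ.+ c)`, so that lowering `a` in `w`
      -- meets the induction hypotheses.
      ≈⟨ conv-recʳ d (q ^ (suc a ℕ.+ c)) _ (λ κ δ → w (suc a) c e κ * h (a ℕ.+ c) δ) (λ κ → refl)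
           (λ κ δ → trans (*-congˡ (h-pascalˡ (a ℕ.+ c) δ))
             (solve 4 (λ a b x k → k :* (a :+ x :* b) := k :* a :+ x :* (k :* b)) refl
               (h (a ℕ.+ c) (suc δ)) (h (suc a ℕ.+ c) δ) (q ^ (suc a ℕ.+ c)) (w (suc a) c e κ))) ⟩
    conv (suc d) (λ κ δ → w (suc a) c e κ * h (a ℕ.+ c) δ) +
      q ^ (suc a ℕ.+ c) * conv d (λ κ δ → w (suc a) c e κ * h (suc a ℕ.+ c) δ)
      ≈⟨ +-cong (conv-w-suc a c e d (h (a ℕ.+ c))) (*-congˡ (saalschütz (suc a) c e d)) ⟩
    conv (suc d) (λ κ δ → w a c e κ * h (a ℕ.+ c) δ) +
      q ^ (suc a ℕ.+ e) * conv d (λ κ δ → w a c (suc e) κ * h (a ℕ.+ c) δ) +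
      q ^ (suc a ℕ.+ c) * (h (suc a ℕ.+ e) d * B)
      ≈⟨ +-congʳ (+-cong (saalschütz a c e (suc d)) (*-congˡ (trans (saalschütz a c (suc e) d)
           (*-cong (reflexive (≡.cong (λ x → h x d) (ℕ.+-suc a e)))
             (reflexive (≡.cong (bin (c ℕ.+ d)) (ℕ.+-suc d e))))))) ⟩
    h (a ℕ.+ e) (suc d) * bin (c ℕ.+ suc d) (suc d ℕ.+ e) +
      q ^ (suc a ℕ.+ e) * (h (suc a ℕ.+ e) d * B′) +
      q ^ (suc a ℕ.+ c) * (h (suc a ℕ.+ e) d * B)
      ≈⟨ +-cong (+-congʳ (*-congˡ B₁-pascal))
           (trans (solve 3 (λ x y b → x :* (y :* b) := y :* (x :* b)) refl _ _ _) (*-congˡ (sym exponents))) ⟩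
    h (a ℕ.+ e) (suc d) * (B′ + P * B) +
      q ^ (suc a ℕ.+ e) * (h (suc a ℕ.+ e) d * B′) +
      h (suc a ℕ.+ e) d * (q ^ (suc a ℕ.+ e) * P * B)
      ≈⟨ solve 6 (λ x y u v b r → x :* (v :+ r :* b) :+ u :* (y :* v) :+ y :* (u :* r :* b)
                               := (x :+ u :* y) :* (v :+ r :* b)) refl
           (h (a ℕ.+ e) (suc d)) (h (suc a ℕ.+ e) d) (q ^ (suc a ℕ.+ e)) B′ B P ⟩
    (h (a ℕ.+ e) (suc d) + q ^ (suc a ℕ.+ e) * h (suc a ℕ.+ e) d) * (B′ + P * B)
      ≈⟨ *-cong (sym (h-pascalˡ (a ℕ.+ e) d)) (sym B₁-pascal) ⟩
    h (suc a ℕ.+ e) (suc d) * bin (c ℕ.+ suc d) (suc d ℕ.+ e) ∎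
    where
    B  = bin (c ℕ.+ d) (d ℕ.+ e)
    B′ = bin (c ℕ.+ d) (suc d ℕ.+ e)
    P  = q ^ (c ℕ.+ d ∸ (d ℕ.+ e))
    B₁-pascal : bin (c ℕ.+ suc d) (suc d ℕ.+ e) ≈ B′ + P * B
    B₁-pascal = trans (reflexive (≡.cong (λ x → bin x (suc d ℕ.+ e)) (ℕ.+-suc c d))) (bin-pascal (c ℕ.+ d) (d ℕ.+ e))
    degree : ∀ a e r d → suc a ℕ.+ e ℕ.+ r ℕ.+ d ≡ suc a ℕ.+ (r ℕ.+ (d ℕ.+ e))
    degree = ℕSolver.solve-∀
    -- Unless `B` vanishes, e ≤ c and `P` is q to the power c - e.
    exponents : q ^ (suc a ℕ.+ e) * P * B ≈ q ^ (suc a ℕ.+ c) * B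
    exponents with d ℕ.+ e ℕ.≤? c ℕ.+ d
    ... | no d+e≰c+d = trans (≈0ʳ _ B≈0) (sym (≈0ʳ _ B≈0))
      where B≈0 = bin-> (ℕ.≰⇒> d+e≰c+d)
    ... | yes d+e≤c+d = *-congʳ (trans (sym (q^+ (suc a ℕ.+ e) _)) (q^≡ (ℕ.+-cancelʳ-≡ d _ _
            (≡.trans (degree a e (c ℕ.+ d ∸ (d ℕ.+ e)) d)
              (≡.trans (≡.cong (suc a ℕ.+_) (ℕ.m∸n+n≡m d+e≤c+d)) (≡.sym (ℕ.+-assoc (suc a) c d)))))))

  -- The bound says that cutting off at κ = n loses nothing, as `bin c (κ ℕ.+ e)` vanishes for κ > c
  -- - e. The induction preserves it, lowering n while raising e.
  vandermonde : ∀ a c e n → c ℕ.≤ n ℕ.+ e →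
    conv n (λ κ δ → w a c e κ * 1#) ≈ bin (a ℕ.+ c) (a ℕ.+ e)
  vandermonde zero c e n c≤n+e = trans (conv-head n (λ κ δ → ≈0ˡ _ (w-zero-suc c e κ)))
    (trans (*-identityʳ _) (w-zero 0 c e))
  vandermonde (suc a) c e zero c≤e = trans (*-identityʳ _) (trans (w-zero (suc a) c e) (top (ℕ.m≤n⇒m<n∨m≡n c≤e)))
    where
    top : c ℕ.< e ⊎ c ≡ e → bin c e ≈ bin (suc a ℕ.+ c) (suc a ℕ.+ e)
    top (inj₁ c<e)    = trans (bin-> c<e) (sym (bin-> (ℕ.+-monoʳ-< (suc a) c<e)))
    top (inj₂ ≡.refl) = trans (bin-diag c) (sym (bin-diag (suc a ℕ.+ c)))
  vandermonde (suc a) c e (suc n) c≤n+e = begin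
    conv (suc n) (λ κ δ → w (suc a) c e κ * 1#)
      ≈⟨ conv-w-suc a c e n (λ _ → 1#) ⟩
    conv (suc n) (λ κ δ → w a c e κ * 1#) + q ^ (suc a ℕ.+ e) * conv n (λ κ δ → w a c (suc e) κ * 1#)
      ≈⟨ +-cong (vandermonde a c e (suc n) c≤n+e)
           (*-congˡ (trans (vandermonde a c (suc e) n (≡.subst (c ℕ.≤_) (≡.sym (ℕ.+-suc n e)) c≤n+e))
             (reflexive (≡.cong (bin (a ℕ.+ c)) (ℕ.+-suc a e))))) ⟩
    bin (suc a ℕ.+ c) (suc a ℕ.+ e) ∎

  -- Integer arguments, and both sums in that form.

  -- The value 0 at negative arguments lets the sums run over ranges that do not depend on j.
  gauss : ℤ → ℤ → Carrier
  gauss (+ m)    (+ n)    = h m n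
  gauss (+ _)    -[1+ _ ] = 0#
  gauss -[1+ _ ] _        = 0#

  gauss-negˡ : ∀ {x} y → x ℤ.< ℤ.0ℤ → gauss x y ≈ 0#
  gauss-negˡ y ℤ.-<+ = refl
  gauss-negˡ y (ℤ.+<+ ())

  gauss-negʳ : ∀ x {y} → y ℤ.< ℤ.0ℤ → gauss x y ≈ 0#
  gauss-negʳ (+ _)    ℤ.-<+ = refl
  gauss-negʳ -[1+ _ ] ℤ.-<+ = refl
  gauss-negʳ x (ℤ.+<+ ())

  gauss-comm : ∀ x y → gauss x y ≈ gauss y x
  gauss-comm (+ m)    (+ n)    = h-comm m n
  gauss-comm (+ _)    -[1+ _ ] = refl
  gauss-comm -[1+ _ ] (+ _)    = refl
  gauss-comm -[1+ _ ] -[1+ _ ] = refl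

  gauss-cong : ∀ {x x′ y y′} → x ≡ x′ → y ≡ y′ → gauss x y ≈ gauss x′ y′
  gauss-cong x≡x′ y≡y′ = reflexive (≡.cong₂ gauss x≡x′ y≡y′)

  -- Unlike a bare comparison it returns the difference, so that matching on the equation removes
  -- subtractions.
  split : ∀ i u → (∃[ k ] u ≡ suc (i ℕ.+ k)) ⊎ (∃[ k ] i ≡ u ℕ.+ k)
  split i       zero    = inj₂ (i , ≡.refl)
  split zero    (suc u) = inj₁ (u , ≡.refl)
  split (suc i) (suc u) with split i u
  ... | inj₁ (k , u≡) = inj₁ (k , ≡.cong suc u≡)
  ... | inj₂ (k , i≡) = inj₂ (k , ≡.cong suc i≡)

  below : ∀ i u → i ℕ.< u → + i ℤ.- + u ℤ.< ℤ.0ℤ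
  below i u i<u = ≡.subst (ℤ._< ℤ.0ℤ) (≡.sym (ℤ.m-n≡m⊖n i u))
    (≡.subst (i ℤ.⊖ u ℤ.<_) (ℤ.n⊖n≡0 u) (ℤ.⊖-monoˡ-< u i<u))

  gauss-bin : ∀ n k → gauss (+ n ℤ.- + k) (+ k) ≈ bin n k
  gauss-bin n k with split n k
  ... | inj₁ (r , ≡.refl) = trans (gauss-negˡ (+ k) (below n k n<k)) (sym (bin-> n<k))
    where n<k = s≤s (ℕ.m≤m+n n r)
  ... | inj₂ (r , ≡.refl) = trans (gauss-cong (cancel (+ k) (+ r)) ≡.refl)
    (reflexive (≡.cong (λ x → bin x k) (ℕ.+-comm r k)))
    where
    cancel : ∀ k r → k ℤ.+ r ℤ.- k ≡ r
    cancel = ℤSolver.solve-∀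

  -- The summand of the q-Saalschütz and q-Vandermonde sums, with κ = i - u and
  -- with the factor q^(κ (κ + e)) absorbed into q ^ Q i.
  shifted : (Q : ℕ → ℕ) (K : ℕ → Carrier) (P : ℤ) (k u e i δ : ℕ) → Carrier
  shifted Q K P k u e i δ = q ^ Q i * (K δ *
    (gauss (P ℤ.+ + k ℤ.+ + u ℤ.- + i) (+ i ℤ.- + u) * gauss (P ℤ.+ + u ℤ.- + i) (+ i ℤ.- + u ℤ.+ + e)))

  shifted-below : ∀ Q K P k u e i δ → i ℕ.< u → shifted Q K P k u e i δ ≈ 0#
  shifted-below Q K P k u e i δ i<u = ≈0ʳ _ (≈0ʳ _ (≈0ˡ _ (gauss-negʳ (P ℤ.+ + k ℤ.+ + u ℤ.- + i) (below i u i<u))))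

  shifted-neg : ∀ Q K p k u e i δ → shifted Q K -[1+ p ] k u e i δ ≈ 0#
  shifted-neg Q K p k u e i δ with split i u
  ... | inj₁ (r , ≡.refl) = shifted-below Q K -[1+ p ] k u e i δ (s≤s (ℕ.m≤m+n i r))
  ... | inj₂ (r , ≡.refl) = ≈0ʳ _ (≈0ʳ _ (≈0ʳ _ (gauss-negˡ _
          (≡.subst (ℤ._< ℤ.0ℤ) (≡.sym (cancel -[1+ p ] (+ u) (+ r)))
            (ℤ.+-mono-<-≤ {y = ℤ.0ℤ} ℤ.-<+ (ℤ.neg-≤-pos {r} {0}))))))
    where
    cancel : ∀ p u r → p ℤ.+ u ℤ.- (u ℤ.+ r) ≡ p ℤ.+ ℤ.- r
    cancel = ℤSolver.solve-∀

  shifted-above : ∀ Q K p k u e κ δ → {Q₀ : ℕ} → Q (u ℕ.+ κ) ≡ Q₀ ℕ.+ κ ℕ.* (κ ℕ.+ e) →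
    shifted Q K (+ p) k u e (u ℕ.+ κ) δ ≈ q ^ Q₀ * (w (p ℕ.+ k) (p ℕ.+ e) e κ * K δ)
  shifted-above Q K p k u e κ δ {Q₀} Q≡ = begin
    shifted Q K (+ p) k u e (u ℕ.+ κ) δ
      ≈⟨ *-cong (trans (q^≡ Q≡) (q^+ Q₀ _)) (*-congˡ (*-cong
           (trans (gauss-cong (top (+ (p ℕ.+ k)) (+ u) (+ κ)) (bottom (+ u) (+ κ))) (gauss-bin (p ℕ.+ k) κ))
           (trans (gauss-cong (top′ (+ p) (+ u) (+ κ) (+ e)) (bottom′ (+ u) (+ κ) (+ e)))
             (gauss-bin (p ℕ.+ e) (κ ℕ.+ e))))) ⟩
    q ^ Q₀ * q ^ (κ ℕ.* (κ ℕ.+ e)) * (K δ * (bin (p ℕ.+ k) κ * bin (p ℕ.+ e) (κ ℕ.+ e)))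
      ≈⟨ solve 4 (λ x y k b → x :* y :* (k :* b) := x :* (y :* b :* k)) refl _ _ _ _ ⟩
    q ^ Q₀ * (w (p ℕ.+ k) (p ℕ.+ e) e κ * K δ) ∎
    where
    top : ∀ a u κ → a ℤ.+ u ℤ.- (u ℤ.+ κ) ≡ a ℤ.- κ
    top = ℤSolver.solve-∀
    bottom : ∀ u κ → u ℤ.+ κ ℤ.- u ≡ κ
    bottom = ℤSolver.solve-∀
    top′ : ∀ p u κ e → p ℤ.+ u ℤ.- (u ℤ.+ κ) ≡ p ℤ.+ e ℤ.- (κ ℤ.+ e)
    top′ = ℤSolver.solve-∀
    bottom′ : ∀ u κ e → u ℤ.+ κ ℤ.- u ℤ.+ e ≡ κ ℤ.+ e
    bottom′ = ℤSolver.solve-∀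

  conv-shifted : ∀ Q K p k u e D {Q₀ : ℕ} → (∀ κ → Q (u ℕ.+ κ) ≡ Q₀ ℕ.+ κ ℕ.* (κ ℕ.+ e)) →
    conv (u ℕ.+ D) (shifted Q K (+ p) k u e) ≈
    q ^ Q₀ * conv D (λ κ δ → w (p ℕ.+ k) (p ℕ.+ e) e κ * K δ)
  conv-shifted Q K p k u e D Q≡ =
    trans (conv-shift u D (shifted-below Q K (+ p) k u e))
      (trans (conv-cong D (λ κ δ → shifted-above Q K p k u e κ δ (Q≡ κ))) (conv-*ˡ D _ _))

  -- The Burge transform of the overview with P = L - a - b, k = 2a, e = 2b, and i - u in the place
  -- of i - b. As `k` and `e` are natural numbers, this is the case a, b ≥ 0. For `P` negative or m
  -- < u both sides vanish; otherwise it is `saalschütz`.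
  burge : ∀ Q {Q₀} P k u e m → (∀ κ → Q (u ℕ.+ κ) ≡ Q₀ ℕ.+ κ ℕ.* (κ ℕ.+ e)) →
    conv m (shifted Q (λ δ → gauss (P ℤ.+ P ℤ.+ + k ℤ.+ + e) (+ δ)) P k u e) ≈
    q ^ Q₀ * (gauss (P ℤ.+ + k ℤ.+ + e) (+ m ℤ.- + u) * gauss P (+ m ℤ.- + u ℤ.+ + e))
  burge Q -[1+ p ] k u e m Q≡ =
    trans (conv-zero m (λ i δ _ → shifted-neg Q
        (λ δ → gauss (-[1+ p ] ℤ.+ -[1+ p ] ℤ.+ + k ℤ.+ + e) (+ δ)) p k u e i δ))
      (sym (≈0ʳ _ (zeroʳ _)))
  burge Q (+ p) k u e m Q≡ with split m u
  ... | inj₁ (r , ≡.refl) =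
    trans (conv-zero m (λ i δ i≤m → shifted-below Q (h (p ℕ.+ p ℕ.+ k ℕ.+ e)) (+ p) k u e i δ
        (s≤s (ℕ.≤-trans i≤m (ℕ.m≤m+n m r)))))
      (sym (≈0ʳ _ (≈0ˡ _ (gauss-negʳ (+ (p ℕ.+ k ℕ.+ e)) (below m u (s≤s (ℕ.m≤m+n m r)))))))
  ... | inj₂ (D , ≡.refl) = trans (conv-shifted Q (h (p ℕ.+ p ℕ.+ k ℕ.+ e)) p k u e D Q≡) (*-congˡ (begin
    conv D (λ κ δ → w (p ℕ.+ k) (p ℕ.+ e) e κ * h (p ℕ.+ p ℕ.+ k ℕ.+ e) δ)
      ≈⟨ conv-cong D (λ κ δ → *-congˡ (reflexive (≡.cong (λ x → h x δ) (kernel p k e)))) ⟩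
    conv D (λ κ δ → w (p ℕ.+ k) (p ℕ.+ e) e κ * h (p ℕ.+ k ℕ.+ (p ℕ.+ e)) δ)
      ≈⟨ saalschütz (p ℕ.+ k) (p ℕ.+ e) e D ⟩
    h (p ℕ.+ k ℕ.+ e) D * bin (p ℕ.+ e ℕ.+ D) (D ℕ.+ e)
      ≈⟨ *-cong (gauss-cong {+ (p ℕ.+ k ℕ.+ e)} ≡.refl (bottom (+ u) (+ D))) (trans
           (gauss-cong {+ p} ≡.refl (bottom′ (+ u) (+ D) (+ e))) (reflexive (≡.cong (λ x → bin x (D ℕ.+ e)) (top p D e)))) ⟨
    gauss (+ p ℤ.+ + k ℤ.+ + e) (+ m ℤ.- + u) * gauss (+ p) (+ m ℤ.- + u ℤ.+ + e) ∎))
    where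
    kernel : ∀ p k e → p ℕ.+ p ℕ.+ k ℕ.+ e ≡ p ℕ.+ k ℕ.+ (p ℕ.+ e)
    kernel = ℕSolver.solve-∀
    top : ∀ p D e → p ℕ.+ (D ℕ.+ e) ≡ p ℕ.+ e ℕ.+ D
    top = ℕSolver.solve-∀
    bottom : ∀ u D → u ℤ.+ D ℤ.- u ≡ D
    bottom = ℤSolver.solve-∀
    bottom′ : ∀ u D e → u ℤ.+ D ℤ.- u ℤ.+ e ≡ D ℤ.+ e
    bottom′ = ℤSolver.solve-∀

  -- `z` is the excess of the summation range over the support; that it is a natural number is the
  -- bound required by `vandermonde`.
  vandermondeℤ : ∀ Q {Q₀} P k u e z m → (∀ κ → Q (u ℕ.+ κ) ≡ Q₀ ℕ.+ κ ℕ.* (κ ℕ.+ e)) →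
    + m ≡ + u ℤ.+ (P ℤ.+ + z) →
    conv m (shifted Q (λ _ → 1#) P k u e) ≈ q ^ Q₀ * gauss P (P ℤ.+ + k ℤ.+ + e)
  vandermondeℤ Q -[1+ p ] k u e z m Q≡ m≡ =
    trans (conv-zero m (λ i δ _ → shifted-neg Q (λ _ → 1#) p k u e i δ)) (sym (zeroʳ _))
  vandermondeℤ Q (+ p) k u e z m Q≡ m≡
    with ≡.refl ← ℤ.+-injective m≡ = trans (conv-shifted Q (λ _ → 1#) p k u e (p ℕ.+ z) Q≡) (*-congˡ (begin
      conv (p ℕ.+ z) (λ κ δ → w (p ℕ.+ k) (p ℕ.+ e) e κ * 1#)
        ≈⟨ vandermonde (p ℕ.+ k) (p ℕ.+ e) e (p ℕ.+ z) (ℕ.+-monoˡ-≤ e (ℕ.m≤m+n p z)) ⟩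
      bin (p ℕ.+ k ℕ.+ (p ℕ.+ e)) (p ℕ.+ k ℕ.+ e)
        ≡⟨ ≡.cong (λ x → bin x (p ℕ.+ k ℕ.+ e)) (top p k e) ⟩
      h p (p ℕ.+ k ℕ.+ e) ∎))
    where
    top : ∀ p k e → p ℕ.+ k ℕ.+ (p ℕ.+ e) ≡ p ℕ.+ (p ℕ.+ k ℕ.+ e)
    top = ℕSolver.solve-∀

  -- The product formula.

  poch : ℕ → Carrier
  poch zero    = 1#
  poch (suc m) = poch m * (1# - q ^ suc m)

  1-x+x[1-y] : ∀ x y → (1# - x) + x * (1# - y) ≈ 1# - x * y
  1-x+x[1-y] x y = begin
    (1# - x) + x * (1# - y)
      ≈⟨ solve 4 (λ x x⁻ y⁻ o → (o :+ x⁻) :+ x :* (con 1 :+ y⁻) := (x :+ x⁻) :+ (o :+ x :* y⁻)) refl x (- x) (- y) 1# ⟩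
    (x - x) + (1# + x * - y)      ≈⟨ +-cong (-‿inverseʳ x) (+-congˡ (sym (RingProperties.-‿distribʳ-* x y))) ⟩
    0# + (1# - x * y)             ≈⟨ +-identityˡ _ ⟩
    1# - x * y                    ∎

  -- Pascal's rule reduces this to (1 - x) + x (1 - y) = 1 - x y for powers x, y of q. It serves to
  -- identify `h` with the quotient defining `qBinomial`.
  h-poch : ∀ m n → h m n * (poch m * poch n) ≈ poch (m ℕ.+ n)
  h-poch zero n = begin
    h 0 n * (1# * poch n) ≈⟨ *-cong (h-zeroˡ n) (*-identityˡ _) ⟩
    1# * poch n           ≈⟨ *-identityˡ _ ⟩
    poch n                ∎
  h-poch (suc m) zero = begin
    1# * (poch (suc m) * 1#) ≈⟨ trans (*-identityˡ _) (*-identityʳ _) ⟩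
    poch (suc m)             ≡⟨ ≡.cong poch (ℕ.+-identityʳ (suc m)) ⟨
    poch (suc m ℕ.+ 0)       ∎
  h-poch (suc m) (suc n) = begin
    h (suc m) (suc n) * (poch m * a * (poch n * b))
      ≈⟨ *-congʳ (h-pascalˡ m n) ⟩
    (h m (suc n) + x * h (suc m) n) * (poch m * a * (poch n * b))
      ≈⟨ solve 7 (λ u v x p a r b → (u :+ x :* v) :* (p :* a :* (r :* b)) :=
           u :* (p :* (r :* b)) :* a :+ v :* (p :* a :* r) :* (x :* b)) refl
           (h m (suc n)) (h (suc m) n) x (poch m) a (poch n) b ⟩
    h m (suc n) * (poch m * poch (suc n)) * a + h (suc m) n * (poch (suc m) * poch n) * (x * b)
      ≈⟨ +-cong (*-congʳ (h-poch m (suc n))) (*-congʳ (trans (h-poch (suc m) n)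
           (reflexive (≡.cong poch (≡.sym (ℕ.+-suc m n)))))) ⟩
    poch (m ℕ.+ suc n) * a + poch (m ℕ.+ suc n) * (x * b)
      ≈⟨ distribˡ _ _ _ ⟨
    poch (m ℕ.+ suc n) * (a + x * b)
      ≈⟨ *-congˡ (trans (1-x+x[1-y] x (q ^ suc n)) (+-congˡ (-‿cong (sym (q^+ (suc m) (suc n)))))) ⟩
    poch (suc m ℕ.+ suc n) ∎
    where
    x = q ^ suc m
    a = 1# - x
    b = 1# - q ^ suc n

  -- Alternating sums over the integers.

  σ : ℤ → Carrier
  σ j = (- 1#) ^ ℤ.∣ j ∣

  -- Pairing n with -1 - n, rather than with -n, gives the range from -J to J - 1. It is invariant
  -- under j ↦ -1 - j, the symmetry of the sums with b = j + 1/2.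
  Σℤ : ℕ → (ℤ → Carrier) → Carrier
  Σℤ zero    f = 0#
  Σℤ (suc J) f = Σℤ J f + (f (+ J) + f -[1+ J ])

  Σℤ-cong : ∀ J {f g} → (∀ j → f j ≈ g j) → Σℤ J f ≈ Σℤ J g
  Σℤ-cong zero    f≈g = refl
  Σℤ-cong (suc J) f≈g = +-cong (Σℤ-cong J f≈g) (+-cong (f≈g _) (f≈g _))

  Σℤ-zero : ∀ J {f} → (∀ n → f (+ n) + f -[1+ n ] ≈ 0#) → Σℤ J f ≈ 0#
  Σℤ-zero zero    f≈0 = refl
  Σℤ-zero (suc J) f≈0 = trans (+-cong (Σℤ-zero J f≈0) (f≈0 J)) (+-identityˡ 0#)

  Σℤ-+ : ∀ J f g → Σℤ J (λ j → f j + g j) ≈ Σℤ J f + Σℤ J g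
  Σℤ-+ zero    f g = sym (+-identityˡ 0#)
  Σℤ-+ (suc J) f g = trans (+-congʳ (Σℤ-+ J f g))
    (solve 6 (λ a b c d x y → (a :+ b) :+ ((c :+ d) :+ (x :+ y)) := (a :+ (c :+ x)) :+ (b :+ (d :+ y)))
      refl _ _ _ _ _ _)

  Σℤ-*ˡ : ∀ J x f → Σℤ J (λ j → x * f j) ≈ x * Σℤ J f
  Σℤ-*ˡ zero    x f = sym (zeroʳ x)
  Σℤ-*ˡ (suc J) x f = trans (+-congʳ (Σℤ-*ˡ J x f))
    (solve 4 (λ x a b c → x :* a :+ (x :* b :+ x :* c) := x :* (a :+ (b :+ c))) refl _ _ _ _)

  -- Power of q times kernel times sum is the shape of a transform, so this lets transforms be
  -- checked one j at a time.
  conv-Σℤ : ∀ n J (x y : ℕ → ℕ → Carrier) (f : ℕ → ℕ → ℤ → Carrier) →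
    conv n (λ i δ → x i δ * (y i δ * Σℤ J (f i δ))) ≈
    Σℤ J (λ j → conv n (λ i δ → x i δ * (y i δ * f i δ j)))
  conv-Σℤ n zero    x y f = conv-zero n (λ i δ _ → ≈0ʳ _ (zeroʳ _))
  conv-Σℤ n (suc J) x y f = begin
    conv n (λ i δ → x i δ * (y i δ * (Σℤ J (f i δ) + (f i δ (+ J) + f i δ -[1+ J ]))))
      ≈⟨ conv-cong n (λ i δ →
           solve 5 (λ x y a b c → x :* (y :* (a :+ (b :+ c))) := x :* (y :* a) :+ (x :* (y :* b) :+ x :* (y :* c)))
             refl (x i δ) (y i δ) (Σℤ J (f i δ)) (f i δ (+ J)) (f i δ -[1+ J ])) ⟩
    conv n (λ i δ → x i δ * (y i δ * Σℤ J (f i δ)) +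
                    (x i δ * (y i δ * f i δ (+ J)) + x i δ * (y i δ * f i δ -[1+ J ])))
      ≈⟨ trans (conv-+ n _ _) (+-cong (conv-Σℤ n J x y f) (conv-+ n _ _)) ⟩
    Σℤ (suc J) (λ j → conv n (λ i δ → x i δ * (y i δ * f i δ j))) ∎

  -- Burge transforms of the sums `F`.

  infixl 7 _⋆_

  -- Defined by cases so that, once the sign of j is known, the product becomes plus or minus a
  -- natural number in which `t ℕ.* n` is an atom for the ring solver.
  _⋆_ : ℕ → ℤ → ℤ
  t ⋆ (+ n)    = + (t ℕ.* n)
  t ⋆ -[1+ n ] = ℤ.- + (t ℕ.+ t ℕ.* n)

  -- For t ≡ x + y this is t j² + x j.
  ex : (t x y : ℕ) → ℤ → ℕ
  ex t x y (+ n)    = n ℕ.* (t ℕ.* n ℕ.+ x)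
  ex t x y -[1+ n ] = suc n ℕ.* (t ℕ.* n ℕ.+ y)

  -- In the notation of the header a = t j + x/2, b = j + e/2, L = l - x/2 and
  -- M = m + e/2.  The parameter y is meant to be t - x.
  F-term : (t x y e : ℕ) (l m : ℤ) → ℤ → Carrier
  F-term t x y e l m j =
    σ j * (q ^ ex t x y j * (gauss (l ℤ.+ t ⋆ j) (m ℤ.- j) * gauss (l ℤ.- + x ℤ.- t ⋆ j) (m ℤ.+ + e ℤ.+ j)))

  F : (t x y e J : ℕ) (l m : ℤ) → Carrier
  F t x y e J l m = Σℤ J (F-term t x y e l m)

  -- `burge` with its arguments given up to equations: a use consists of values for `P`, `k`, `u`,
  -- `e` and identities for the ring solver. The term's own power `q ^ X` is merged with the
  -- `q ^ E i` of the transform.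
  burge′ : ∀ s (E : ℕ → ℕ) X {Q₀} P k u e m →
    (∀ κ → E (u ℕ.+ κ) ℕ.+ X ≡ Q₀ ℕ.+ κ ℕ.* (κ ℕ.+ e)) →
    ∀ {N} {a a′ b b′ : ℕ → ℤ} {p p′ r′} →
    N ≡ P ℤ.+ P ℤ.+ + k ℤ.+ + e →
    (∀ i → a i ≡ P ℤ.+ + k ℤ.+ + u ℤ.- + i) → (∀ i → a′ i ≡ + i ℤ.- + u) →
    (∀ i → b i ≡ P ℤ.+ + u ℤ.- + i) → (∀ i → b′ i ≡ + i ℤ.- + u ℤ.+ + e) →
    p ≡ P ℤ.+ + k ℤ.+ + e → p′ ≡ + m ℤ.- + u → r′ ≡ + m ℤ.- + u ℤ.+ + e →
    conv m (λ i δ → q ^ E i * (gauss N (+ δ) * (s * (q ^ X * (gauss (a i) (a′ i) * gauss (b i) (b′ i)))))) ≈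
    s * (q ^ Q₀ * (gauss p p′ * gauss P r′))
  burge′ s E X {Q₀} P k u e m Q≡ {a = a} {a′} {b} {b′} ≡.refl a≡ a′≡ b≡ b′≡ ≡.refl ≡.refl ≡.refl = begin
    conv m (λ i δ → q ^ E i * (gauss (P ℤ.+ P ℤ.+ + k ℤ.+ + e) (+ δ) *
        (s * (q ^ X * (gauss (a i) (a′ i) * gauss (b i) (b′ i))))))
      ≈⟨ conv-cong m (λ i δ → trans
           (solve 5 (λ u v w x y → u :* (v :* (w :* (x :* y))) := w :* (u :* x :* (v :* y))) refl _ _ _ _ _)
           (*-congˡ (*-cong (sym (q^+ (E i) X)) (*-congˡ (*-cong (gauss-cong (a≡ i) (a′≡ i)) (gauss-cong (b≡ i) (b′≡ i))))))) ⟩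
    conv m (λ i δ → s * shifted Q (λ δ → gauss (P ℤ.+ P ℤ.+ + k ℤ.+ + e) (+ δ)) P k u e i δ)
      ≈⟨ trans (conv-*ˡ m s _) (*-congˡ (burge Q P k u e m Q≡)) ⟩
    s * (q ^ Q₀ * (gauss (P ℤ.+ + k ℤ.+ + e) (+ m ℤ.- + u) * gauss P (+ m ℤ.- + u ℤ.+ + e))) ∎
    where
    Q : ℕ → ℕ
    Q i = E i ℕ.+ X

  -- For terms in which the extra `k` sits in the second factor.
  burge″ : ∀ s (E : ℕ → ℕ) X {Q₀} P k u e m →
    (∀ κ → E (u ℕ.+ κ) ℕ.+ X ≡ Q₀ ℕ.+ κ ℕ.* (κ ℕ.+ e)) →
    ∀ {N} {a a′ b b′ : ℕ → ℤ} {p p′ r′} →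
    N ≡ P ℤ.+ P ℤ.+ + k ℤ.+ + e →
    (∀ i → a i ≡ P ℤ.+ + k ℤ.+ + u ℤ.- + i) → (∀ i → a′ i ≡ + i ℤ.- + u) →
    (∀ i → b i ≡ P ℤ.+ + u ℤ.- + i) → (∀ i → b′ i ≡ + i ℤ.- + u ℤ.+ + e) →
    p ≡ P ℤ.+ + k ℤ.+ + e → p′ ≡ + m ℤ.- + u → r′ ≡ + m ℤ.- + u ℤ.+ + e →
    conv m (λ i δ → q ^ E i * (gauss N (+ δ) * (s * (q ^ X * (gauss (b i) (b′ i) * gauss (a i) (a′ i)))))) ≈
    s * (q ^ Q₀ * (gauss P r′ * gauss p p′))
  burge″ s E X P k u e m Q≡ N≡ a≡ a′≡ b≡ b′≡ p≡ p′≡ r′≡ =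
    trans (conv-cong m (λ i δ → *-congˡ (*-congˡ (*-congˡ (*-congˡ (*-comm _ _))))))
      (trans (burge′ s E X P k u e m Q≡ N≡ a≡ a′≡ b≡ b′≡ p≡ p′≡ r′≡) (*-congˡ (*-congˡ (*-comm _ _))))

  -- The sum over i starts at max (j, - e - j), so the sign of j decides which of
  -- the two q-binomial coefficients plays which role in the q-Saalschütz sum.
  F-burge⁺ : ∀ t x y y′ e l m n →
    conv m (λ i δ → q ^ (i ℕ.* (i ℕ.+ e)) *
      (gauss (l ℤ.+ l ℤ.- + (e ℕ.+ x)) (+ δ) * F-term t x y e (l ℤ.- + e ℤ.- + i) (+ i) (+ n))) ≈
    F-term (suc t) (e ℕ.+ x) y′ e l (+ m) (+ n)
  F-burge⁺ t x y y′ e l m n =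
    burge′ (σ (+ n)) (λ i → i ℕ.* (i ℕ.+ e)) (ex t x y (+ n))
      (l ℤ.- + (e ℕ.+ x) ℤ.- + (n ℕ.+ T)) (x ℕ.+ (T ℕ.+ T)) n (e ℕ.+ (n ℕ.+ n)) m
      (λ κ → degree n κ e x T)
      (N≡ l (+ e) (+ x) (+ n) (+ T)) (λ i → a≡ l (+ e) (+ x) (+ n) (+ T) (+ i)) (λ i → ≡.refl)
      (λ i → b≡ l (+ e) (+ x) (+ n) (+ T) (+ i)) (λ i → r≡ (+ i) (+ e) (+ n))
      (p≡ l (+ e) (+ x) (+ n) (+ T)) ≡.refl (r≡ (+ m) (+ e) (+ n))
    where
    T = t ℕ.* n
    degree : ∀ n κ e x T → (n ℕ.+ κ) ℕ.* (n ℕ.+ κ ℕ.+ e) ℕ.+ n ℕ.* (T ℕ.+ x) ≡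
                           n ℕ.* (n ℕ.+ T ℕ.+ (e ℕ.+ x)) ℕ.+ κ ℕ.* (κ ℕ.+ (e ℕ.+ (n ℕ.+ n)))
    degree = ℕSolver.solve-∀
    N≡ : ∀ l e x n T → l ℤ.+ l ℤ.- (e ℤ.+ x) ≡
      l ℤ.- (e ℤ.+ x) ℤ.- (n ℤ.+ T) ℤ.+ (l ℤ.- (e ℤ.+ x) ℤ.- (n ℤ.+ T)) ℤ.+ (x ℤ.+ (T ℤ.+ T)) ℤ.+ (e ℤ.+ (n ℤ.+ n))
    N≡ = ℤSolver.solve-∀
    a≡ : ∀ l e x n T i → l ℤ.- e ℤ.- i ℤ.+ T ≡
      l ℤ.- (e ℤ.+ x) ℤ.- (n ℤ.+ T) ℤ.+ (x ℤ.+ (T ℤ.+ T)) ℤ.+ n ℤ.- i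
    a≡ = ℤSolver.solve-∀
    b≡ : ∀ l e x n T i → l ℤ.- e ℤ.- i ℤ.- x ℤ.- T ≡ l ℤ.- (e ℤ.+ x) ℤ.- (n ℤ.+ T) ℤ.+ n ℤ.- i
    b≡ = ℤSolver.solve-∀
    r≡ : ∀ i e n → i ℤ.+ e ℤ.+ n ≡ i ℤ.- n ℤ.+ (e ℤ.+ (n ℤ.+ n))
    r≡ = ℤSolver.solve-∀
    p≡ : ∀ l e x n T → l ℤ.+ (n ℤ.+ T) ≡
      l ℤ.- (e ℤ.+ x) ℤ.- (n ℤ.+ T) ℤ.+ (x ℤ.+ (T ℤ.+ T)) ℤ.+ (e ℤ.+ (n ℤ.+ n))
    p≡ = ℤSolver.solve-∀

  -- For j = -1 - n one has a ≤ 0 and b < 0. The first index is n, and -2b = 2n + 1 and -2a = 2T +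
  -- (x + y) + y serve as `e` and `k`. The difference y = t - x is unchanged.
  F-burge⁻₁ : ∀ x y l m n →
    conv m (λ i δ → q ^ (i ℕ.* (i ℕ.+ 1)) *
      (gauss (l ℤ.+ l ℤ.- + suc x) (+ δ) * F-term (x ℕ.+ y) x y 1 (l ℤ.- + 1 ℤ.- + i) (+ i) -[1+ n ])) ≈
    F-term (suc (x ℕ.+ y)) (suc x) y 1 l (+ m) -[1+ n ]
  F-burge⁻₁ x y l m n =
    burge″ (σ -[1+ n ]) (λ i → i ℕ.* (i ℕ.+ 1)) (ex (x ℕ.+ y) x y -[1+ n ])
      (l ℤ.- + (suc (x ℕ.+ y) ℕ.+ (n ℕ.+ T))) (T ℕ.+ T ℕ.+ (x ℕ.+ y) ℕ.+ y) n (suc (n ℕ.+ n)) m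
      (λ κ → degree n κ y T)
      (N≡ l (+ x) (+ y) (+ n) (+ T)) (λ i → a≡ l (+ x) (+ y) (+ n) (+ T) (+ i)) (λ i → p′≡ (+ i) (+ n))
      (λ i → b≡ l (+ x) (+ y) (+ n) (+ T) (+ i)) (λ i → r≡ (+ i) (+ n))
      (p≡ l (+ x) (+ y) (+ n) (+ T)) (p′≡ (+ m) (+ n)) (r≡ (+ m) (+ n))
    where
    T = (x ℕ.+ y) ℕ.* n
    degree : ∀ n κ y T → (n ℕ.+ κ) ℕ.* (n ℕ.+ κ ℕ.+ 1) ℕ.+ suc n ℕ.* (T ℕ.+ y) ≡
                         suc n ℕ.* (n ℕ.+ T ℕ.+ y) ℕ.+ κ ℕ.* (κ ℕ.+ suc (n ℕ.+ n))
    degree = ℕSolver.solve-∀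
    N≡ : ∀ l x y n T → l ℤ.+ l ℤ.- (+ 1 ℤ.+ x) ≡
      l ℤ.- (+ 1 ℤ.+ (x ℤ.+ y) ℤ.+ (n ℤ.+ T)) ℤ.+ (l ℤ.- (+ 1 ℤ.+ (x ℤ.+ y) ℤ.+ (n ℤ.+ T)))
        ℤ.+ (T ℤ.+ T ℤ.+ (x ℤ.+ y) ℤ.+ y) ℤ.+ (+ 1 ℤ.+ (n ℤ.+ n))
    N≡ = ℤSolver.solve-∀
    a≡ : ∀ l x y n T i → l ℤ.- + 1 ℤ.- i ℤ.- x ℤ.- (ℤ.- (x ℤ.+ y ℤ.+ T)) ≡
      l ℤ.- (+ 1 ℤ.+ (x ℤ.+ y) ℤ.+ (n ℤ.+ T)) ℤ.+ (T ℤ.+ T ℤ.+ (x ℤ.+ y) ℤ.+ y) ℤ.+ n ℤ.- i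
    a≡ = ℤSolver.solve-∀
    b≡ : ∀ l x y n T i → l ℤ.- + 1 ℤ.- i ℤ.+ (ℤ.- (x ℤ.+ y ℤ.+ T)) ≡
      l ℤ.- (+ 1 ℤ.+ (x ℤ.+ y) ℤ.+ (n ℤ.+ T)) ℤ.+ n ℤ.- i
    b≡ = ℤSolver.solve-∀
    r≡ : ∀ i n → i ℤ.- (ℤ.- (+ 1 ℤ.+ n)) ≡ i ℤ.- n ℤ.+ (+ 1 ℤ.+ (n ℤ.+ n))
    r≡ = ℤSolver.solve-∀
    p≡ : ∀ l x y n T → l ℤ.- (+ 1 ℤ.+ x) ℤ.- (ℤ.- (+ 1 ℤ.+ (x ℤ.+ y) ℤ.+ (n ℤ.+ T))) ≡
      l ℤ.- (+ 1 ℤ.+ (x ℤ.+ y) ℤ.+ (n ℤ.+ T)) ℤ.+ (T ℤ.+ T ℤ.+ (x ℤ.+ y) ℤ.+ y) ℤ.+ (+ 1 ℤ.+ (n ℤ.+ n))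
    p≡ = ℤSolver.solve-∀
    p′≡ : ∀ i n → i ℤ.+ + 1 ℤ.+ (ℤ.- (+ 1 ℤ.+ n)) ≡ i ℤ.- n
    p′≡ = ℤSolver.solve-∀

  -- With b = j the first index is n + 1, one more than for b = j + 1/2; hence a separate lemma.
  F-burge⁻₀ : ∀ t l m n →
    conv m (λ i δ → q ^ (i ℕ.* (i ℕ.+ 0)) *
      (gauss (l ℤ.+ l ℤ.- + 0) (+ δ) * F-term t 0 t 0 (l ℤ.- + 0 ℤ.- + i) (+ i) -[1+ n ])) ≈
    F-term (suc t) 0 (suc t) 0 l (+ m) -[1+ n ]
  F-burge⁻₀ t l m n =
    burge″ (σ -[1+ n ]) (λ i → i ℕ.* (i ℕ.+ 0)) (ex t 0 t -[1+ n ])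
      (l ℤ.- + (suc t ℕ.+ (n ℕ.+ T))) (t ℕ.+ T ℕ.+ (t ℕ.+ T)) (suc n) (suc n ℕ.+ suc n) m
      (λ κ → degree n κ t T)
      (N≡ l (+ t) (+ n) (+ T)) (λ i → a≡ l (+ t) (+ n) (+ T) (+ i)) (λ i → p′≡ (+ i) (+ n))
      (λ i → b≡ l (+ t) (+ n) (+ T) (+ i)) (λ i → r≡ (+ i) (+ n))
      (p≡ l (+ t) (+ n) (+ T)) (p′≡ (+ m) (+ n)) (r≡ (+ m) (+ n))
    where
    T = t ℕ.* n
    degree : ∀ n κ t T → (suc n ℕ.+ κ) ℕ.* (suc n ℕ.+ κ ℕ.+ 0) ℕ.+ suc n ℕ.* (T ℕ.+ t) ≡
                         suc n ℕ.* (n ℕ.+ T ℕ.+ suc t) ℕ.+ κ ℕ.* (κ ℕ.+ (suc n ℕ.+ suc n))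
    degree = ℕSolver.solve-∀
    N≡ : ∀ l t n T → l ℤ.+ l ℤ.- + 0 ≡
      l ℤ.- (+ 1 ℤ.+ t ℤ.+ (n ℤ.+ T)) ℤ.+ (l ℤ.- (+ 1 ℤ.+ t ℤ.+ (n ℤ.+ T)))
        ℤ.+ (t ℤ.+ T ℤ.+ (t ℤ.+ T)) ℤ.+ ((+ 1 ℤ.+ n) ℤ.+ (+ 1 ℤ.+ n))
    N≡ = ℤSolver.solve-∀
    a≡ : ∀ l t n T i → l ℤ.- + 0 ℤ.- i ℤ.- + 0 ℤ.- (ℤ.- (t ℤ.+ T)) ≡
      l ℤ.- (+ 1 ℤ.+ t ℤ.+ (n ℤ.+ T)) ℤ.+ (t ℤ.+ T ℤ.+ (t ℤ.+ T)) ℤ.+ (+ 1 ℤ.+ n) ℤ.- i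
    a≡ = ℤSolver.solve-∀
    b≡ : ∀ l t n T i → l ℤ.- + 0 ℤ.- i ℤ.+ (ℤ.- (t ℤ.+ T)) ≡
      l ℤ.- (+ 1 ℤ.+ t ℤ.+ (n ℤ.+ T)) ℤ.+ (+ 1 ℤ.+ n) ℤ.- i
    b≡ = ℤSolver.solve-∀
    r≡ : ∀ i n → i ℤ.- (ℤ.- (+ 1 ℤ.+ n)) ≡ i ℤ.- (+ 1 ℤ.+ n) ℤ.+ ((+ 1 ℤ.+ n) ℤ.+ (+ 1 ℤ.+ n))
    r≡ = ℤSolver.solve-∀
    p≡ : ∀ l t n T → l ℤ.- + 0 ℤ.- (ℤ.- (+ 1 ℤ.+ t ℤ.+ (n ℤ.+ T))) ≡
      l ℤ.- (+ 1 ℤ.+ t ℤ.+ (n ℤ.+ T)) ℤ.+ (t ℤ.+ T ℤ.+ (t ℤ.+ T)) ℤ.+ ((+ 1 ℤ.+ n) ℤ.+ (+ 1 ℤ.+ n))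
    p≡ = ℤSolver.solve-∀
    p′≡ : ∀ i n → i ℤ.+ + 0 ℤ.+ (ℤ.- (+ 1 ℤ.+ n)) ≡ i ℤ.- (+ 1 ℤ.+ n)
    p′≡ = ℤSolver.solve-∀

  F-burge₁ : ∀ x y J l m →
    conv m (λ i δ → q ^ (i ℕ.* (i ℕ.+ 1)) *
      (gauss (l ℤ.+ l ℤ.- + suc x) (+ δ) * F (x ℕ.+ y) x y 1 J (l ℤ.- + 1 ℤ.- + i) (+ i))) ≈
    F (suc (x ℕ.+ y)) (suc x) y 1 J l (+ m)
  F-burge₁ x y J l m = trans (conv-Σℤ m J _ _ _) (Σℤ-cong J λ
    { (+ n)    → F-burge⁺ (x ℕ.+ y) x y y 1 l m n
    ; -[1+ n ] → F-burge⁻₁ x y l m n })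

  F-burge₀ : ∀ t J l m →
    conv m (λ i δ → q ^ (i ℕ.* (i ℕ.+ 0)) *
      (gauss (l ℤ.+ l ℤ.- + 0) (+ δ) * F t 0 t 0 J (l ℤ.- + 0 ℤ.- + i) (+ i))) ≈
    F (suc t) 0 (suc t) 0 J l (+ m)
  F-burge₀ t J l m = trans (conv-Σℤ m J _ _ _) (Σℤ-cong J λ
    { (+ n)    → F-burge⁺ t 0 t (suc t) 0 l m n
    ; -[1+ n ] → F-burge⁻₀ t l m n })

  -- The base case: a Pascal recurrence in q².

  -- The hypothesis excludes x = y = 0, the only point where the rule fails. For negative x the
  -- meaningless exponent `∣ x ∣` multiplies 0.
  gauss-pascalˡ : ∀ x y n → x ℤ.+ y ≡ + suc n →
    gauss x y ≈ gauss (x ℤ.- + 1) y + q ^ ℤ.∣ x ∣ * gauss x (y ℤ.- + 1)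
  gauss-pascalˡ (+ zero)  (+ suc b) n _ = begin
    h 0 (suc b)                  ≈⟨ trans (h-zeroˡ (suc b)) (sym (h-zeroˡ b)) ⟩
    h 0 b                        ≈⟨ solve 1 (λ x → x := con 0 :+ con 1 :* x) refl (h 0 b) ⟩
    0# + 1# * h 0 b              ∎
  gauss-pascalˡ (+ suc a) (+ zero)  n _ = solve 1 (λ x → con 1 := con 1 :+ x :* con 0) refl (q ^ suc a)
  gauss-pascalˡ (+ suc a) (+ suc b) n _ = h-pascalˡ a b
  gauss-pascalˡ (+ a)     -[1+ b ]  n _ = sym (trans
    (+-cong (gauss-negʳ (+ a ℤ.- + 1) ℤ.-<+) (zeroʳ (q ^ a))) (+-identityˡ 0#))
  gauss-pascalˡ -[1+ a ]  y         n _ = sym (trans (+-identityˡ _) (zeroʳ _))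

  -- For negative x the exponent `∣ x ∣` is wrong but `gauss x y` is 0, so it is enough that the
  -- exponents add up in the integers.
  raise : ∀ E x y z E′ → + E ℤ.+ x ≡ + E′ → q ^ E * (q ^ ℤ.∣ x ∣ * (gauss x y * z)) ≈ q ^ E′ * (gauss x y * z)
  raise E (+ a) y z E′ E+x≡ = trans (sym (*-assoc _ _ _))
    (*-congʳ (trans (sym (q^+ E a)) (q^≡ (ℤ.+-injective E+x≡))))
  raise E -[1+ a ] y z E′ _ = trans (≈0ʳ _ (≈0ʳ _ (zeroˡ z))) (sym (≈0ʳ _ (zeroˡ z)))

  raise₂ : ∀ x x′ y y′ z D → x ℤ.+ x′ ≡ + D →
    q ^ ℤ.∣ x ∣ * (q ^ ℤ.∣ x′ ∣ * (gauss x y * gauss x′ y′ * z)) ≈ q ^ D * (gauss x y * gauss x′ y′ * z)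
  raise₂ (+ a) (+ a′) y y′ z D x+x′≡ = trans (sym (*-assoc _ _ _))
    (*-congʳ (trans (sym (q^+ a a′)) (q^≡ (ℤ.+-injective x+x′≡))))
  raise₂ -[1+ a ] x′ y y′ z D _ = trans (≈0ʳ _ (≈0ʳ _ (≈0ˡ z (zeroˡ _)))) (sym (≈0ʳ _ (≈0ˡ z (zeroˡ _))))
  raise₂ (+ a) -[1+ a′ ] y y′ z D _ = trans (≈0ʳ _ (≈0ʳ _ (≈0ˡ z (zeroʳ _)))) (sym (≈0ʳ _ (≈0ˡ z (zeroʳ _))))

  1⋆_ : ∀ j → 1 ⋆ j ≡ j
  1⋆ (+ n)    = ≡.cong +_ (ℕ.+-identityʳ n)
  1⋆ -[1+ n ] = ≡.cong -[1+_] (ℕ.+-identityʳ n)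

  -1*-1≈1 : - 1# * - 1# ≈ 1#
  -1*-1≈1 = trans (sym (RingProperties.-‿distribˡ-* 1# (- 1#)))
    (trans (-‿cong (*-identityˡ (- 1#))) (RingProperties.-‿involutive 1#))

  σ-suc : ∀ j → σ (ℤ.suc j) ≈ - 1# * σ j
  σ-suc (+ n)          = refl
  σ-suc -[1+ zero ]    = begin
    1#                 ≈⟨ -1*-1≈1 ⟨
    - 1# * - 1#        ≈⟨ *-congˡ (*-identityʳ (- 1#)) ⟨
    - 1# * (- 1# * 1#) ∎
  σ-suc -[1+ suc n ]   = begin
    - 1# * X                 ≈⟨ *-identityˡ _ ⟨
    1# * (- 1# * X)          ≈⟨ *-congʳ -1*-1≈1 ⟨
    - 1# * - 1# * (- 1# * X) ≈⟨ *-assoc _ _ _ ⟩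
    - 1# * (- 1# * (- 1# * X)) ∎
    where
    X = (- 1#) ^ n

  cancel-signs : ∀ {s t x y} → s ≈ - 1# * t → x ≈ y → s * x + t * y ≈ 0#
  cancel-signs {s} {t} {x} {y} s≈ x≈y = begin
    s * x + t * y                ≈⟨ +-congʳ (*-cong s≈ x≈y) ⟩
    - 1# * t * y + t * y         ≈⟨ solve 3 (λ m t y → m :* t :* y :+ t :* y := (m :+ con 1) :* (t :* y)) refl (- 1#) t y ⟩
    (- 1# + 1#) * (t * y)        ≈⟨ ≈0ˡ _ (-‿inverseˡ 1#) ⟩
    0#                           ∎

  telescope : ∀ J (f g : ℤ → Carrier) → (∀ j → g (ℤ.suc j) + f j ≈ 0#) →
    Σℤ (suc J) (λ j → f j + g j) ≈ f (+ J) + g -[1+ J ]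
  telescope zero f g g+f = begin
    0# + ((f (+ 0) + g (+ 0)) + (f -[1+ 0 ] + g -[1+ 0 ]))
      ≈⟨ solve 4 (λ a b c d → con 0 :+ ((a :+ b) :+ (c :+ d)) := (b :+ c) :+ (a :+ d)) refl _ _ _ _ ⟩
    (g (+ 0) + f -[1+ 0 ]) + (f (+ 0) + g -[1+ 0 ]) ≈⟨ trans (+-congʳ (g+f -[1+ 0 ])) (+-identityˡ _) ⟩
    f (+ 0) + g -[1+ 0 ] ∎
  telescope (suc J) f g g+f = begin
    Σℤ (suc J) (λ j → f j + g j) + ((f (+ suc J) + g (+ suc J)) + (f -[1+ suc J ] + g -[1+ suc J ]))
      ≈⟨ +-congʳ (telescope J f g g+f) ⟩
    (f (+ J) + g -[1+ J ]) + ((f (+ suc J) + g (+ suc J)) + (f -[1+ suc J ] + g -[1+ suc J ]))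
      ≈⟨ solve 6 (λ a b c d e f → (a :+ b) :+ ((c :+ d) :+ (e :+ f)) := (d :+ a) :+ (b :+ e) :+ (c :+ f))
           refl _ _ _ _ _ _ ⟩
    (g (+ suc J) + f (+ J)) + (g -[1+ J ] + f -[1+ suc J ]) + (f (+ suc J) + g -[1+ suc J ])
      ≈⟨ +-congʳ (trans (+-cong (g+f (+ J)) (g+f -[1+ suc J ])) (+-identityˡ 0#)) ⟩
    0# + (f (+ suc J) + g -[1+ suc J ]) ≈⟨ +-identityˡ _ ⟩
    f (+ suc J) + g -[1+ suc J ] ∎

  j²+j j²-j : ℤ → ℕ
  j²+j (+ n)      = n ℕ.* suc n
  j²+j -[1+ n ]   = suc n ℕ.* n
  j²-j (+ zero)   = 0
  j²-j (+ suc n)  = suc n ℕ.* n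
  j²-j -[1+ n ]   = suc n ℕ.* suc (suc n)

  j²-j-suc : ∀ j → j²-j (ℤ.suc j) ≡ j²+j j
  j²-j-suc (+ n)        = ℕ.*-comm (suc n) n
  j²-j-suc -[1+ zero ]  = ≡.refl
  j²-j-suc -[1+ suc n ] = ℕ.*-comm (suc n) (suc (suc n))

  j²+j-degree : ∀ a j → + ex 1 0 1 j ℤ.+ (+ a ℤ.+ 1 ⋆ j) ≡ + (j²+j j ℕ.+ a)
  j²+j-degree a (+ n) = ≡.cong +_ (degree a n)
    where
    degree : ∀ a n → n ℕ.* (1 ℕ.* n ℕ.+ 0) ℕ.+ (a ℕ.+ 1 ℕ.* n) ≡ n ℕ.* suc n ℕ.+ a
    degree = ℕSolver.solve-∀
  j²+j-degree a -[1+ n ] = ≡.trans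
    (≡.cong (λ x → + x ℤ.+ (+ a ℤ.+ 1 ⋆ -[1+ n ])) (degree n))
    (cancel (+ (suc n ℕ.* n)) (+ (1 ℕ.+ 1 ℕ.* n)) (+ a))
    where
    degree : ∀ n → suc n ℕ.* (1 ℕ.* n ℕ.+ 1) ≡ suc n ℕ.* n ℕ.+ (1 ℕ.+ 1 ℕ.* n)
    degree = ℕSolver.solve-∀
    cancel : ∀ t n a → t ℤ.+ n ℤ.+ (a ℤ.+ ℤ.- n) ≡ t ℤ.+ a
    cancel = ℤSolver.solve-∀

  j²-j-degree : ∀ a j → + ex 1 0 1 j ℤ.+ (+ a ℤ.- + 0 ℤ.- 1 ⋆ j) ≡ + (j²-j j ℕ.+ a)
  j²-j-degree a (+ zero) = cancel (+ a)
    where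
    cancel : ∀ a → + 0 ℤ.+ (a ℤ.- + 0 ℤ.- + 0) ≡ a
    cancel = ℤSolver.solve-∀
  j²-j-degree a (+ suc n) = ≡.trans
    (≡.cong (λ x → + x ℤ.+ (+ a ℤ.- + 0 ℤ.- 1 ⋆ + suc n)) (degree n))
    (cancel (+ (suc n ℕ.* n)) (+ (1 ℕ.* suc n)) (+ a))
    where
    degree : ∀ n → suc n ℕ.* (1 ℕ.* suc n ℕ.+ 0) ≡ suc n ℕ.* n ℕ.+ 1 ℕ.* suc n
    degree = ℕSolver.solve-∀
    cancel : ∀ t n a → t ℤ.+ n ℤ.+ (a ℤ.- + 0 ℤ.- n) ≡ t ℤ.+ a
    cancel = ℤSolver.solve-∀
  j²-j-degree a -[1+ n ] = ≡.trans
    (cancel (+ ex 1 0 1 -[1+ n ]) (+ (1 ℕ.+ 1 ℕ.* n)) (+ a))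
    (≡.cong +_ (degree a n))
    where
    degree : ∀ a n → suc n ℕ.* (1 ℕ.* n ℕ.+ 1) ℕ.+ (1 ℕ.+ 1 ℕ.* n) ℕ.+ a ≡ suc n ℕ.* suc (suc n) ℕ.+ a
    degree = ℕSolver.solve-∀
    cancel : ∀ t n a → t ℤ.+ (a ℤ.- + 0 ℤ.- ℤ.- n) ≡ t ℤ.+ n ℤ.+ a
    cancel = ℤSolver.solve-∀

  module _ (a b : ℕ) where

    private
      x x′ y y′ : ℤ → ℤ
      x  j = + suc a ℤ.+ 1 ⋆ j
      x′ j = + suc a ℤ.- + 0 ℤ.- 1 ⋆ j
      y  j = + suc b ℤ.- j
      y′ j = + suc b ℤ.+ + 0 ℤ.+ j

      cross⁺ cross⁻ : ℤ → Carrier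
      cross⁺ j = σ j * (q ^ (j²+j j ℕ.+ suc a) * (gauss (x j) (y j ℤ.- + 1) * gauss (x′ j ℤ.- + 1) (y′ j)))
      cross⁻ j = σ j * (q ^ (j²-j j ℕ.+ suc a) * (gauss (x′ j) (y′ j ℤ.- + 1) * gauss (x j ℤ.- + 1) (y j)))

      -- Replacing j by j + 1 turns j² - j into j² + j, exchanges which factor has been lowered, and
      -- reverses the sign.
      cross-cancel : ∀ j → cross⁻ (ℤ.suc j) + cross⁺ j ≈ 0#
      cross-cancel j = cancel-signs (σ-suc j)
        (*-cong (q^≡ (≡.cong (ℕ._+ suc a) (j²-j-suc j)))
          (trans (*-comm _ _) (*-cong (gauss-cong x≡ y≡) (gauss-cong x′≡ y′≡))))
        where
        step : 1 ⋆ ℤ.suc j ≡ + 1 ℤ.+ 1 ⋆ j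
        step = ≡.trans (1⋆ ℤ.suc j) (≡.cong ℤ.suc (≡.sym (1⋆ j)))
        x≡ : x (ℤ.suc j) ℤ.- + 1 ≡ x j
        x≡ = ≡.trans (≡.cong (λ z → + suc a ℤ.+ z ℤ.- + 1) step) (arith (+ suc a) (1 ⋆ j))
          where
          arith : ∀ a j → a ℤ.+ (+ 1 ℤ.+ j) ℤ.- + 1 ≡ a ℤ.+ j
          arith = ℤSolver.solve-∀
        x′≡ : x′ (ℤ.suc j) ≡ x′ j ℤ.- + 1
        x′≡ = ≡.trans (≡.cong (λ z → + suc a ℤ.- + 0 ℤ.- z) step) (arith (+ suc a) (1 ⋆ j))
          where
          arith : ∀ a j → a ℤ.- + 0 ℤ.- (+ 1 ℤ.+ j) ≡ a ℤ.- + 0 ℤ.- j ℤ.- + 1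
          arith = ℤSolver.solve-∀
        y≡ : y (ℤ.suc j) ≡ y j ℤ.- + 1
        y≡ = arith (+ suc b) j
          where
          arith : ∀ b j → b ℤ.- (+ 1 ℤ.+ j) ≡ b ℤ.- j ℤ.- + 1
          arith = ℤSolver.solve-∀
        y′≡ : y′ (ℤ.suc j) ℤ.- + 1 ≡ y′ j
        y′≡ = arith (+ suc b) j
          where
          arith : ∀ b j → b ℤ.+ + 0 ℤ.+ (+ 1 ℤ.+ j) ℤ.- + 1 ≡ b ℤ.+ + 0 ℤ.+ j
          arith = ℤSolver.solve-∀

      -- Of the four products of the two Pascal rules, the unmixed ones carry 1 and q^(2a + 2), as
      -- in the q²-Pascal rule. The mixed ones carry q^(a + 1 + j) and q^(a + 1 - j) and become
      -- `cross⁺` and `cross⁻`.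
      F-term-pascal : ∀ j → F-term 1 0 1 0 (+ suc a) (+ suc b) j ≈
        (F-term 1 0 1 0 (+ a) (+ suc b) j + q ^ (suc a ℕ.+ suc a) * F-term 1 0 1 0 (+ suc a) (+ b) j)
        + (cross⁺ j + cross⁻ j)
      F-term-pascal j = begin
        σ j * (E * (gauss (x j) (y j) * gauss (x′ j) (y′ j)))
          ≈⟨ *-congˡ (*-congˡ (*-cong (gauss-pascalˡ (x j) (y j) (a ℕ.+ suc b) xy≡)
               (gauss-pascalˡ (x′ j) (y′ j) (a ℕ.+ suc b) x′y′≡))) ⟩
        σ j * (E * ((A₁ + Q * A₂) * (B₁ + Q′ * B₂)))
          ≈⟨ solve 8 (λ s e a₁ a₂ b₁ b₂ p p′ → s :* (e :* ((a₁ :+ p :* a₂) :* (b₁ :+ p′ :* b₂))) :=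
               s :* (e :* (a₁ :* b₁)) :+ p :* (p′ :* (a₂ :* b₂ :* (s :* e)))
               :+ (s :* (e :* (p :* (a₂ :* b₁))) :+ s :* (e :* (p′ :* (b₂ :* a₁))))) refl
               (σ j) E A₁ A₂ B₁ B₂ Q Q′ ⟩
        σ j * (E * (A₁ * B₁)) + Q * (Q′ * (A₂ * B₂ * (σ j * E)))
          + (σ j * (E * (Q * (A₂ * B₁))) + σ j * (E * (Q′ * (B₂ * A₁))))
          ≈⟨ +-cong (+-cong (*-congˡ (*-congˡ (*-cong (gauss-cong x-1≡ ≡.refl) (gauss-cong x′-1≡ ≡.refl))))
               (trans (raise₂ (x j) (x′ j) _ _ _ (suc a ℕ.+ suc a) xx′≡)
                 (*-congˡ (trans (solve 4 (λ a b s e → a :* b :* (s :* e) := s :* (e :* (a :* b))) refl A₂ B₂ (σ j) E)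
                   (*-congˡ (*-congˡ (*-cong (gauss-cong {x j} ≡.refl y-1≡) (gauss-cong {x′ j} ≡.refl y′-1≡))))))))
               (+-cong (*-congˡ (raise (ex 1 0 1 j) (x j) _ _ _ (j²+j-degree (suc a) j)))
                 (*-congˡ (raise (ex 1 0 1 j) (x′ j) _ _ _ (j²-j-degree (suc a) j)))) ⟩
        (F-term 1 0 1 0 (+ a) (+ suc b) j + q ^ (suc a ℕ.+ suc a) * F-term 1 0 1 0 (+ suc a) (+ b) j)
          + (cross⁺ j + cross⁻ j) ∎
        where
        E  = q ^ ex 1 0 1 j
        Q  = q ^ ℤ.∣ x j ∣
        Q′ = q ^ ℤ.∣ x′ j ∣
        A₁ = gauss (x j ℤ.- + 1) (y j)
        A₂ = gauss (x j) (y j ℤ.- + 1)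
        B₁ = gauss (x′ j ℤ.- + 1) (y′ j)
        B₂ = gauss (x′ j) (y′ j ℤ.- + 1)
        xy≡ : x j ℤ.+ y j ≡ + suc (a ℕ.+ suc b)
        xy≡ = ≡.trans (≡.cong (λ z → + suc a ℤ.+ z ℤ.+ y j) (1⋆ j)) (arith (+ suc a) (+ suc b) j)
          where
          arith : ∀ a b j → a ℤ.+ j ℤ.+ (b ℤ.- j) ≡ a ℤ.+ b
          arith = ℤSolver.solve-∀
        x′y′≡ : x′ j ℤ.+ y′ j ≡ + suc (a ℕ.+ suc b)
        x′y′≡ = ≡.trans (≡.cong (λ z → + suc a ℤ.- + 0 ℤ.- z ℤ.+ y′ j) (1⋆ j)) (arith (+ suc a) (+ suc b) j)
          where
          arith : ∀ a b j → a ℤ.- + 0 ℤ.- j ℤ.+ (b ℤ.+ + 0 ℤ.+ j) ≡ a ℤ.+ b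
          arith = ℤSolver.solve-∀
        xx′≡ : x j ℤ.+ x′ j ≡ + (suc a ℕ.+ suc a)
        xx′≡ = arith (+ suc a) (1 ⋆ j)
          where
          arith : ∀ a j → a ℤ.+ j ℤ.+ (a ℤ.- + 0 ℤ.- j) ≡ a ℤ.+ a
          arith = ℤSolver.solve-∀
        x-1≡ : x j ℤ.- + 1 ≡ + a ℤ.+ 1 ⋆ j
        x-1≡ = arith (+ a) (1 ⋆ j)
          where
          arith : ∀ a j → + 1 ℤ.+ a ℤ.+ j ℤ.- + 1 ≡ a ℤ.+ j
          arith = ℤSolver.solve-∀
        x′-1≡ : x′ j ℤ.- + 1 ≡ + a ℤ.- + 0 ℤ.- 1 ⋆ j
        x′-1≡ = arith (+ a) (1 ⋆ j)
          where
          arith : ∀ a j → + 1 ℤ.+ a ℤ.- + 0 ℤ.- j ℤ.- + 1 ≡ a ℤ.- + 0 ℤ.- j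
          arith = ℤSolver.solve-∀
        y-1≡ : y j ℤ.- + 1 ≡ + b ℤ.- j
        y-1≡ = arith (+ b) j
          where
          arith : ∀ b j → + 1 ℤ.+ b ℤ.- j ℤ.- + 1 ≡ b ℤ.- j
          arith = ℤSolver.solve-∀
        y′-1≡ : y′ j ℤ.- + 1 ≡ + b ℤ.+ + 0 ℤ.+ j
        y′-1≡ = arith (+ b) j
          where
          arith : ∀ b j → + 1 ℤ.+ b ℤ.+ + 0 ℤ.+ j ℤ.- + 1 ≡ b ℤ.+ + 0 ℤ.+ j
          arith = ℤSolver.solve-∀

    -- This is Pascal's rule for q²-binomial coefficients; the cross terms of the
    -- product of two q-Pascal rules telescope.
    F-pascal₀ : ∀ J → suc b ℕ.≤ J →
      F 1 0 1 0 (suc J) (+ suc a) (+ suc b) ≈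
      F 1 0 1 0 (suc J) (+ a) (+ suc b) + q ^ (suc a ℕ.+ suc a) * F 1 0 1 0 (suc J) (+ suc a) (+ b)
    F-pascal₀ J b<J = begin
      F 1 0 1 0 (suc J) (+ suc a) (+ suc b) ≈⟨ Σℤ-cong (suc J) F-term-pascal ⟩
      Σℤ (suc J) (λ j →
        (F-term 1 0 1 0 (+ a) (+ suc b) j + q ^ (suc a ℕ.+ suc a) * F-term 1 0 1 0 (+ suc a) (+ b) j)
        + (cross⁺ j + cross⁻ j))
        ≈⟨ trans (Σℤ-+ (suc J) _ _) (+-cong (trans (Σℤ-+ (suc J) _ _) (+-congˡ (Σℤ-*ˡ (suc J) _ _)))
             (trans (telescope J cross⁺ cross⁻ cross-cancel) (+-cong cross⁺≈0 cross⁻≈0))) ⟩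
      F 1 0 1 0 (suc J) (+ a) (+ suc b) + q ^ (suc a ℕ.+ suc a) * F 1 0 1 0 (suc J) (+ suc a) (+ b) + (0# + 0#)
        ≈⟨ trans (+-congˡ (+-identityˡ 0#)) (+-identityʳ _) ⟩
      F 1 0 1 0 (suc J) (+ a) (+ suc b) + q ^ (suc a ℕ.+ suc a) * F 1 0 1 0 (suc J) (+ suc a) (+ b) ∎
      where
      -- The telescoped sum leaves its two end terms; `b<J` puts both outside the support.
      outside : + suc b ℤ.- + suc J ℤ.< ℤ.0ℤ
      outside = below (suc b) (suc J) (s≤s b<J)
      cross⁺≈0 : cross⁺ (+ J) ≈ 0#
      cross⁺≈0 = ≈0ʳ _ (≈0ʳ _ (≈0ˡ _ (gauss-negʳ (x (+ J)) (≡.subst (ℤ._< ℤ.0ℤ) (arith (+ suc b) (+ J)) outside))))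
        where
        arith : ∀ b J → b ℤ.- (+ 1 ℤ.+ J) ≡ b ℤ.- J ℤ.- + 1
        arith = ℤSolver.solve-∀
      cross⁻≈0 : cross⁻ -[1+ J ] ≈ 0#
      cross⁻≈0 = ≈0ʳ _ (≈0ʳ _ (≈0ˡ _ (gauss-negʳ (x′ -[1+ J ])
        (≡.subst (ℤ._< ℤ.0ℤ) (≡.sym (arith (+ suc b) (+ J))) (ℤ.+-mono-<-≤ {y = ℤ.0ℤ} outside (ℤ.neg-≤-pos {1} {0}))))))
        where
        arith : ∀ b J → b ℤ.+ + 0 ℤ.+ ℤ.- (+ 1 ℤ.+ J) ℤ.- + 1 ≡ b ℤ.- (+ 1 ℤ.+ J) ℤ.+ ℤ.- + 1
        arith = ℤSolver.solve-∀

  -- Vanishing sums, and the passage from b = j + 1/2 to b = j.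

  neg-neg : ∀ p k → -[1+ p ] ℤ.+ ℤ.- + k ℤ.< ℤ.0ℤ
  neg-neg p k = ℤ.+-mono-<-≤ {y = ℤ.0ℤ} ℤ.-<+ (ℤ.neg-≤-pos {k} {0})

  -- If l is negative, so is l - x - t j for j ≥ 0 and l + t j for j < 0.
  F-negˡ : ∀ t x y e J p m → F t x y e J -[1+ p ] m ≈ 0#
  F-negˡ t x y e J p m = Σℤ-zero J λ n → trans
    (+-cong
      (≈0ʳ _ (≈0ʳ _ (≈0ʳ _ (gauss-negˡ _ (≡.subst (ℤ._< ℤ.0ℤ) (≡.sym (arith -[1+ p ] (+ x) (+ (t ℕ.* n))))
        (neg-neg p (x ℕ.+ t ℕ.* n)))))))
      (≈0ʳ _ (≈0ʳ _ (≈0ˡ _ (gauss-negˡ (m ℤ.- -[1+ n ]) (neg-neg p (t ℕ.+ t ℕ.* n)))))))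
    (+-identityˡ 0#)
    where
    arith : ∀ p x T → p ℤ.- x ℤ.- T ≡ p ℤ.+ ℤ.- (x ℤ.+ T)
    arith = ℤSolver.solve-∀

  F-negʳ : ∀ t x y J l p → F t x y 1 J l -[1+ p ] ≈ 0#
  F-negʳ t x y J l p = Σℤ-zero J λ n → trans
    (+-cong
      (≈0ʳ _ (≈0ʳ _ (≈0ˡ _ (gauss-negʳ (l ℤ.+ t ⋆ + n) (neg-neg p n)))))
      (≈0ʳ _ (≈0ʳ _ (≈0ʳ _ (gauss-negʳ (l ℤ.- + x ℤ.- t ⋆ -[1+ n ])
        (≡.subst (ℤ._< ℤ.0ℤ) (≡.sym (arith (+ p) (+ n))) ℤ.-<+))))))
    (+-identityˡ 0#)
    where
    arith : ∀ p n → ℤ.- (+ 1 ℤ.+ p) ℤ.+ + 1 ℤ.+ ℤ.- (+ 1 ℤ.+ n) ≡ ℤ.- (+ 1 ℤ.+ (p ℤ.+ n))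
    arith = ℤSolver.solve-∀

  -- As a = 0, the substitution j ↦ -1 - j exchanges the two factors and reverses the sign.
  F-antisym : ∀ J l m → F 0 0 0 1 J l m ≈ 0#
  F-antisym J l m = Σℤ-zero J λ n → trans (+-comm _ _) (cancel-signs refl
    (*-cong (q^≡ (≡.trans (ℕ.*-zeroʳ (suc n)) (≡.sym (ℕ.*-zeroʳ n))))
      (trans (*-comm _ _) (*-cong (gauss-cong (left l) (arith₁ m (+ n))) (gauss-cong (≡.sym (left l)) (arith₂ m (+ n)))))))
    where
    left : ∀ l → l ℤ.- + 0 ℤ.- + 0 ≡ l ℤ.+ + 0
    left = ℤSolver.solve-∀
    arith₁ : ∀ m n → m ℤ.+ + 1 ℤ.+ ℤ.- (+ 1 ℤ.+ n) ≡ m ℤ.- n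
    arith₁ = ℤSolver.solve-∀
    arith₂ : ∀ m n → m ℤ.- ℤ.- (+ 1 ℤ.+ n) ≡ m ℤ.+ + 1 ℤ.+ n
    arith₂ = ℤSolver.solve-∀

  gauss-pascalʳ : ∀ x b → gauss x (+ suc b) ≈ gauss x (+ b) + q ^ suc b * gauss (x ℤ.- + 1) (+ suc b)
  gauss-pascalʳ (+ zero)  b = trans (trans (h-zeroˡ (suc b)) (sym (h-zeroˡ b)))
    (sym (trans (+-congˡ (zeroʳ _)) (+-identityʳ _)))
  gauss-pascalʳ (+ suc a) b = h-pascalʳ a b
  gauss-pascalʳ -[1+ a ]  b = sym (trans (+-identityˡ _) (zeroʳ _))

  -- Admits second argument 0, where the rule would fail if the first argument were 0 as well.
  gauss-pascalʳ⁺ : ∀ a b → gauss (+ suc a) (+ b) ≈ gauss (+ suc a) (+ b ℤ.- + 1) + q ^ b * gauss (+ a) (+ b)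
  gauss-pascalʳ⁺ a zero    = solve 0 (con 1 := con 0 :+ con 1 :* con 1) refl
  gauss-pascalʳ⁺ a (suc b) = h-pascalʳ a b

  pascal-term : ∀ s E {E′ k K} A {x y z} → x ≈ y + q ^ k * z → E ℕ.+ k ≡ K ℕ.+ E′ →
    s * (q ^ E * (A * x)) ≈ s * (q ^ E * (A * y)) + q ^ K * (s * (q ^ E′ * (A * z)))
  pascal-term s E {E′} {k} {K} A {x} {y} {z} x≈ E+k≡ = begin
    s * (q ^ E * (A * x))               ≈⟨ *-congˡ (*-congˡ (*-congˡ x≈)) ⟩
    s * (q ^ E * (A * (y + q ^ k * z)))
      ≈⟨ solve 6 (λ s e a y k z → s :* (e :* (a :* (y :+ k :* z))) := s :* (e :* (a :* y)) :+ e :* k :* (s :* (a :* z)))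
           refl s (q ^ E) A y (q ^ k) z ⟩
    s * (q ^ E * (A * y)) + q ^ E * q ^ k * (s * (A * z))
      ≈⟨ +-congˡ (*-congʳ (trans (sym (q^+ E k)) (trans (q^≡ E+k≡) (q^+ K E′)))) ⟩
    s * (q ^ E * (A * y)) + q ^ K * q ^ E′ * (s * (A * z))
      ≈⟨ +-congˡ (solve 5 (λ s k e a z → k :* e :* (s :* (a :* z)) := k :* (s :* (e :* (a :* z)))) refl _ _ _ _ _) ⟩
    s * (q ^ E * (A * y)) + q ^ K * (s * (q ^ E′ * (A * z))) ∎

  -- Pascal's rule is applied to the second factor only. Its power q^(m + 1 + j) splits into the
  -- prefactor and the q^j that turns the exponent t j² into t j² + j; the lowered first argument
  -- turns x = 0 into x = 1.
  F-term-pascal₁ : ∀ y a m j →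
    F-term (suc y) 0 (suc y) 1 (+ a) (+ m) j ≈
    F-term (suc y) 0 (suc y) 0 (+ a) (+ m) j + q ^ suc m * F-term (suc y) 1 y 1 (+ a) (+ m) j
  F-term-pascal₁ y a m (+ n) =
    pascal-term (σ (+ n)) (ex (suc y) 0 (suc y) (+ n)) {ex (suc y) 1 y (+ n)} {suc (m ℕ.+ n)} {suc m} _
      (trans (gauss-cong {+ a ℤ.- + 0 ℤ.- + T} ≡.refl (arith₁ (+ m) (+ n)))
        (trans (gauss-pascalʳ (+ a ℤ.- + 0 ℤ.- + T) (m ℕ.+ n))
          (+-cong (gauss-cong {+ a ℤ.- + 0 ℤ.- + T} ≡.refl (arith₀ (+ m) (+ n)))
            (*-congˡ (gauss-cong (arith (+ a) (+ T)) (≡.sym (arith₁ (+ m) (+ n))))))))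
      (degree m n T)
    where
    T = suc y ℕ.* n
    degree : ∀ m n T → n ℕ.* (T ℕ.+ 0) ℕ.+ suc (m ℕ.+ n) ≡ suc m ℕ.+ n ℕ.* (T ℕ.+ 1)
    degree = ℕSolver.solve-∀
    arith₁ : ∀ m n → m ℤ.+ + 1 ℤ.+ n ≡ + 1 ℤ.+ (m ℤ.+ n)
    arith₁ = ℤSolver.solve-∀
    arith₀ : ∀ m n → m ℤ.+ n ≡ m ℤ.+ + 0 ℤ.+ n
    arith₀ = ℤSolver.solve-∀
    arith : ∀ a T → a ℤ.- + 0 ℤ.- T ℤ.- + 1 ≡ a ℤ.- + 1 ℤ.- T
    arith = ℤSolver.solve-∀
  F-term-pascal₁ y a m -[1+ n ] with split m n
  -- Here m < n, and all three terms vanish through their second factor.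
  ... | inj₁ (r , ≡.refl) = trans
    (≈0ʳ _ (≈0ʳ _ (≈0ʳ _ (gauss-negʳ (+ a ℤ.- + 0 ℤ.- suc y ⋆ -[1+ n ]) neg₁))))
    (sym (trans (+-cong
        (≈0ʳ _ (≈0ʳ _ (≈0ʳ _ (gauss-negʳ (+ a ℤ.- + 0 ℤ.- suc y ⋆ -[1+ n ]) neg₀))))
        (≈0ʳ _ (≈0ʳ _ (≈0ʳ _ (≈0ʳ _ (gauss-negʳ (+ a ℤ.- + 1 ℤ.- suc y ⋆ -[1+ n ]) neg₁))))))
      (+-identityˡ 0#)))
    where
    neg₁ : + m ℤ.+ + 1 ℤ.+ -[1+ n ] ℤ.< ℤ.0ℤ
    neg₁ = ≡.subst (ℤ._< ℤ.0ℤ) (≡.sym (arith (+ m) (+ r))) ℤ.-<+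
      where
      arith : ∀ m r → m ℤ.+ + 1 ℤ.+ ℤ.- (+ 1 ℤ.+ (+ 1 ℤ.+ (m ℤ.+ r))) ≡ ℤ.- (+ 1 ℤ.+ r)
      arith = ℤSolver.solve-∀
    neg₀ : + m ℤ.+ + 0 ℤ.+ -[1+ n ] ℤ.< ℤ.0ℤ
    neg₀ = ≡.subst (ℤ._< ℤ.0ℤ) (≡.sym (arith (+ m) (+ r))) ℤ.-<+
      where
      arith : ∀ m r → m ℤ.+ + 0 ℤ.+ ℤ.- (+ 1 ℤ.+ (+ 1 ℤ.+ (m ℤ.+ r))) ≡ ℤ.- (+ 1 ℤ.+ (+ 1 ℤ.+ r))
      arith = ℤSolver.solve-∀
  -- As t = `suc y` is positive, so is the first argument a + t (n + 1), and the rule holds even at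
  -- r = 0.
  ... | inj₂ (r , ≡.refl) =
    pascal-term (σ -[1+ n ]) (ex (suc y) 0 (suc y) -[1+ n ]) {ex (suc y) 1 y -[1+ n ]} {r} {suc m} _
      (trans (gauss-cong (arith-p (+ a) (+ y) (+ T)) (arith₁ (+ n) (+ r)))
        (trans (gauss-pascalʳ⁺ (a ℕ.+ (y ℕ.+ T)) r)
          (+-cong (gauss-cong (≡.sym (arith-p (+ a) (+ y) (+ T))) (arith₀ (+ n) (+ r)))
            (*-congˡ (gauss-cong (arith-p′ (+ a) (+ y) (+ T)) (≡.sym (arith₁ (+ n) (+ r))))))))
      (degree n r T y)
    where
    T = suc y ℕ.* n
    degree : ∀ n r T y → suc n ℕ.* (T ℕ.+ suc y) ℕ.+ r ≡ suc (n ℕ.+ r) ℕ.+ suc n ℕ.* (T ℕ.+ y)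
    degree = ℕSolver.solve-∀
    arith-p : ∀ a y T → a ℤ.- + 0 ℤ.- (ℤ.- (+ 1 ℤ.+ y ℤ.+ T)) ≡ + 1 ℤ.+ (a ℤ.+ (y ℤ.+ T))
    arith-p = ℤSolver.solve-∀
    arith-p′ : ∀ a y T → a ℤ.+ (y ℤ.+ T) ≡ a ℤ.- + 1 ℤ.- (ℤ.- (+ 1 ℤ.+ y ℤ.+ T))
    arith-p′ = ℤSolver.solve-∀
    arith₁ : ∀ n r → n ℤ.+ r ℤ.+ + 1 ℤ.+ ℤ.- (+ 1 ℤ.+ n) ≡ r
    arith₁ = ℤSolver.solve-∀
    arith₀ : ∀ n r → r ℤ.- + 1 ≡ n ℤ.+ r ℤ.+ + 0 ℤ.+ ℤ.- (+ 1 ℤ.+ n)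
    arith₀ = ℤSolver.solve-∀

  F-pascal₁ : ∀ y J a m →
    F (suc y) 0 (suc y) 1 J (+ a) (+ m) ≈
    F (suc y) 0 (suc y) 0 J (+ a) (+ m) + q ^ suc m * F (suc y) 1 y 1 J (+ a) (+ m)
  F-pascal₁ y J a m = trans (Σℤ-cong J (F-term-pascal₁ y a m))
    (trans (Σℤ-+ J _ _) (+-congˡ (Σℤ-*ˡ J _ _)))


  -- The transform with a and b exchanged, and the merging of the products.

  conv-cong′ : ∀ n {f g} → (∀ i j → i ℕ.+ j ≡ n → f i j ≈ g i j) → conv n f ≈ conv n g
  conv-cong′ zero    f≈g = f≈g 0 0 ≡.refl
  conv-cong′ (suc n) f≈g =
    +-cong (f≈g 0 (suc n) ≡.refl) (conv-cong′ n (λ i j i+j≡n → f≈g (suc i) j (≡.cong suc i+j≡n)))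

  -- With ν = s + y this is (ν + 1) j (ν j + s): the exponent ν j² + s j of `F` plus ν j (ν j + s),
  -- which is a² - s²/4.
  ex-H : (s y : ℕ) → ℤ → ℕ
  ex-H s y (+ n)    = (n ℕ.+ (s ℕ.+ y) ℕ.* n) ℕ.* ((s ℕ.+ y) ℕ.* n ℕ.+ s)
  ex-H s y -[1+ n ] = ((s ℕ.+ y) ℕ.* n ℕ.+ y) ℕ.* (suc (s ℕ.+ y) ℕ.+ (n ℕ.+ (s ℕ.+ y) ℕ.* n))

  -- In the notation of the overview L = m + s/2, M = i + (s + 1)/2, a = ν j + s/2 and b = (ν + 1) j
  -- + (s + 1)/2, where ν = s + y.
  H-term : (s y : ℕ) (m i : ℕ) → ℤ → Carrier
  H-term s y m i j = σ j * (q ^ ex-H s y j *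
    (gauss (+ m ℤ.+ + s ℤ.+ (s ℕ.+ y) ⋆ j) (+ i ℤ.- suc (s ℕ.+ y) ⋆ j) *
     gauss (+ m ℤ.- (s ℕ.+ y) ⋆ j) (+ i ℤ.+ + s ℤ.+ + 1 ℤ.+ suc (s ℕ.+ y) ⋆ j)))

  -- Symmetry of `gauss` exchanges L with M and (a, b) with (-b, -a), so that now j ≥ 0 is the case
  -- of `burge″`. The first index k is ν j for j ≥ 0 and -s - ν j for j < 0.
  H-burge-term : ∀ s y m i j →
    conv m (λ k δ → q ^ (k ℕ.* (k ℕ.+ s)) *
      (gauss (+ i ℤ.+ + i ℤ.+ + suc s) (+ δ) * F-term (s ℕ.+ y) s y 1 (+ k ℤ.+ + s) (+ i ℤ.- + k) j)) ≈
    H-term s y m i j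
  H-burge-term s y m i j = trans
    (conv-cong m (λ k δ → *-congˡ (*-congˡ (*-congˡ (*-congˡ (*-cong
      (gauss-comm (+ k ℤ.+ + s ℤ.+ ν ⋆ j) (+ i ℤ.- + k ℤ.- j))
      (gauss-comm (+ k ℤ.+ + s ℤ.- + s ℤ.- ν ⋆ j) (+ i ℤ.- + k ℤ.+ + 1 ℤ.+ j))))))))
    (trans (step j) (*-congˡ (*-congˡ (*-cong
      (gauss-comm (+ i ℤ.- suc ν ⋆ j) (+ m ℤ.+ + s ℤ.+ ν ⋆ j))
      (gauss-comm (+ i ℤ.+ + s ℤ.+ + 1 ℤ.+ suc ν ⋆ j) (+ m ℤ.- ν ⋆ j))))))
    where
    ν = s ℕ.+ y
    step : ∀ j → conv m (λ k δ → q ^ (k ℕ.* (k ℕ.+ s)) * (gauss (+ i ℤ.+ + i ℤ.+ + suc s) (+ δ) *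
        (σ j * (q ^ ex ν s y j * (gauss (+ i ℤ.- + k ℤ.- j) (+ k ℤ.+ + s ℤ.+ ν ⋆ j) *
                                  gauss (+ i ℤ.- + k ℤ.+ + 1 ℤ.+ j) (+ k ℤ.+ + s ℤ.- + s ℤ.- ν ⋆ j)))))) ≈
      σ j * (q ^ ex-H s y j * (gauss (+ i ℤ.- suc ν ⋆ j) (+ m ℤ.+ + s ℤ.+ ν ⋆ j) *
                               gauss (+ i ℤ.+ + s ℤ.+ + 1 ℤ.+ suc ν ⋆ j) (+ m ℤ.- ν ⋆ j)))
    step (+ n) = burge″ (σ (+ n)) (λ k → k ℕ.* (k ℕ.+ s)) (ex ν s y (+ n))
      (+ i ℤ.- + (n ℕ.+ T)) (suc (n ℕ.+ n)) T (s ℕ.+ (T ℕ.+ T)) m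
      (λ κ → degree n κ s T)
      (N≡ (+ i) (+ s) (+ n) (+ T)) (λ k → a≡ (+ i) (+ n) (+ T) (+ k)) (λ k → a′≡ (+ k) (+ s) (+ T))
      (λ k → b≡ (+ i) (+ n) (+ T) (+ k)) (λ k → r≡ (+ k) (+ s) (+ T))
      (p≡ (+ i) (+ s) (+ n) (+ T)) ≡.refl (r≡ (+ m) (+ s) (+ T))
      where
      T = ν ℕ.* n
      degree : ∀ n κ s T → (T ℕ.+ κ) ℕ.* (T ℕ.+ κ ℕ.+ s) ℕ.+ n ℕ.* (T ℕ.+ s) ≡
                           (n ℕ.+ T) ℕ.* (T ℕ.+ s) ℕ.+ κ ℕ.* (κ ℕ.+ (s ℕ.+ (T ℕ.+ T)))
      degree = ℕSolver.solve-∀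
      N≡ : ∀ i s n T → i ℤ.+ i ℤ.+ (+ 1 ℤ.+ s) ≡
        i ℤ.- (n ℤ.+ T) ℤ.+ (i ℤ.- (n ℤ.+ T)) ℤ.+ (+ 1 ℤ.+ (n ℤ.+ n)) ℤ.+ (s ℤ.+ (T ℤ.+ T))
      N≡ = ℤSolver.solve-∀
      a≡ : ∀ i n T k → i ℤ.- k ℤ.+ + 1 ℤ.+ n ≡ i ℤ.- (n ℤ.+ T) ℤ.+ (+ 1 ℤ.+ (n ℤ.+ n)) ℤ.+ T ℤ.- k
      a≡ = ℤSolver.solve-∀
      a′≡ : ∀ k s T → k ℤ.+ s ℤ.- s ℤ.- T ≡ k ℤ.- T
      a′≡ = ℤSolver.solve-∀
      b≡ : ∀ i n T k → i ℤ.- k ℤ.- n ≡ i ℤ.- (n ℤ.+ T) ℤ.+ T ℤ.- k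
      b≡ = ℤSolver.solve-∀
      r≡ : ∀ k s T → k ℤ.+ s ℤ.+ T ≡ k ℤ.- T ℤ.+ (s ℤ.+ (T ℤ.+ T))
      r≡ = ℤSolver.solve-∀
      p≡ : ∀ i s n T → i ℤ.+ s ℤ.+ + 1 ℤ.+ (n ℤ.+ T) ≡
        i ℤ.- (n ℤ.+ T) ℤ.+ (+ 1 ℤ.+ (n ℤ.+ n)) ℤ.+ (s ℤ.+ (T ℤ.+ T))
      p≡ = ℤSolver.solve-∀
    step -[1+ n ] = burge′ (σ -[1+ n ]) (λ k → k ℕ.* (k ℕ.+ s)) (ex ν s y -[1+ n ])
      (+ i ℤ.+ + s ℤ.+ + 1 ℤ.+ suc ν ⋆ -[1+ n ]) (suc (n ℕ.+ n)) (T ℕ.+ y) (s ℕ.+ (y ℕ.+ y) ℕ.+ (T ℕ.+ T)) m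
      (λ κ → degree n κ s y T)
      (N≡ (+ i) (+ s) (+ y) (+ n) (+ T)) (λ k → a≡ (+ i) (+ s) (+ y) (+ n) (+ T) (+ k)) (λ k → a′≡ (+ k) (+ s) (+ y) (+ T))
      (λ k → b≡ (+ i) (+ s) (+ y) (+ n) (+ T) (+ k)) (λ k → b′≡ (+ k) (+ s) (+ y) (+ T))
      (p≡ (+ i) (+ s) (+ y) (+ n) (+ T)) (a′≡ (+ m) (+ s) (+ y) (+ T)) (r≡ (+ m) (+ s) (+ y) (+ T))
      where
      T = ν ℕ.* n
      degree : ∀ n κ s y T → (T ℕ.+ y ℕ.+ κ) ℕ.* (T ℕ.+ y ℕ.+ κ ℕ.+ s) ℕ.+ suc n ℕ.* (T ℕ.+ y) ≡
        (T ℕ.+ y) ℕ.* (suc (s ℕ.+ y) ℕ.+ (n ℕ.+ T)) ℕ.+ κ ℕ.* (κ ℕ.+ (s ℕ.+ (y ℕ.+ y) ℕ.+ (T ℕ.+ T)))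
      degree = ℕSolver.solve-∀
      N≡ : ∀ i s y n T → i ℤ.+ i ℤ.+ (+ 1 ℤ.+ s) ≡
        i ℤ.+ s ℤ.+ + 1 ℤ.+ ℤ.- (+ 1 ℤ.+ (s ℤ.+ y) ℤ.+ (n ℤ.+ T)) ℤ.+
          (i ℤ.+ s ℤ.+ + 1 ℤ.+ ℤ.- (+ 1 ℤ.+ (s ℤ.+ y) ℤ.+ (n ℤ.+ T)))
          ℤ.+ (+ 1 ℤ.+ (n ℤ.+ n)) ℤ.+ (s ℤ.+ (y ℤ.+ y) ℤ.+ (T ℤ.+ T))
      N≡ = ℤSolver.solve-∀
      a≡ : ∀ i s y n T k → i ℤ.- k ℤ.- ℤ.- (+ 1 ℤ.+ n) ≡
        i ℤ.+ s ℤ.+ + 1 ℤ.+ ℤ.- (+ 1 ℤ.+ (s ℤ.+ y) ℤ.+ (n ℤ.+ T)) ℤ.+ (+ 1 ℤ.+ (n ℤ.+ n)) ℤ.+ (T ℤ.+ y) ℤ.- k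
      a≡ = ℤSolver.solve-∀
      a′≡ : ∀ k s y T → k ℤ.+ s ℤ.+ ℤ.- (s ℤ.+ y ℤ.+ T) ≡ k ℤ.- (T ℤ.+ y)
      a′≡ = ℤSolver.solve-∀
      b≡ : ∀ i s y n T k → i ℤ.- k ℤ.+ + 1 ℤ.+ ℤ.- (+ 1 ℤ.+ n) ≡
        i ℤ.+ s ℤ.+ + 1 ℤ.+ ℤ.- (+ 1 ℤ.+ (s ℤ.+ y) ℤ.+ (n ℤ.+ T)) ℤ.+ (T ℤ.+ y) ℤ.- k
      b≡ = ℤSolver.solve-∀
      b′≡ : ∀ k s y T → k ℤ.+ s ℤ.- s ℤ.- ℤ.- (s ℤ.+ y ℤ.+ T) ≡
        k ℤ.- (T ℤ.+ y) ℤ.+ (s ℤ.+ (y ℤ.+ y) ℤ.+ (T ℤ.+ T))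
      b′≡ = ℤSolver.solve-∀
      r≡ : ∀ m s y T → m ℤ.- ℤ.- (s ℤ.+ y ℤ.+ T) ≡ m ℤ.- (T ℤ.+ y) ℤ.+ (s ℤ.+ (y ℤ.+ y) ℤ.+ (T ℤ.+ T))
      r≡ = ℤSolver.solve-∀
      p≡ : ∀ i s y n T → i ℤ.- ℤ.- (+ 1 ℤ.+ (s ℤ.+ y) ℤ.+ (n ℤ.+ T)) ≡
        i ℤ.+ s ℤ.+ + 1 ℤ.+ ℤ.- (+ 1 ℤ.+ (s ℤ.+ y) ℤ.+ (n ℤ.+ T)) ℤ.+
          (+ 1 ℤ.+ (n ℤ.+ n)) ℤ.+ (s ℤ.+ (y ℤ.+ y) ℤ.+ (T ℤ.+ T))
      p≡ = ℤSolver.solve-∀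

  H-burge : ∀ s y J m i →
    conv m (λ k δ → q ^ (k ℕ.* (k ℕ.+ s)) *
      (gauss (+ i ℤ.+ + i ℤ.+ + suc s) (+ δ) * F (s ℕ.+ y) s y 1 J (+ k ℤ.+ + s) (+ i ℤ.- + k))) ≈
    Σℤ J (H-term s y m i)
  H-burge s y J m i = trans (conv-Σℤ m J _ _ _) (Σℤ-cong J (H-burge-term s y m i))

  -- With ν = s + y and K = 2ν + 1 this is (ν + 1) j (K j + 2s + 1): the exponent `ex-H` plus (ν +
  -- 1) j ((ν + 1) j + s + 1) from the q-Vandermonde sum.
  ex-K : (s y : ℕ) → ℤ → ℕ
  ex-K s y (+ n)    = (n ℕ.+ T) ℕ.* (n ℕ.+ (T ℕ.+ T) ℕ.+ suc (s ℕ.+ s))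
    where T = (s ℕ.+ y) ℕ.* n
  ex-K s y -[1+ n ] = (suc (s ℕ.+ y) ℕ.+ (n ℕ.+ T)) ℕ.* (n ℕ.+ (T ℕ.+ T) ℕ.+ (y ℕ.+ y))
    where T = (s ℕ.+ y) ℕ.* n

  -- With ν = s + y and K = 2ν + 1, the argument K j is written j + ν j + ν j.
  K-term : (s y L : ℕ) → ℤ → Carrier
  K-term s y L j = σ j * (q ^ ex-K s y j *
    gauss (+ L ℤ.- (j ℤ.+ (s ℕ.+ y) ⋆ j ℤ.+ (s ℕ.+ y) ⋆ j))
      (+ L ℤ.+ + suc (s ℕ.+ s) ℤ.+ (j ℤ.+ (s ℕ.+ y) ⋆ j ℤ.+ (s ℕ.+ y) ⋆ j)))

  -- The first arguments in `H-term` depend on δ, those in `shifted` on i. The correction i + δ - m,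
  -- zero throughout the convolution, makes their relation an identity for the ring solver.
  vandermonde′ : ∀ s (E : ℕ → ℕ) X {Q₀} P k u e z m →
    (∀ κ → E (u ℕ.+ κ) ℕ.+ X ≡ Q₀ ℕ.+ κ ℕ.* (κ ℕ.+ e)) →
    + m ≡ + u ℤ.+ (P ℤ.+ + z) →
    ∀ {a b : ℤ → ℤ} {a′ b′ : ℕ → ℤ} {r} →
    (∀ i δ → a δ ≡ P ℤ.+ + k ℤ.+ + u ℤ.- i ℤ.+ (i ℤ.+ δ ℤ.- + m)) → (∀ i → a′ i ≡ + i ℤ.- + u) →
    (∀ i δ → b δ ≡ P ℤ.+ + u ℤ.- i ℤ.+ (i ℤ.+ δ ℤ.- + m)) → (∀ i → b′ i ≡ + i ℤ.- + u ℤ.+ + e) →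
    r ≡ P ℤ.+ + k ℤ.+ + e →
    conv m (λ i δ → q ^ E i * (1# * (s * (q ^ X * (gauss (a (+ δ)) (a′ i) * gauss (b (+ δ)) (b′ i)))))) ≈
    s * (q ^ Q₀ * gauss P r)
  vandermonde′ s E X {Q₀} P k u e z m Q≡ m≡ {a} {b} {a′} {b′} a≡ a′≡ b≡ b′≡ ≡.refl = begin
    conv m (λ i δ → q ^ E i * (1# * (s * (q ^ X * (gauss (a (+ δ)) (a′ i) * gauss (b (+ δ)) (b′ i))))))
      ≈⟨ conv-cong′ m (λ i δ i+δ≡m → trans
           (solve 5 (λ u v w x y → u :* (v :* (w :* (x :* y))) := w :* (u :* x :* (v :* y))) refl _ _ _ _ _)
           (*-congˡ (*-cong (sym (q^+ (E i) X)) (*-congˡ (*-cong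
             (gauss-cong (≡.trans (a≡ (+ i) (+ δ)) (drop i δ (P ℤ.+ + k ℤ.+ + u ℤ.- + i) i+δ≡m)) (a′≡ i))
             (gauss-cong (≡.trans (b≡ (+ i) (+ δ)) (drop i δ (P ℤ.+ + u ℤ.- + i) i+δ≡m)) (b′≡ i))))))) ⟩
    conv m (λ i δ → s * shifted Q (λ _ → 1#) P k u e i δ)
      ≈⟨ trans (conv-*ˡ m s _) (*-congˡ (vandermondeℤ Q P k u e z m Q≡ m≡)) ⟩
    s * (q ^ Q₀ * gauss P (P ℤ.+ + k ℤ.+ + e)) ∎
    where
    Q : ℕ → ℕ
    Q i = E i ℕ.+ X
    drop : ∀ i δ x → i ℕ.+ δ ≡ m → x ℤ.+ (+ i ℤ.+ + δ ℤ.- + m) ≡ x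
    drop i δ x ≡.refl = arith x (+ (i ℕ.+ δ))
      where
      arith : ∀ x m → x ℤ.+ (m ℤ.- m) ≡ x
      arith = ℤSolver.solve-∀

  -- As i + m = L, the top entries L + s - j and L + s + 1 + j of the two factors do not depend on
  -- i, as q-Vandermonde requires. The factor `1#` stands in the place of a kernel.
  K-vandermonde-term : ∀ s y L j →
    conv L (λ i m → q ^ (i ℕ.* (i ℕ.+ suc s)) * (1# * H-term s y m i j)) ≈ K-term s y L j
  K-vandermonde-term s y L (+ n) =
    vandermonde′ (σ (+ n)) (λ i → i ℕ.* (i ℕ.+ suc s)) (ex-H s y (+ n))
      (+ L ℤ.- (+ n ℤ.+ + T ℤ.+ + T)) (s ℕ.+ (T ℕ.+ T)) (n ℕ.+ T) (suc s ℕ.+ (n ℕ.+ T ℕ.+ (n ℕ.+ T))) T L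
      (λ κ → degree n κ s T) (L≡ (+ L) (+ n) (+ T))
      (a≡ (+ L) (+ s) (+ n) (+ T)) (λ i → ≡.refl) (b≡ (+ L) (+ n) (+ T)) (λ i → b′≡ (+ i) (+ s) (+ n) (+ T))
      (r≡ (+ L) (+ s) (+ n) (+ T))
    where
    T = (s ℕ.+ y) ℕ.* n
    degree : ∀ n κ s T → (n ℕ.+ T ℕ.+ κ) ℕ.* (n ℕ.+ T ℕ.+ κ ℕ.+ suc s) ℕ.+ (n ℕ.+ T) ℕ.* (T ℕ.+ s) ≡
      (n ℕ.+ T) ℕ.* (n ℕ.+ (T ℕ.+ T) ℕ.+ suc (s ℕ.+ s)) ℕ.+
        κ ℕ.* (κ ℕ.+ (suc s ℕ.+ (n ℕ.+ T ℕ.+ (n ℕ.+ T))))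
    degree = ℕSolver.solve-∀
    L≡ : ∀ L n T → L ≡ n ℤ.+ T ℤ.+ (L ℤ.- (n ℤ.+ T ℤ.+ T) ℤ.+ T)
    L≡ = ℤSolver.solve-∀
    a≡ : ∀ L s n T i δ → δ ℤ.+ s ℤ.+ T ≡
      L ℤ.- (n ℤ.+ T ℤ.+ T) ℤ.+ (s ℤ.+ (T ℤ.+ T)) ℤ.+ (n ℤ.+ T) ℤ.- i ℤ.+ (i ℤ.+ δ ℤ.- L)
    a≡ = ℤSolver.solve-∀
    b≡ : ∀ L n T i δ → δ ℤ.- T ≡ L ℤ.- (n ℤ.+ T ℤ.+ T) ℤ.+ (n ℤ.+ T) ℤ.- i ℤ.+ (i ℤ.+ δ ℤ.- L)
    b≡ = ℤSolver.solve-∀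
    b′≡ : ∀ i s n T → i ℤ.+ s ℤ.+ + 1 ℤ.+ (n ℤ.+ T) ≡
      i ℤ.- (n ℤ.+ T) ℤ.+ (+ 1 ℤ.+ s ℤ.+ (n ℤ.+ T ℤ.+ (n ℤ.+ T)))
    b′≡ = ℤSolver.solve-∀
    r≡ : ∀ L s n T → L ℤ.+ (+ 1 ℤ.+ (s ℤ.+ s)) ℤ.+ (n ℤ.+ T ℤ.+ T) ≡
      L ℤ.- (n ℤ.+ T ℤ.+ T) ℤ.+ (s ℤ.+ (T ℤ.+ T)) ℤ.+ (+ 1 ℤ.+ s ℤ.+ (n ℤ.+ T ℤ.+ (n ℤ.+ T)))
    r≡ = ℤSolver.solve-∀
  K-vandermonde-term s y L -[1+ n ] = trans
    (conv-cong L (λ i m → *-congˡ (*-congˡ (*-congˡ (*-congˡ (*-comm _ _))))))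
    (trans (vandermonde′ (σ -[1+ n ]) (λ i → i ℕ.* (i ℕ.+ suc s)) (ex-H s y -[1+ n ])
      (+ L ℤ.+ + suc (s ℕ.+ s) ℤ.+ (-[1+ n ] ℤ.+ (s ℕ.+ y) ⋆ -[1+ n ] ℤ.+ (s ℕ.+ y) ⋆ -[1+ n ]))
      (s ℕ.+ (y ℕ.+ y) ℕ.+ (T ℕ.+ T)) (n ℕ.+ T ℕ.+ y) (suc s ℕ.+ (n ℕ.+ T ℕ.+ y ℕ.+ (n ℕ.+ T ℕ.+ y))) (T ℕ.+ y) L
      (λ κ → degree n κ s y T) (L≡ (+ L) (+ s) (+ y) (+ n) (+ T))
      (a≡ (+ L) (+ s) (+ y) (+ n) (+ T)) (λ i → a′≡ (+ i) (+ s) (+ y) (+ n) (+ T))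
      (b≡ (+ L) (+ s) (+ y) (+ n) (+ T)) (λ i → b′≡ (+ i) (+ s) (+ y) (+ n) (+ T))
      (r≡ (+ L) (+ s) (+ y) (+ n) (+ T)))
    (*-congˡ (*-congˡ (gauss-comm
      (+ L ℤ.+ + suc (s ℕ.+ s) ℤ.+ (-[1+ n ] ℤ.+ (s ℕ.+ y) ⋆ -[1+ n ] ℤ.+ (s ℕ.+ y) ⋆ -[1+ n ]))
      (+ L ℤ.- (-[1+ n ] ℤ.+ (s ℕ.+ y) ⋆ -[1+ n ] ℤ.+ (s ℕ.+ y) ⋆ -[1+ n ]))))))
    where
    T = (s ℕ.+ y) ℕ.* n
    degree : ∀ n κ s y T →
      (n ℕ.+ T ℕ.+ y ℕ.+ κ) ℕ.* (n ℕ.+ T ℕ.+ y ℕ.+ κ ℕ.+ suc s) ℕ.+ (T ℕ.+ y) ℕ.* (suc (s ℕ.+ y) ℕ.+ (n ℕ.+ T)) ≡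
      (suc (s ℕ.+ y) ℕ.+ (n ℕ.+ T)) ℕ.* (n ℕ.+ (T ℕ.+ T) ℕ.+ (y ℕ.+ y)) ℕ.+
        κ ℕ.* (κ ℕ.+ (suc s ℕ.+ (n ℕ.+ T ℕ.+ y ℕ.+ (n ℕ.+ T ℕ.+ y))))
    degree = ℕSolver.solve-∀
    L≡ : ∀ L s y n T → L ≡ n ℤ.+ T ℤ.+ y ℤ.+
      (L ℤ.+ (+ 1 ℤ.+ (s ℤ.+ s)) ℤ.+ (ℤ.- (+ 1 ℤ.+ n) ℤ.+ ℤ.- (s ℤ.+ y ℤ.+ T) ℤ.+ ℤ.- (s ℤ.+ y ℤ.+ T)) ℤ.+ (T ℤ.+ y))
    L≡ = ℤSolver.solve-∀
    a≡ : ∀ L s y n T i δ → δ ℤ.- ℤ.- (s ℤ.+ y ℤ.+ T) ≡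
      L ℤ.+ (+ 1 ℤ.+ (s ℤ.+ s)) ℤ.+ (ℤ.- (+ 1 ℤ.+ n) ℤ.+ ℤ.- (s ℤ.+ y ℤ.+ T) ℤ.+ ℤ.- (s ℤ.+ y ℤ.+ T))
        ℤ.+ (s ℤ.+ (y ℤ.+ y) ℤ.+ (T ℤ.+ T)) ℤ.+ (n ℤ.+ T ℤ.+ y) ℤ.- i ℤ.+ (i ℤ.+ δ ℤ.- L)
    a≡ = ℤSolver.solve-∀
    a′≡ : ∀ i s y n T → i ℤ.+ s ℤ.+ + 1 ℤ.+ ℤ.- (+ 1 ℤ.+ (s ℤ.+ y) ℤ.+ (n ℤ.+ T)) ≡ i ℤ.- (n ℤ.+ T ℤ.+ y)
    a′≡ = ℤSolver.solve-∀
    b≡ : ∀ L s y n T i δ → δ ℤ.+ s ℤ.+ ℤ.- (s ℤ.+ y ℤ.+ T) ≡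
      L ℤ.+ (+ 1 ℤ.+ (s ℤ.+ s)) ℤ.+ (ℤ.- (+ 1 ℤ.+ n) ℤ.+ ℤ.- (s ℤ.+ y ℤ.+ T) ℤ.+ ℤ.- (s ℤ.+ y ℤ.+ T))
        ℤ.+ (n ℤ.+ T ℤ.+ y) ℤ.- i ℤ.+ (i ℤ.+ δ ℤ.- L)
    b≡ = ℤSolver.solve-∀
    b′≡ : ∀ i s y n T → i ℤ.- ℤ.- (+ 1 ℤ.+ (s ℤ.+ y) ℤ.+ (n ℤ.+ T)) ≡
      i ℤ.- (n ℤ.+ T ℤ.+ y) ℤ.+ (+ 1 ℤ.+ s ℤ.+ (n ℤ.+ T ℤ.+ y ℤ.+ (n ℤ.+ T ℤ.+ y)))
    b′≡ = ℤSolver.solve-∀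
    r≡ : ∀ L s y n T → L ℤ.- (ℤ.- (+ 1 ℤ.+ n) ℤ.+ ℤ.- (s ℤ.+ y ℤ.+ T) ℤ.+ ℤ.- (s ℤ.+ y ℤ.+ T)) ≡
      L ℤ.+ (+ 1 ℤ.+ (s ℤ.+ s)) ℤ.+ (ℤ.- (+ 1 ℤ.+ n) ℤ.+ ℤ.- (s ℤ.+ y ℤ.+ T) ℤ.+ ℤ.- (s ℤ.+ y ℤ.+ T))
        ℤ.+ (s ℤ.+ (y ℤ.+ y) ℤ.+ (T ℤ.+ T)) ℤ.+ (+ 1 ℤ.+ s ℤ.+ (n ℤ.+ T ℤ.+ y ℤ.+ (n ℤ.+ T ℤ.+ y)))
    r≡ = ℤSolver.solve-∀

  K-vandermonde : ∀ s y J L →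
    conv L (λ i m → q ^ (i ℕ.* (i ℕ.+ suc s)) * (1# * Σℤ J (H-term s y m i))) ≈ Σℤ J (K-term s y L)
  K-vandermonde s y J L = trans (conv-Σℤ L J _ _ _) (Σℤ-cong J (K-vandermonde-term s y L))

  -- Positivity, from closure under sums and products alone.

  module Positivity {p} (Pos : Carrier → Set p)
    (Pos-resp : ∀ {x y} → x ≈ y → Pos x → Pos y)
    (Pos-0 : Pos 0#) (Pos-1 : Pos 1#) (Pos-q : Pos q)
    (Pos-+ : ∀ {x y} → Pos x → Pos y → Pos (x + y))
    (Pos-* : ∀ {x y} → Pos x → Pos y → Pos (x * y)) where

    Pos-q^ : ∀ n → Pos (q ^ n)
    Pos-q^ zero    = Pos-1
    Pos-q^ (suc n) = Pos-* Pos-q (Pos-q^ n)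

    Pos-bin : ∀ n k → Pos (bin n k)
    Pos-bin n       zero    = Pos-1
    Pos-bin zero    (suc k) = Pos-0
    Pos-bin (suc n) (suc k) = Pos-+ (Pos-bin n k) (Pos-* (Pos-q^ (suc k)) (Pos-bin n (suc k)))

    Pos-gauss : ∀ x y → Pos (gauss x y)
    Pos-gauss (+ m)    (+ n)    = Pos-bin (m ℕ.+ n) n
    Pos-gauss (+ _)    -[1+ _ ] = Pos-0
    Pos-gauss -[1+ _ ] _        = Pos-0

    Pos-conv : ∀ n {f} → (∀ i j → i ℕ.≤ n → Pos (f i j)) → Pos (conv n f)
    Pos-conv zero    pos = pos 0 0 z≤n
    Pos-conv (suc n) pos = Pos-+ (pos 0 (suc n) z≤n) (Pos-conv n (λ i j i≤n → pos (suc i) j (s≤s i≤n)))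

    Pos-Σℤ : ∀ J {f} → (∀ j → Pos (f j)) → Pos (Σℤ J f)
    Pos-Σℤ zero    pos = Pos-0
    Pos-Σℤ (suc J) pos = Pos-+ (Pos-Σℤ J pos) (Pos-+ (pos _) (pos _))

    Pos-≈0 : ∀ {x} → x ≈ 0# → Pos x
    Pos-≈0 x≈0 = Pos-resp (sym x≈0) Pos-0

    Pos-F-term-0 : ∀ t x y e l m → Pos (F-term t x y e l m (+ 0))
    Pos-F-term-0 t x y e l m = Pos-* Pos-1 (Pos-* (Pos-q^ (ex t x y (+ 0)))
      (Pos-* (Pos-gauss (l ℤ.+ t ⋆ + 0) (m ℤ.- + 0)) (Pos-gauss (l ℤ.- + x ℤ.- t ⋆ + 0) (m ℤ.+ + e ℤ.+ + 0))))

    -- For a = 0 or b = 0 only j = 0 contributes, and its sign is positive; the rest is the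
    -- q²-Pascal recurrence.
    Pos-F-base : ∀ a b J → b ℕ.≤ J → Pos (F 1 0 1 0 (suc J) (+ a) (+ b))
    Pos-F-base zero b J _ = Pos-Σℤ (suc J) λ
      { (+ zero)  → Pos-F-term-0 1 0 1 0 (+ 0) (+ b)
      ; (+ suc n) → Pos-≈0 (≈0ʳ (σ (+ suc n)) (≈0ʳ _ (zeroʳ _)))
      ; -[1+ n ]  → Pos-≈0 (≈0ʳ (σ -[1+ n ]) (≈0ʳ _ (zeroˡ _))) }
    Pos-F-base (suc a) zero J _ = Pos-Σℤ (suc J) λ
      { (+ zero)  → Pos-F-term-0 1 0 1 0 (+ suc a) (+ 0)
      ; (+ suc n) → Pos-≈0 (≈0ʳ (σ (+ suc n)) (≈0ʳ _ (zeroˡ _)))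
      ; -[1+ n ]  → Pos-≈0 (≈0ʳ (σ -[1+ n ]) (≈0ʳ _ (≈0ʳ _ (gauss-negʳ (+ suc a ℤ.- + 0 ℤ.- 1 ⋆ -[1+ n ]) (ℤ.-<+ {n}))))) }
    Pos-F-base (suc a) (suc b) J b<J = Pos-resp (sym (F-pascal₀ a b J b<J))
      (Pos-+ (Pos-F-base a (suc b) J b<J)
        (Pos-* (Pos-q^ (suc a ℕ.+ suc a)) (Pos-F-base (suc a) b J (ℕ.<⇒≤ b<J))))

    Pos-F₀ : ∀ t l m J → m ℕ.≤ J → Pos (F (suc t) 0 (suc t) 0 (suc J) l (+ m))
    Pos-F₀ zero (+ a)    m J m≤J = Pos-F-base a m J m≤J
    Pos-F₀ zero -[1+ a ] m J m≤J = Pos-≈0 (F-negˡ 1 0 1 0 (suc J) a (+ m))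
    Pos-F₀ (suc t) l m J m≤J = Pos-resp (F-burge₀ (suc t) (suc J) l m)
      (Pos-conv m (λ i δ i≤m → Pos-* (Pos-q^ (i ℕ.* (i ℕ.+ 0)))
        (Pos-* (Pos-gauss (l ℤ.+ l ℤ.- + 0) (+ δ)) (Pos-F₀ t (l ℤ.- + 0 ℤ.- + i) i J (ℕ.≤-trans i≤m m≤J)))))

    -- Undoing a transform lowers x + y by one: it lowers x or, at x = 0, it lowers y after Pascal's
    -- rule has split off the sum with b = j.
    Pos-F₁ : ∀ x y l m J → m ℕ.≤ J → Pos (F (x ℕ.+ y) x y 1 (suc J) l (+ m))

    Pos-F₁-suc : ∀ x y l m J → m ℕ.≤ J → Pos (F (suc (x ℕ.+ y)) (suc x) y 1 (suc J) l (+ m))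
    Pos-F₁-suc x y l m J m≤J = Pos-resp (F-burge₁ x y (suc J) l m)
      (Pos-conv m (λ i δ i≤m → Pos-* (Pos-q^ (i ℕ.* (i ℕ.+ 1)))
        (Pos-* (Pos-gauss (l ℤ.+ l ℤ.- + suc x) (+ δ)) (Pos-F₁ x y (l ℤ.- + 1 ℤ.- + i) i J (ℕ.≤-trans i≤m m≤J)))))

    Pos-F₁ zero    zero    l        m J m≤J = Pos-≈0 (F-antisym (suc J) l (+ m))
    Pos-F₁ zero    (suc y) -[1+ a ] m J m≤J = Pos-≈0 (F-negˡ (suc y) 0 (suc y) 1 (suc J) a (+ m))
    Pos-F₁ zero    (suc y) (+ a)    m J m≤J = Pos-resp (sym (F-pascal₁ y (suc J) a m))
      (Pos-+ (Pos-F₀ y (+ a) m J m≤J) (Pos-* (Pos-q^ (suc m)) (Pos-F₁-suc 0 y (+ a) m J m≤J)))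
    Pos-F₁ (suc x) y       l        m J m≤J = Pos-F₁-suc x y l m J m≤J

    Pos-H : ∀ s y J m i → i ℕ.≤ J → Pos (Σℤ (suc J) (H-term s y m i))
    Pos-H s y J m i i≤J = Pos-resp (H-burge s y (suc J) m i)
      (Pos-conv m (λ k δ _ → Pos-* (Pos-q^ (k ℕ.* (k ℕ.+ s)))
        (Pos-* (Pos-gauss (+ i ℤ.+ + i ℤ.+ + suc s) (+ δ)) (Pos-F k))))
      where
      arith⁻ : ∀ i r → i ℤ.- (+ 1 ℤ.+ (i ℤ.+ r)) ≡ ℤ.- (+ 1 ℤ.+ r)
      arith⁻ = ℤSolver.solve-∀
      arith⁺ : ∀ k r → k ℤ.+ r ℤ.- k ≡ r
      arith⁺ = ℤSolver.solve-∀
      Pos-F : ∀ k → Pos (F (s ℕ.+ y) s y 1 (suc J) (+ k ℤ.+ + s) (+ i ℤ.- + k))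
      -- The index k may exceed i; then i - k is negative and the sum vanishes.
      Pos-F k with split i k
      ... | inj₁ (r , ≡.refl) = ≡.subst (λ z → Pos (F (s ℕ.+ y) s y 1 (suc J) (+ k ℤ.+ + s) z))
        (≡.sym (arith⁻ (+ i) (+ r))) (Pos-≈0 (F-negʳ (s ℕ.+ y) s y (suc J) (+ k ℤ.+ + s) r))
      ... | inj₂ (r , ≡.refl) = ≡.subst (λ z → Pos (F (s ℕ.+ y) s y 1 (suc J) (+ k ℤ.+ + s) z))
        (≡.sym (arith⁺ (+ k) (+ r))) (Pos-F₁ s y (+ k ℤ.+ + s) r J (ℕ.≤-trans (ℕ.m≤n+m r k) i≤J))

    Pos-Σ-K-term : ∀ s y J L → L ℕ.≤ J → Pos (Σℤ (suc J) (K-term s y L))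
    Pos-Σ-K-term s y J L L≤J = Pos-resp (K-vandermonde s y (suc J) L)
      (Pos-conv L (λ i m i≤L → Pos-* (Pos-q^ (i ℕ.* (i ℕ.+ suc s)))
        (Pos-* Pos-1 (Pos-H s y J m i (ℕ.≤-trans i≤L L≤J)))))

open import Defs
open import Data.Nat.Base using (_≥_; _<_)
open import Data.Rational.Base using (1ℚ; _+_; _-_; _*_; _/_)
open ≡.≡-Reasoning

-- The ring of formal power series.

infixl 6 _⊕_

_⊕_ : Series → Series → Series
(f ⊕ g) n = f n ℤ.+ g n

⊝_ : Series → Series
(⊝ f) n = ℤ.- f n

⊛-cong : ∀ {f f′ g g′} → f ≗ f′ → g ≗ g′ → f ⊛ g ≗ f′ ⊛ g′
⊛-cong f≗ g≗ zero    = ≡.cong₂ ℤ._*_ (f≗ 0) (g≗ 0)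
⊛-cong f≗ g≗ (suc n) = ≡.cong₂ ℤ._+_ (≡.cong₂ ℤ._*_ (f≗ 0) (g≗ (suc n))) (⊛-cong (λ k → f≗ (suc k)) g≗ n)

-- The Cauchy product recurses on its left factor; commutativity needs the right factor peeled as
-- well.
⊛-sucʳ : ∀ f g n → (f ⊛ g) (suc n) ≡ (f ⊛ tail g) n ℤ.+ f (suc n) ℤ.* g 0
⊛-sucʳ f g zero    = ≡.refl
⊛-sucʳ f g (suc n) = ≡.trans (≡.cong (λ z → f 0 ℤ.* g (suc (suc n)) ℤ.+ z) (⊛-sucʳ (tail f) g n))
  (≡.sym (ℤ.+-assoc (f 0 ℤ.* g (suc (suc n))) _ _))

⊛-comm : ∀ f g → f ⊛ g ≗ g ⊛ f
⊛-comm f g zero    = ℤ.*-comm (f 0) (g 0)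
⊛-comm f g (suc n) = begin
  f 0 ℤ.* g (suc n) ℤ.+ (tail f ⊛ g) n ≡⟨ ≡.cong₂ ℤ._+_ (ℤ.*-comm (f 0) _) (⊛-comm (tail f) g n) ⟩
  g (suc n) ℤ.* f 0 ℤ.+ (g ⊛ tail f) n ≡⟨ ℤ.+-comm (g (suc n) ℤ.* f 0) _ ⟩
  (g ⊛ tail f) n ℤ.+ g (suc n) ℤ.* f 0 ≡⟨ ⊛-sucʳ g f n ⟨
  (g ⊛ f) (suc n)                      ∎

⊛-distribʳ : ∀ h f g → (f ⊕ g) ⊛ h ≗ f ⊛ h ⊕ g ⊛ h
⊛-distribʳ h f g zero    = ℤ.*-distribʳ-+ (h 0) (f 0) (g 0)
⊛-distribʳ h f g (suc n) = ≡.trans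
  (≡.cong (λ z → (f 0 ℤ.+ g 0) ℤ.* h (suc n) ℤ.+ z) (⊛-distribʳ h (tail f) (tail g) n))
  (arith (f 0) (g 0) (h (suc n)) ((tail f ⊛ h) n) ((tail g ⊛ h) n))
  where
  arith : ∀ a b c x y → (a ℤ.+ b) ℤ.* c ℤ.+ (x ℤ.+ y) ≡ a ℤ.* c ℤ.+ x ℤ.+ (b ℤ.* c ℤ.+ y)
  arith = ℤSolver.solve-∀

⊛-distribˡ : ∀ h f g → h ⊛ (f ⊕ g) ≗ h ⊛ f ⊕ h ⊛ g
⊛-distribˡ h f g n = begin
  (h ⊛ (f ⊕ g)) n            ≡⟨ ⊛-comm h (f ⊕ g) n ⟩
  ((f ⊕ g) ⊛ h) n            ≡⟨ ⊛-distribʳ h f g n ⟩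
  (f ⊛ h) n ℤ.+ (g ⊛ h) n    ≡⟨ ≡.cong₂ ℤ._+_ (⊛-comm f h n) (⊛-comm g h n) ⟩
  (h ⊛ f) n ℤ.+ (h ⊛ g) n    ∎

⊛-scaleˡ : ∀ c f g → (λ n → c ℤ.* f n) ⊛ g ≗ λ n → c ℤ.* (f ⊛ g) n
⊛-scaleˡ c f g zero    = ℤ.*-assoc c (f 0) (g 0)
⊛-scaleˡ c f g (suc n) = ≡.trans
  (≡.cong (λ z → c ℤ.* f 0 ℤ.* g (suc n) ℤ.+ z) (⊛-scaleˡ c (tail f) g n))
  (arith c (f 0) (g (suc n)) ((tail f ⊛ g) n))
  where
  arith : ∀ c x y z → c ℤ.* x ℤ.* y ℤ.+ c ℤ.* z ≡ c ℤ.* (x ℤ.* y ℤ.+ z)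
  arith = ℤSolver.solve-∀

⊛-assoc : ∀ f g h → (f ⊛ g) ⊛ h ≗ f ⊛ (g ⊛ h)
⊛-assoc f g h zero    = ℤ.*-assoc (f 0) (g 0) (h 0)
⊛-assoc f g h (suc n) = begin
  f 0 ℤ.* g 0 ℤ.* h (suc n) ℤ.+ (((λ k → f 0 ℤ.* g (suc k)) ⊕ tail f ⊛ g) ⊛ h) n
    ≡⟨ ≡.cong (λ z → f 0 ℤ.* g 0 ℤ.* h (suc n) ℤ.+ z) (≡.trans (⊛-distribʳ h (λ k → f 0 ℤ.* g (suc k)) (tail f ⊛ g) n)
         (≡.cong₂ ℤ._+_ (⊛-scaleˡ (f 0) (tail g) h n) (⊛-assoc (tail f) g h n))) ⟩
  f 0 ℤ.* g 0 ℤ.* h (suc n) ℤ.+ (f 0 ℤ.* (tail g ⊛ h) n ℤ.+ (tail f ⊛ (g ⊛ h)) n)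
    ≡⟨ arith (f 0) (g 0) (h (suc n)) ((tail g ⊛ h) n) ((tail f ⊛ (g ⊛ h)) n) ⟩
  f 0 ℤ.* (g 0 ℤ.* h (suc n) ℤ.+ (tail g ⊛ h) n) ℤ.+ (tail f ⊛ (g ⊛ h)) n ∎
  where
  arith : ∀ a b c x y → a ℤ.* b ℤ.* c ℤ.+ (a ℤ.* x ℤ.+ y) ≡ a ℤ.* (b ℤ.* c ℤ.+ x) ℤ.+ y
  arith = ℤSolver.solve-∀

⊛-zeroˡ : ∀ f → 0# ⊛ f ≗ 0#
⊛-zeroˡ f zero    = ≡.refl
⊛-zeroˡ f (suc n) = ≡.trans (ℤ.+-identityˡ _) (⊛-zeroˡ f n)

⊛-identityˡ : ∀ f → (q^ 0) ⊛ f ≗ f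
⊛-identityˡ f zero    = ℤ.*-identityˡ (f 0)
⊛-identityˡ f (suc n) = begin
  1ℤ ℤ.* f (suc n) ℤ.+ (0# ⊛ f) n ≡⟨ ≡.cong₂ ℤ._+_ (ℤ.*-identityˡ (f (suc n))) (⊛-zeroˡ f n) ⟩
  f (suc n) ℤ.+ 0ℤ                ≡⟨ ℤ.+-identityʳ _ ⟩
  f (suc n)                       ∎

seriesRing : CommutativeRing 0ℓ 0ℓ
seriesRing = record
  { Carrier = Series
  ; _≈_ = _≗_
  ; _+_ = _⊕_
  ; _*_ = _⊛_
  ; -_  = ⊝_
  ; 0#  = 0#
  ; 1#  = q^ 0
  ; isCommutativeRing = record
    { isRing = record
      { +-isAbelianGroup = Pointwise.isAbelianGroup ℕ ℤ.+-0-isAbelianGroup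
      ; *-cong     = ⊛-cong
      ; *-assoc    = ⊛-assoc
      ; *-identity = ⊛-identityˡ , λ f n → ≡.trans (⊛-comm f (q^ 0) n) (⊛-identityˡ f n)
      ; distrib    = ⊛-distribˡ , ⊛-distribʳ
      }
    ; *-comm = ⊛-comm
    }
  }

-- Quotients, powers of q and signs.

-- Turns the product formula into an equation for the quotient. Long division changes the dividend
-- at each step, so `go` generalises over `f` and `k`.
÷-unique : ∀ f g k → g 0 ≡ 1ℤ → k ⊛ g ≗ f → f ÷ g ≗ k
÷-unique f g k g₀ kg≗f n = go n f k kg≗f
  where
  head : ∀ f k → k ⊛ g ≗ f → f 0 ≡ k 0
  head f k kg≗f = ≡.trans (≡.sym (kg≗f 0)) (≡.trans (≡.cong (k 0 ℤ.*_) g₀) (ℤ.*-identityʳ (k 0)))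
  go : ∀ n f k → k ⊛ g ≗ f → (f ÷ g) n ≡ k n
  go zero    f k kg≗f = head f k kg≗f
  go (suc n) f k kg≗f = go n _ (tail k) λ i → ≡.sym (begin
    f (suc i) ℤ.- f 0 ℤ.* g (suc i)
      ≡⟨ ≡.cong₂ (λ x y → x ℤ.- y ℤ.* g (suc i)) (≡.sym (kg≗f (suc i))) (head f k kg≗f) ⟩
    k 0 ℤ.* g (suc i) ℤ.+ (tail k ⊛ g) i ℤ.- k 0 ℤ.* g (suc i)
      ≡⟨ arith (k 0 ℤ.* g (suc i)) ((tail k ⊛ g) i) ⟩
    (tail k ⊛ g) i ∎)
    where
    arith : ∀ x y → x ℤ.+ y ℤ.- x ≡ y
    arith = ℤSolver.solve-∀

q^-⊛-below : ∀ k f n → n ℕ.< k → (q^ k ⊛ f) n ≡ 0ℤ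
q^-⊛-below (suc k) f zero    _           = ≡.refl
q^-⊛-below (suc k) f (suc n) (ℕ.s≤s n<k) = ≡.trans (ℤ.+-identityˡ _) (q^-⊛-below k f n n<k)

q^-⊛-shift : ∀ k f n → (q^ k ⊛ f) (k ℕ.+ n) ≡ f n
q^-⊛-shift zero    f n = ⊛-identityˡ f n
q^-⊛-shift (suc k) f n = ≡.trans (ℤ.+-identityˡ _) (q^-⊛-shift k f n)

open Exp (CommutativeRing.semiring seriesRing) using (_^_)

q^-power : ∀ k → (q^ 1) ^ k ≗ q^ k
q^-power zero    n = ≡.refl
q^-power (suc k) n = ≡.trans (⊛-cong {q^ 1} (λ _ → ≡.refl) (q^-power k) n) (step n)
  where
  step : ∀ n → (q^ 1 ⊛ q^ k) n ≡ (q^ suc k) n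
  step zero    = ≡.refl
  step (suc n) = ≡.trans (ℤ.+-identityˡ _) (⊛-identityˡ (q^ k) n)

sign-⊛ : ∀ k f → (⊝ (q^ 0)) ^ k ⊛ f ≗ λ n → -1ℤ ℤ.^ k ℤ.* f n
sign-⊛ zero    f n = ≡.trans (⊛-identityˡ f n) (≡.sym (ℤ.*-identityˡ (f n)))
sign-⊛ (suc k) f n = begin
  (⊝ (q^ 0) ⊛ s ⊛ f) n                  ≡⟨ ⊛-assoc (⊝ (q^ 0)) s f n ⟩
  (⊝ (q^ 0) ⊛ (s ⊛ f)) n                ≡⟨ ⊛-cong {g = s ⊛ f} (λ i → ≡.sym (ℤ.-1*i≡-i ((q^ 0) i))) (λ _ → ≡.refl) n ⟩
  ((λ i → -1ℤ ℤ.* (q^ 0) i) ⊛ (s ⊛ f)) n ≡⟨ ⊛-scaleˡ -1ℤ (q^ 0) (s ⊛ f) n ⟩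
  -1ℤ ℤ.* ((q^ 0) ⊛ (s ⊛ f)) n           ≡⟨ ≡.cong (-1ℤ ℤ.*_) (≡.trans (⊛-identityˡ (s ⊛ f) n) (sign-⊛ k f n)) ⟩
  -1ℤ ℤ.* (-1ℤ ℤ.^ k ℤ.* f n)            ≡⟨ ℤ.*-assoc -1ℤ (-1ℤ ℤ.^ k) (f n) ⟨
  -1ℤ ℤ.^ suc k ℤ.* f n                  ∎
  where
  s = (⊝ (q^ 0)) ^ k

-- Polynomials with nonnegative coefficients.

infixl 6 _⊞_
infixl 7 _⊠_

_⊞_ : List ℤ → List ℤ → List ℤ
[]      ⊞ r       = r
(c ∷ p) ⊞ []      = c ∷ p
(c ∷ p) ⊞ (d ∷ r) = c ℤ.+ d ∷ p ⊞ r

_⊠_ : List ℤ → List ℤ → List ℤ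
[]      ⊠ r = []
(c ∷ p) ⊠ r = map (c ℤ.*_) r ⊞ (0ℤ ∷ p ⊠ r)

coefficient-⊞ : ∀ p r → coefficient (p ⊞ r) ≗ coefficient p ⊕ coefficient r
coefficient-⊞ []      r       n       = ≡.sym (ℤ.+-identityˡ _)
coefficient-⊞ (c ∷ p) []      n       = ≡.sym (ℤ.+-identityʳ _)
coefficient-⊞ (c ∷ p) (d ∷ r) zero    = ≡.refl
coefficient-⊞ (c ∷ p) (d ∷ r) (suc n) = coefficient-⊞ p r n

coefficient-map : ∀ c r n → coefficient (map (c ℤ.*_) r) n ≡ c ℤ.* coefficient r n
coefficient-map c []      n       = ≡.sym (ℤ.*-zeroʳ c)
coefficient-map c (d ∷ r) zero    = ≡.refl
coefficient-map c (d ∷ r) (suc n) = coefficient-map c r n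

coefficient-⊠ : ∀ p r → coefficient (p ⊠ r) ≗ coefficient p ⊛ coefficient r
coefficient-⊠ []      r n       = ≡.sym (⊛-zeroˡ (coefficient r) n)
coefficient-⊠ (c ∷ p) r zero    = begin
  coefficient (map (c ℤ.*_) r ⊞ (0ℤ ∷ p ⊠ r)) 0 ≡⟨ coefficient-⊞ (map (c ℤ.*_) r) _ 0 ⟩
  coefficient (map (c ℤ.*_) r) 0 ℤ.+ 0ℤ         ≡⟨ ≡.trans (ℤ.+-identityʳ _) (coefficient-map c r 0) ⟩
  c ℤ.* coefficient r 0                         ∎
coefficient-⊠ (c ∷ p) r (suc n) = ≡.trans (coefficient-⊞ (map (c ℤ.*_) r) _ (suc n))
  (≡.cong₂ ℤ._+_ (coefficient-map c r (suc n)) (coefficient-⊠ p r n))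

All-⊞ : ∀ {p r} → All (0ℤ ℤ.≤_) p → All (0ℤ ℤ.≤_) r → All (0ℤ ℤ.≤_) (p ⊞ r)
All-⊞ []       rs       = rs
All-⊞ (c ∷ ps) []       = c ∷ ps
All-⊞ (c ∷ ps) (d ∷ rs) = ℤ.+-mono-≤ c d ∷ All-⊞ ps rs

All-⊠ : ∀ {p r} → All (0ℤ ℤ.≤_) p → All (0ℤ ℤ.≤_) r → All (0ℤ ℤ.≤_) (p ⊠ r)
All-⊠ []       rs = []
All-⊠ (c ∷ ps) rs = All-⊞ (All.map⁺ (All.map (0≤* c) rs)) (ℤ.≤-refl ∷ All-⊠ ps rs)
  where
  0≤* : ∀ {i j} → 0ℤ ℤ.≤ i → 0ℤ ℤ.≤ j → 0ℤ ℤ.≤ i ℤ.* j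
  0≤* {+ i} {+ j} _ _ = ≡.subst (0ℤ ℤ.≤_) (ℤ.pos-* i j) (ℤ.+≤+ ℕ.z≤n)

NonNegPoly : Series → Set
NonNegPoly f = ∃[ p ] f ≗ coefficient p × All (0ℤ ℤ.≤_) p

NonNegPoly-resp : ∀ {f g} → f ≗ g → NonNegPoly f → NonNegPoly g
NonNegPoly-resp f≗g (p , f≗p , 0≤p) = p , (λ n → ≡.trans (≡.sym (f≗g n)) (f≗p n)) , 0≤p

NonNegPoly-0 : NonNegPoly 0#
NonNegPoly-0 = [] , (λ _ → ≡.refl) , []

NonNegPoly-1 : NonNegPoly (q^ 0)
NonNegPoly-1 = 1ℤ ∷ [] , (λ { zero → ≡.refl ; (suc n) → ≡.refl }) , ℤ.+≤+ ℕ.z≤n ∷ []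

NonNegPoly-q : NonNegPoly (q^ 1)
NonNegPoly-q = 0ℤ ∷ 1ℤ ∷ [] , (λ { zero → ≡.refl ; (suc zero) → ≡.refl ; (suc (suc n)) → ≡.refl }) ,
  ℤ.≤-refl ∷ ℤ.+≤+ ℕ.z≤n ∷ []

NonNegPoly-+ : ∀ {f g} → NonNegPoly f → NonNegPoly g → NonNegPoly (f ⊕ g)
NonNegPoly-+ (p , f≗p , 0≤p) (r , g≗r , 0≤r) =
  p ⊞ r , (λ n → ≡.trans (≡.cong₂ ℤ._+_ (f≗p n) (g≗r n)) (≡.sym (coefficient-⊞ p r n))) , All-⊞ 0≤p 0≤r

NonNegPoly-* : ∀ {f g} → NonNegPoly f → NonNegPoly g → NonNegPoly (f ⊛ g)
NonNegPoly-* (p , f≗p , 0≤p) (r , g≗r , 0≤r) =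
  p ⊠ r , (λ n → ≡.trans (⊛-cong f≗p g≗r n) (≡.sym (coefficient-⊠ p r n))) , All-⊠ 0≤p 0≤r

open QBinomials seriesRing (q^ 1)
open Positivity NonNegPoly NonNegPoly-resp NonNegPoly-0 NonNegPoly-1 NonNegPoly-q NonNegPoly-+ NonNegPoly-*

-- Agreement of the two q-binomial coefficients.

⟨q⟩≗poch : ∀ m → ⟨q⟩ m ≗ poch m
⟨q⟩≗poch zero    n = ≡.refl
⟨q⟩≗poch (suc m) n = ⊛-cong (⟨q⟩≗poch m) (λ i → ≡.cong (λ x → (q^ 0) i ℤ.- x) (≡.sym (q^-power (suc m) i))) n

qBinomial≗gauss : ∀ x y → qBinomial x y ≗ gauss x y
qBinomial≗gauss (+ m)    (+ n)    = ÷-unique (⟨q⟩ (m ℕ.+ n)) (⟨q⟩ m ⊛ ⟨q⟩ n) (h m n)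
  (≡.cong₂ ℤ._*_ (⟨q⟩₀≡1 m) (⟨q⟩₀≡1 n)) λ k → begin
    (h m n ⊛ (⟨q⟩ m ⊛ ⟨q⟩ n)) k   ≡⟨ ⊛-cong {h m n} (λ _ → ≡.refl) (⊛-cong (⟨q⟩≗poch m) (⟨q⟩≗poch n)) k ⟩
    (h m n ⊛ (poch m ⊛ poch n)) k ≡⟨ h-poch m n k ⟩
    poch (m ℕ.+ n) k              ≡⟨ ⟨q⟩≗poch (m ℕ.+ n) k ⟨
    ⟨q⟩ (m ℕ.+ n) k               ∎
qBinomial≗gauss (+ _)    -[1+ _ ] n = ≡.refl
qBinomial≗gauss -[1+ _ ] _        n = ≡.refl

-- Formal sums with rational exponents.

⌈⌉-cong : ∀ {f g} → f ≗ g → ∀ e → ⌈ f ⌉ e ≡ ⌈ g ⌉ e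
⌈⌉-cong f≗g (mkℚ (+ n)    zero    _) = f≗g n
⌈⌉-cong f≗g (mkℚ (+ n)    (suc _) _) = ≡.refl
⌈⌉-cong f≗g (mkℚ -[1+ _ ] _       _) = ≡.refl

⌈⌉-zero : ∀ {f} → f ≗ 0# → ∀ e → ⌈ f ⌉ e ≡ 0ℤ
⌈⌉-zero f≗0 (mkℚ (+ n)    zero    _) = f≗0 n
⌈⌉-zero f≗0 (mkℚ (+ n)    (suc _) _) = ≡.refl
⌈⌉-zero f≗0 (mkℚ -[1+ _ ] _       _) = ≡.refl

⌈⌉-fraction : ∀ f e → ℚ.denominator-1 e ≢ 0 → ⌈ f ⌉ e ≡ 0ℤ
⌈⌉-fraction f (mkℚ (+ n)    zero    _) den≢0 = contradiction ≡.refl den≢0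
⌈⌉-fraction f (mkℚ (+ n)    (suc _) _) _     = ≡.refl
⌈⌉-fraction f (mkℚ -[1+ _ ] _       _) _     = ≡.refl

⌈⌉-⊕ : ∀ f g e → ⌈ f ⊕ g ⌉ e ≡ ⌈ f ⌉ e ℤ.+ ⌈ g ⌉ e
⌈⌉-⊕ f g (mkℚ (+ n)    zero    _) = ≡.refl
⌈⌉-⊕ f g (mkℚ (+ n)    (suc _) _) = ≡.refl
⌈⌉-⊕ f g (mkℚ -[1+ _ ] _       _) = ≡.refl

⌈⌉-scale : ∀ c f e → ⌈ (λ n → c ℤ.* f n) ⌉ e ≡ c ℤ.* ⌈ f ⌉ e
⌈⌉-scale c f (mkℚ (+ n)    zero    _) = ≡.refl
⌈⌉-scale c f (mkℚ (+ n)    (suc _) _) = ≡.sym (ℤ.*-zeroʳ c)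
⌈⌉-scale c f (mkℚ -[1+ _ ] _       _) = ≡.sym (ℤ.*-zeroʳ c)

-- The constructor form, on which `⌈_⌉` can match; `z ℚ./ 1` is computed through a gcd.
int : ℤ → ℚ
int z = mkℚ z 0 (Coprimality.sym (Coprimality.1-coprimeTo ℤ.∣ z ∣))

/1≡int : ∀ z → z ℚ./ 1 ≡ int z
/1≡int z = ℚ.↥p/↧p≡p (int z)

integral : ∀ e → ℚ.denominator-1 e ≡ 0 → e ≡ int (ℚ.numerator e)
integral (mkℚ z zero _) _ = ≡.refl

/1-+ : ∀ z w → z ℚ./ 1 ℚ.+ w ℚ./ 1 ≡ (z ℤ.+ w) ℚ./ 1
/1-+ z w = ℚ.toℚᵘ-injective (ℚᵘ.≃-trans (ℚ.toℚᵘ-homo-+ (z ℚ./ 1) (w ℚ./ 1))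
  (ℚᵘ.≃-trans (ℚᵘ.+-cong (ℚ.toℚᵘ-fromℚᵘ (ℚᵘ.mkℚᵘ z 0)) (ℚ.toℚᵘ-fromℚᵘ (ℚᵘ.mkℚᵘ w 0)))
    (ℚᵘ.≃-trans (ℚᵘ.*≡* (arith z w)) (ℚᵘ.≃-sym (ℚ.toℚᵘ-fromℚᵘ (ℚᵘ.mkℚᵘ (z ℤ.+ w) 0))))))
  where
  arith : ∀ z w → (z ℤ.* 1ℤ ℤ.+ w ℤ.* 1ℤ) ℤ.* 1ℤ ≡ (z ℤ.+ w) ℤ.* 1ℤ
  arith = ℤSolver.solve-∀

/1-* : ∀ z w → z ℚ./ 1 ℚ.* (w ℚ./ 1) ≡ (z ℤ.* w) ℚ./ 1
/1-* z w = ℚ.toℚᵘ-injective (ℚᵘ.≃-trans (ℚ.toℚᵘ-homo-* (z ℚ./ 1) (w ℚ./ 1))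
  (ℚᵘ.≃-trans (ℚᵘ.*-cong (ℚ.toℚᵘ-fromℚᵘ (ℚᵘ.mkℚᵘ z 0)) (ℚ.toℚᵘ-fromℚᵘ (ℚᵘ.mkℚᵘ w 0)))
    (ℚᵘ.≃-sym (ℚ.toℚᵘ-fromℚᵘ (ℚᵘ.mkℚᵘ (z ℤ.* w) 0)))))

/-cancel : ∀ z d → z ℚ./ suc d ℚ.* (+ suc d ℚ./ 1) ≡ z ℚ./ 1
/-cancel z d = ℚ.toℚᵘ-injective (ℚᵘ.≃-trans (ℚ.toℚᵘ-homo-* (z ℚ./ suc d) (+ suc d ℚ./ 1))
  (ℚᵘ.≃-trans (ℚᵘ.*-cong (ℚ.toℚᵘ-fromℚᵘ (ℚᵘ.mkℚᵘ z d)) (ℚ.toℚᵘ-fromℚᵘ (ℚᵘ.mkℚᵘ (+ suc d) 0)))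
    (ℚᵘ.≃-trans (ℚᵘ.*≡* (≡.trans (ℤ.*-identityʳ (z ℤ.* + suc d)) (≡.cong (λ x → z ℤ.* + suc x) (≡.sym (ℕ.*-identityʳ d)))))
      (ℚᵘ.≃-sym (ℚ.toℚᵘ-fromℚᵘ (ℚᵘ.mkℚᵘ z 0))))))

+k-k : ∀ x k → x ℚ.+ + k ℚ./ 1 ℚ.+ (ℤ.- + k) ℚ./ 1 ≡ x
+k-k x k = ≡.trans (ℚ.+-assoc x _ _)
  (≡.trans (≡.cong (x ℚ.+_) (≡.trans (/1-+ (+ k) (ℤ.- + k)) (≡.cong (ℚ._/ 1) (ℤ.+-inverseʳ (+ k))))) (ℚ.+-identityʳ x))

-- For integral d this is a shift of coefficients. For fractional d both sides are 0: if d + k were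
-- integral, so would be d = (d + k) - k.
⌈⌉-shift : ∀ k f d → ⌈ f ⌉ d ≡ ⌈ q^ k ⊛ f ⌉ (d ℚ.+ + k ℚ./ 1)
⌈⌉-shift k f (mkℚ z zero c) = ≡.trans (integer z) (≡.cong ⌈ q^ k ⊛ f ⌉ (≡.sym (≡.trans
    (≡.cong (ℚ._+ + k ℚ./ 1) (≡.sym (/1≡int z))) (≡.trans (/1-+ z (+ k)) (/1≡int (z ℤ.+ + k))))))
  where
  integer : ∀ z → ⌈ f ⌉ (int z) ≡ ⌈ q^ k ⊛ f ⌉ (int (z ℤ.+ + k))
  integer (+ n) = ≡.trans (≡.sym (q^-⊛-shift k f n)) (≡.cong (q^ k ⊛ f) (ℕ.+-comm k n))
  integer -[1+ n ] with split k (suc n)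
  ... | inj₁ (r , ≡.refl) = ≡.cong (λ x → ⌈ q^ k ⊛ f ⌉ (int x)) (≡.sym (arith (+ k) (+ r)))
    where
    arith : ∀ k r → ℤ.- (+ 1 ℤ.+ (k ℤ.+ r)) ℤ.+ k ≡ ℤ.- (+ 1 ℤ.+ r)
    arith = ℤSolver.solve-∀
  ... | inj₂ (r , ≡.refl) = ≡.trans (≡.sym (q^-⊛-below k f r (ℕ.s≤s (ℕ.m≤n+m r n))))
    (≡.cong (λ x → ⌈ q^ k ⊛ f ⌉ (int x)) (≡.sym (arith (+ n) (+ r))))
    where
    arith : ∀ n r → ℤ.- (+ 1 ℤ.+ n) ℤ.+ (+ 1 ℤ.+ n ℤ.+ r) ≡ r
    arith = ℤSolver.solve-∀
⌈⌉-shift k f d@(mkℚ z (suc b) c) = ≡.trans (⌈⌉-fraction f d λ ()) (≡.sym (⌈⌉-fraction (q^ k ⊛ f) (d ℚ.+ + k ℚ./ 1) λ den≡0 →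
  contradiction (≡.cong ℚ.denominator-1 (begin
    d                                     ≡⟨ +k-k d k ⟨
    d ℚ.+ + k ℚ./ 1 ℚ.+ (ℤ.- + k) ℚ./ 1   ≡⟨ ≡.cong (ℚ._+ (ℤ.- + k) ℚ./ 1)
      (≡.trans (integral (d ℚ.+ + k ℚ./ 1) den≡0) (≡.sym (/1≡int num))) ⟩
    num ℚ./ 1 ℚ.+ (ℤ.- + k) ℚ./ 1         ≡⟨ /1-+ num (ℤ.- + k) ⟩
    (num ℤ.- + k) ℚ./ 1                   ≡⟨ /1≡int (num ℤ.- + k) ⟩
    int (num ℤ.- + k)                     ∎)) λ ()))
  where
  num = ℚ.numerator (d ℚ.+ + k ℚ./ 1)

q^·-integer : ∀ k f e → (q^ + k ℚ./ 1 · f) e ≡ ⌈ (q^ 1) ^ k ⊛ f ⌉ e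
q^·-integer k f e = begin
  ⌈ f ⌉ (e ℚ.- + k ℚ./ 1)                         ≡⟨ ⌈⌉-shift k f (e ℚ.- + k ℚ./ 1) ⟩
  ⌈ q^ k ⊛ f ⌉ (e ℚ.- + k ℚ./ 1 ℚ.+ + k ℚ./ 1)     ≡⟨ ≡.cong ⌈ q^ k ⊛ f ⌉ (≡.trans (ℚ.+-assoc e _ _)
       (≡.trans (≡.cong (e ℚ.+_) (ℚ.+-inverseˡ (+ k ℚ./ 1))) (ℚ.+-identityʳ e))) ⟩
  ⌈ q^ k ⊛ f ⌉ e                                  ≡⟨ ⌈⌉-cong (⊛-cong {g = f} (λ n → ≡.sym (q^-power k n)) (λ _ → ≡.refl)) e ⟩
  ⌈ (q^ 1) ^ k ⊛ f ⌉ e                            ∎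

-- Exponents and summands of `G`.

⋆-correct : ∀ t j → t ⋆ j ≡ + t ℤ.* j
⋆-correct t (+ n)    = ℤ.pos-* t n
⋆-correct t -[1+ n ] = ≡.trans (≡.cong (λ x → ℤ.- (+ t ℤ.+ x)) (ℤ.pos-* t n)) (arith (+ t) (+ n))
  where
  arith : ∀ t n → ℤ.- (t ℤ.+ t ℤ.* n) ≡ t ℤ.* ℤ.- (+ 1 ℤ.+ n)
  arith = ℤSolver.solve-∀

K⋆-correct : ∀ ν j → + (1 ℕ.+ 2 ℕ.* ν) ℤ.* j ≡ j ℤ.+ ν ⋆ j ℤ.+ ν ⋆ j
K⋆-correct ν j = ≡.trans (arith (+ ν) j) (≡.cong (λ x → j ℤ.+ x ℤ.+ x) (≡.sym (⋆-correct ν j)))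
  where
  arith : ∀ ν j → (+ 1 ℤ.+ (ν ℤ.+ (ν ℤ.+ + 0))) ℤ.* j ≡ j ℤ.+ ν ℤ.* j ℤ.+ ν ℤ.* j
  arith = ℤSolver.solve-∀

ex-K-correct : ∀ s y j → + ex-K s y j ≡
  + (s ℕ.+ y ℕ.+ 1) ℤ.* j ℤ.* (+ (1 ℕ.+ 2 ℕ.* (s ℕ.+ y)) ℤ.* j ℤ.+ + (1 ℕ.+ 2 ℕ.* s))
ex-K-correct s y (+ n) = ≡.trans (ℤ.pos-* (n ℕ.+ (s ℕ.+ y) ℕ.* n) _)
  (≡.trans (≡.cong (λ T → (+ n ℤ.+ T) ℤ.* (+ n ℤ.+ (T ℤ.+ T) ℤ.+ + suc (s ℕ.+ s))) (ℤ.pos-* (s ℕ.+ y) n))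
    (arith (+ s) (+ y) (+ n)))
  where
  arith : ∀ s y n → (n ℤ.+ (s ℤ.+ y) ℤ.* n) ℤ.* (n ℤ.+ ((s ℤ.+ y) ℤ.* n ℤ.+ (s ℤ.+ y) ℤ.* n) ℤ.+ (+ 1 ℤ.+ (s ℤ.+ s))) ≡
    (s ℤ.+ y ℤ.+ + 1) ℤ.* n ℤ.*
      ((+ 1 ℤ.+ ((s ℤ.+ y) ℤ.+ ((s ℤ.+ y) ℤ.+ + 0))) ℤ.* n ℤ.+ (+ 1 ℤ.+ (s ℤ.+ (s ℤ.+ + 0))))
  arith = ℤSolver.solve-∀
ex-K-correct s y -[1+ n ] = ≡.trans (ℤ.pos-* (suc (s ℕ.+ y) ℕ.+ (n ℕ.+ (s ℕ.+ y) ℕ.* n)) _)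
  (≡.trans (≡.cong (λ T → (+ suc (s ℕ.+ y) ℤ.+ (+ n ℤ.+ T)) ℤ.* (+ n ℤ.+ (T ℤ.+ T) ℤ.+ + (y ℕ.+ y))) (ℤ.pos-* (s ℕ.+ y) n))
    (arith (+ s) (+ y) (+ n)))
  where
  arith : ∀ s y n → (+ 1 ℤ.+ (s ℤ.+ y) ℤ.+ (n ℤ.+ (s ℤ.+ y) ℤ.* n)) ℤ.*
      (n ℤ.+ ((s ℤ.+ y) ℤ.* n ℤ.+ (s ℤ.+ y) ℤ.* n) ℤ.+ (y ℤ.+ y)) ≡
    (s ℤ.+ y ℤ.+ + 1) ℤ.* ℤ.- (+ 1 ℤ.+ n) ℤ.*
      ((+ 1 ℤ.+ ((s ℤ.+ y) ℤ.+ ((s ℤ.+ y) ℤ.+ + 0))) ℤ.* ℤ.- (+ 1 ℤ.+ n) ℤ.+ (+ 1 ℤ.+ (s ℤ.+ (s ℤ.+ + 0))))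
  arith = ℤSolver.solve-∀

α β : ℕ → ℕ → ℚ
α ν s = + (ν ℕ.+ 1) ℚ./ 1 ℚ.* (1ℚ ℚ.+ + (1 ℕ.+ 2 ℕ.* s) ℚ./ (1 ℕ.+ 2 ℕ.* ν))
β ν s = + (ν ℕ.+ 1) ℚ./ 1 ℚ.* (1ℚ ℚ.- + (1 ℕ.+ 2 ℕ.* s) ℚ./ (1 ℕ.+ 2 ℕ.* ν))

-- The sum α + β is 2(ν + 1), and K (α - β) is 2(ν + 1)(1 + 2s) because the fraction in α and β has
-- denominator K; so the exponent is an integer.
exponent-integral : ∀ s y j → let ν = s ℕ.+ y in
  exponent (α ν s) (β ν s) (1 ℕ.+ 2 ℕ.* ν) j ≡ + ex-K s y j ℚ./ 1
exponent-integral s y j = begin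
  exponent (α ν s) (β ν s) K j                   ≡⟨ ring a x κ J ⟩
  a ℚ.* J ℚ.* (κ ℚ.* J ℚ.+ x ℚ.* κ)              ≡⟨ ≡.cong₂ ℚ._*_ (/1-* (+ (ν ℕ.+ 1)) j)
    (≡.trans (≡.cong₂ ℚ._+_ (/1-* (+ K) j) (/-cancel (+ c) (2 ℕ.* ν))) (/1-+ (+ K ℤ.* j) (+ c))) ⟩
  (+ (ν ℕ.+ 1) ℤ.* j) ℚ./ 1 ℚ.* ((+ K ℤ.* j ℤ.+ + c) ℚ./ 1)
    ≡⟨ ≡.trans (/1-* (+ (ν ℕ.+ 1) ℤ.* j) (+ K ℤ.* j ℤ.+ + c)) (≡.cong (ℚ._/ 1) (≡.sym (ex-K-correct s y j))) ⟩
  + ex-K s y j ℚ./ 1                             ∎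
  where
  ν = s ℕ.+ y
  K = 1 ℕ.+ 2 ℕ.* ν
  c = 1 ℕ.+ 2 ℕ.* s
  a = + (ν ℕ.+ 1) ℚ./ 1
  x = + c ℚ./ K
  κ = + K ℚ./ 1
  J = j ℚ./ 1
  open ℚSolver.+-*-Solver
  ring : ∀ a x κ J →
    κ ℚ.* J ℚ.* (((a ℚ.* (1ℚ ℚ.+ x) ℚ.+ a ℚ.* (1ℚ ℚ.- x)) ℚ.* J ℚ.+ (a ℚ.* (1ℚ ℚ.+ x) ℚ.- a ℚ.* (1ℚ ℚ.- x))) ℚ.* ½) ≡
    a ℚ.* J ℚ.* (κ ℚ.* J ℚ.+ x ℚ.* κ)
  ring = solve 4 (λ a x κ J →
    κ :* J :* (((a :* (con 1ℚ :+ x) :+ a :* (con 1ℚ :- x)) :* J :+ (a :* (con 1ℚ :+ x) :- a :* (con 1ℚ :- x))) :* con ½)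
    := a :* J :* (κ :* J :+ x :* κ)) ≡.refl

summand-K-term : ∀ s y L j e → let ν = s ℕ.+ y in
  summand L (L ℕ.+ 1 ℕ.+ 2 ℕ.* s) (α ν s) (β ν s) (1 ℕ.+ 2 ℕ.* ν) j e ≡ ⌈ K-term s y L j ⌉ e
summand-K-term s y L j e = begin
  sign ℤ.* (q^ exponent (α ν s) (β ν s) K j · binomial) e
    ≡⟨ ≡.cong (λ r → sign ℤ.* (q^ r · binomial) e) (exponent-integral s y j) ⟩
  sign ℤ.* (q^ + ex-K s y j ℚ./ 1 · binomial) e
    ≡⟨ ≡.cong (sign ℤ.*_) (q^·-integer (ex-K s y j) binomial e) ⟩
  sign ℤ.* ⌈ (q^ 1) ^ ex-K s y j ⊛ binomial ⌉ e
    ≡⟨ ⌈⌉-scale sign ((q^ 1) ^ ex-K s y j ⊛ binomial) e ⟨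
  ⌈ (λ n → sign ℤ.* ((q^ 1) ^ ex-K s y j ⊛ binomial) n) ⌉ e
    ≡⟨ ⌈⌉-cong (λ n → ≡.trans (≡.sym (sign-⊛ ℤ.∣ j ∣ ((q^ 1) ^ ex-K s y j ⊛ binomial) n))
         (⊛-cong {σ j} (λ _ → ≡.refl) (⊛-cong {(q^ 1) ^ ex-K s y j} (λ _ → ≡.refl) binomial≗) n)) e ⟩
  ⌈ K-term s y L j ⌉ e ∎
  where
  ν = s ℕ.+ y
  K = 1 ℕ.+ 2 ℕ.* ν
  M = L ℕ.+ 1 ℕ.+ 2 ℕ.* s
  sign = -1ℤ ℤ.^ ℤ.∣ j ∣
  Kj = j ℤ.+ ν ⋆ j ℤ.+ ν ⋆ j
  binomial = [ + (L ℕ.+ M) choose + L ℤ.- + K ℤ.* j ]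
  complement : ∀ L s x → L ℤ.+ (L ℤ.+ + 1 ℤ.+ (s ℤ.+ (s ℤ.+ + 0))) ℤ.- (L ℤ.- x) ≡ L ℤ.+ (+ 1 ℤ.+ (s ℤ.+ s)) ℤ.+ x
  complement = ℤSolver.solve-∀
  binomial≗ : binomial ≗ gauss (+ L ℤ.- Kj) (+ L ℤ.+ + suc (s ℕ.+ s) ℤ.+ Kj)
  binomial≗ n = ≡.trans (qBinomial≗gauss (+ L ℤ.- + K ℤ.* j) (+ (L ℕ.+ M) ℤ.- (+ L ℤ.- + K ℤ.* j)) n)
    (≡.cong (λ f → f n) (≡.cong₂ gauss (≡.cong (λ x → + L ℤ.- x) (K⋆-correct ν j))
      (≡.trans (≡.cong (λ x → + (L ℕ.+ M) ℤ.- (+ L ℤ.- x)) (K⋆-correct ν j)) (complement (+ L) (+ s) Kj))))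

-- Matching the summation ranges.

-- `Σ∣j∣≤` pairs n with -n and `Σℤ` pairs n with -1 - n, so the ranges differ by the single index -1
-- - J.
⌈Σℤ⌉ : ∀ J f e → ⌈ Σℤ (suc J) f ⌉ e ≡ Σ∣j∣≤ J (λ j → ⌈ f j ⌉ e) ℤ.+ ⌈ f -[1+ J ] ⌉ e
⌈Σℤ⌉ zero f e = begin
  ⌈ 0# ⊕ (f (+ 0) ⊕ f -[1+ 0 ]) ⌉ e       ≡⟨ ⌈⌉-cong (λ n → ℤ.+-identityˡ _) e ⟩
  ⌈ f (+ 0) ⊕ f -[1+ 0 ] ⌉ e              ≡⟨ ⌈⌉-⊕ (f (+ 0)) (f -[1+ 0 ]) e ⟩
  ⌈ f (+ 0) ⌉ e ℤ.+ ⌈ f -[1+ 0 ] ⌉ e      ∎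
⌈Σℤ⌉ (suc J) f e = begin
  ⌈ Σℤ (suc J) f ⊕ (f (+ suc J) ⊕ f -[1+ suc J ]) ⌉ e
    ≡⟨ ≡.trans (⌈⌉-⊕ (Σℤ (suc J) f) _ e) (≡.cong₂ ℤ._+_ (⌈Σℤ⌉ J f e) (⌈⌉-⊕ (f (+ suc J)) (f -[1+ suc J ]) e)) ⟩
  Σ∣j∣≤ J (λ j → ⌈ f j ⌉ e) ℤ.+ ⌈ f -[1+ J ] ⌉ e ℤ.+ (⌈ f (+ suc J) ⌉ e ℤ.+ ⌈ f -[1+ suc J ] ⌉ e)
    ≡⟨ arith (Σ∣j∣≤ J (λ j → ⌈ f j ⌉ e)) (⌈ f -[1+ J ] ⌉ e) (⌈ f (+ suc J) ⌉ e) (⌈ f -[1+ suc J ] ⌉ e) ⟩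
  Σ∣j∣≤ J (λ j → ⌈ f j ⌉ e) ℤ.+ (⌈ f (+ suc J) ⌉ e ℤ.+ ⌈ f -[1+ J ] ⌉ e) ℤ.+ ⌈ f -[1+ suc J ] ⌉ e ∎
  where
  arith : ∀ a b c d → a ℤ.+ b ℤ.+ (c ℤ.+ d) ≡ a ℤ.+ (c ℤ.+ b) ℤ.+ d
  arith = ℤSolver.solve-∀

Σ∣j∣≤-cong : ∀ J {f g} → f ≗ g → Σ∣j∣≤ J f ≡ Σ∣j∣≤ J g
Σ∣j∣≤-cong zero    f≗g = f≗g 0ℤ
Σ∣j∣≤-cong (suc J) f≗g = ≡.cong₂ ℤ._+_ (Σ∣j∣≤-cong J f≗g) (≡.cong₂ ℤ._+_ (f≗g (+ suc J)) (f≗g -[1+ J ]))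

-- Disposes of the extra index j = -1 - J, where L + 1 + 2s + K j is negative.
K-term-vanish : ∀ s y L J → L ℕ.+ suc (s ℕ.+ s) ℕ.≤ J → K-term s y L -[1+ J ] ≗ 0#
K-term-vanish s y L J M≤J = ≈0ʳ (σ -[1+ J ]) (≈0ʳ _ (gauss-negʳ (+ L ℤ.- Kj)
  (≡.subst (ℤ._< 0ℤ) (≡.sym (arith (+ L) (+ suc (s ℕ.+ s)) (+ J) (+ T)))
    (ℤ.+-mono-<-≤ {y = 0ℤ} (below (L ℕ.+ suc (s ℕ.+ s)) (suc J) (ℕ.s≤s M≤J)) (ℤ.neg-≤-pos {T ℕ.+ T} {0})))))
  where
  T = s ℕ.+ y ℕ.+ (s ℕ.+ y) ℕ.* J
  Kj = -[1+ J ] ℤ.+ (s ℕ.+ y) ⋆ -[1+ J ] ℤ.+ (s ℕ.+ y) ⋆ -[1+ J ]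
  arith : ∀ L c J T → L ℤ.+ c ℤ.+ (ℤ.- (+ 1 ℤ.+ J) ℤ.+ ℤ.- T ℤ.+ ℤ.- T) ≡ L ℤ.+ c ℤ.- (+ 1 ℤ.+ J) ℤ.+ ℤ.- (T ℤ.+ T)
  arith = ℤSolver.solve-∀

G≡ΣK-term : ∀ s y L e → let ν = s ℕ.+ y; M = L ℕ.+ 1 ℕ.+ 2 ℕ.* s in
  G L M (α ν s) (β ν s) (1 ℕ.+ 2 ℕ.* ν) e ≡ ⌈ Σℤ (suc (L ℕ.+ M)) (K-term s y L) ⌉ e
G≡ΣK-term s y L e = begin
  Σ∣j∣≤ J (λ j → summand L M (α ν s) (β ν s) (1 ℕ.+ 2 ℕ.* ν) j e)
    ≡⟨ Σ∣j∣≤-cong J (λ j → summand-K-term s y L j e) ⟩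
  Σ∣j∣≤ J (λ j → ⌈ K-term s y L j ⌉ e)
    ≡⟨ ℤ.+-identityʳ _ ⟨
  Σ∣j∣≤ J (λ j → ⌈ K-term s y L j ⌉ e) ℤ.+ 0ℤ
    ≡⟨ ≡.cong (λ z → Σ∣j∣≤ J (λ j → ⌈ K-term s y L j ⌉ e) ℤ.+ z) (⌈⌉-zero (K-term-vanish s y L J
         (≡.subst (ℕ._≤ J) (arith L s) (ℕ.m≤n+m M L))) e) ⟨
  Σ∣j∣≤ J (λ j → ⌈ K-term s y L j ⌉ e) ℤ.+ ⌈ K-term s y L -[1+ J ] ⌉ e
    ≡⟨ ⌈Σℤ⌉ J (K-term s y L) e ⟨
  ⌈ Σℤ (suc J) (K-term s y L) ⌉ e ∎
  where
  ν = s ℕ.+ y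
  M = L ℕ.+ 1 ℕ.+ 2 ℕ.* s
  J = L ℕ.+ M
  arith : ∀ L s → L ℕ.+ 1 ℕ.+ 2 ℕ.* s ≡ L ℕ.+ suc (s ℕ.+ s)
  arith = ℕSolver.solve-∀

theorem1p2 : ∀ (L ν s : ℕ) → ν ≥ 1 → s < ν →
    G L (L ℕ.+ 1 ℕ.+ 2 ℕ.* s)
    (+ (ν ℕ.+ 1) / 1 * (1ℚ + + (1 ℕ.+ 2 ℕ.* s) / (1 ℕ.+ 2 ℕ.* ν)))
    (+ (ν ℕ.+ 1) / 1 * (1ℚ - + (1 ℕ.+ 2 ℕ.* s) / (1 ℕ.+ 2 ℕ.* ν)))
    (1 ℕ.+ 2 ℕ.* ν) ≥0
theorem1p2 L ν s _ s<ν with y , ≡.refl ← ℕ.m≤n⇒∃[o]m+o≡n (ℕ.<⇒≤ s<ν) =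
  -- Writing ν as s + y keeps the exponents in the natural numbers for either sign of j. The cut-off
  -- is that of `G`, the sum of its first two arguments, which is at least L as positivity requires.
  let p , Σ≗p , 0≤p = Pos-Σ-K-term s y (L ℕ.+ (L ℕ.+ 1 ℕ.+ 2 ℕ.* s)) L (ℕ.m≤m+n L _)
  in  p , (λ e → ≡.trans (G≡ΣK-term s y L e) (⌈⌉-cong Σ≗p e)) , 0≤p
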